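{- Let $m$ be a positive integer and $c\ge2m+1$. Let $G$ be a graph with a spanning subgraph $F$ such that every $m$-tree-connected component $C$ of $F$ contains at least $c-\frac{c-1}{2m}d_F(C)$ vertices. If for all $S\subseteq V(G)$, $$\omega(G\setminus S)\le\frac{c-2m}{2m(c-1)}|S|+1,$$ then for any given vertex $u$, $G$ has an $m$-tree-connected spanning subgraph $H$ containing $F$ such that $d_H(v)\le d_F(v)+1$ for each vertex $v$, and $d_H(u)=d_F(u)$.
   Context: All graphs are finite, without loops, multiple edges allowed. A graph is $m$-tree-connected if it has $m$ edge-disjoint spanning trees (a one-vertex graph is). The $m$-tree-connected components of $F$ are its maximal induced $m$-tree-connected subgraphs, whose vertex sets partition $V(F)$. For a subgraph $C$, $d_F(C)$ is the number of edges of $F$ with exactly one end in $V(C)$. $\omega$ counts components; $G\setminus S$ deletes $S$.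
   Formalization: The number c is taken rational rather than real; the real case follows, since for given G and F the hypotheses are finitely many linear inequalities in c with integer coefficients and the conclusion does not involve c. -}

module Defs where

open import Data.Nat as ℕ using (ℕ)
open import Data.Integer as ℤ using (ℤ)
open import Data.Rational as ℚ using (ℚ; _/_)
open import Data.Fin using (Fin; _≟_)
open import Data.Fin.Subset using (Subset; _∈_; _∉_; ∣_∣; _∩_; ∁; ⁅_⁆; Nonempty; _⊆_)
open import Data.Vec using (tabulate; lookup)
open import Data.Bool using (Bool; _∧_; _∨_; _xor_; not)
open import Data.Product using (Σ; ∃; _×_; _,_; proj₁; proj₂)
open import Data.Sum using (_⊎_)
open import Relation.Binary.PropositionalEquality using (_≡_; _≢_)
open import Relation.Nullary using (¬_; ⌊_⌋)

toℚ : ℕ → ℚ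
toℚ n = ℤ.+ n / 1

-- A finite loopless multigraph: vertices Fin n, edges Fin k, each edge
-- labelled by its (ordered) pair of distinct ends. Parallel edges allowed.
record Graph : Set where
  field
    n        : ℕ
    k        : ℕ
    ends     : Fin k → Fin n × Fin n
    loopless : ∀ e → proj₁ (ends e) ≢ proj₂ (ends e)

module _ (G : Graph) where
  open Graph G

  -- spanning subgraphs are given by their edge sets
  EdgeSet : Set
  EdgeSet = Subset k

  VertexSet : Set
  VertexSet = Subset n

  Joins : Fin k → Fin n → Fin n → Set
  Joins e u w = ends e ≡ (u , w) ⊎ ends e ≡ (w , u)

  data Reach (X : EdgeSet) : Fin n → Fin n → Set where
    here : ∀ {v} → Reach X v v
    step : ∀ {u w v} e → e ∈ X → Joins e u w → Reach X w v → Reach X u v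

  deg : EdgeSet → Fin n → ℕ
  deg X v = ∣ X ∩ tabulate (λ e → ⌊ v ≟ proj₁ (ends e) ⌋ ∨ ⌊ v ≟ proj₂ (ends e) ⌋) ∣

  inside : VertexSet → EdgeSet
  inside W = tabulate (λ e → lookup W (proj₁ (ends e)) ∧ lookup W (proj₂ (ends e)))

  boundary : EdgeSet → VertexSet → ℕ
  boundary X W = ∣ X ∩ tabulate (λ e → lookup W (proj₁ (ends e)) xor lookup W (proj₂ (ends e))) ∣

  -- T is (the edge set of) a spanning tree of the graph (W , Y):
  -- T ⊆ Y, T connects all vertices of W, and T is acyclic
  -- (every edge of T is a bridge of T, i.e. removing it disconnects its ends).
  SpanningTree : VertexSet → EdgeSet → EdgeSet → Set
  SpanningTree W Y T =
    (T ⊆ Y) ×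
    (∀ u v → u ∈ W → v ∈ W → Reach T u v) ×
    (∀ e → e ∈ T → ¬ Reach (T ∩ ∁ ⁅ e ⁆) (proj₁ (ends e)) (proj₂ (ends e)))

  TreeConnected : ℕ → EdgeSet → VertexSet → Set
  TreeConnected m X W =
    Σ (Fin m → EdgeSet) λ T →
      (∀ i → SpanningTree W (X ∩ inside W) (T i)) ×
      (∀ i j → i ≢ j → ∀ e → e ∈ T i → e ∉ T j)

  TreeComponent : ℕ → EdgeSet → VertexSet → Set
  TreeComponent m X W =
    Nonempty W × TreeConnected m X W ×
    (∀ W′ → W ⊆ W′ → TreeConnected m X W′ → W′ ≡ W)

  avoid : VertexSet → EdgeSet
  avoid S = tabulate (λ e → not (lookup S (proj₁ (ends e))) ∧ not (lookup S (proj₂ (ends e))))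

  -- ω(G \ S) = j : the connected components of G \ S are in bijection with Fin j,
  -- via a surjective labelling f of V \ S whose fibres are exactly the components.
  NumComponents : VertexSet → ℕ → Set
  NumComponents S j =
    Σ ((v : Fin n) → v ∉ S → Fin j) λ f →
      (∀ i → ∃ λ v → Σ (v ∉ S) λ p → f v p ≡ i) ×
      (∀ u v (p : u ∉ S) (q : v ∉ S) →
         (f u p ≡ f v q → Reach (avoid S) u v) × (Reach (avoid S) u v → f u p ≡ f v q))

{-# OPTIONS --safe #-}

-- Call an edge set X m-sparse if every nonempty vertex set W spans at most m(|W| - 1) edges of X, and call W tight
-- in X if equality holds.  By Nash-Williams' arboricity theorem m-sparse sets decompose into m forests, so a tight set
-- is m-tree-connected, and tight sets that meet have a tight union; the maximal ones partition the vertices.  Let B be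
-- a maximal m-sparse subset of F and M a maximum matching of edges outside F that avoids u and keeps B ∪ M m-sparse.
-- If |B ∪ M| = m(n - 1), then H = F ∪ M works.  Otherwise collect, one at a time, vertices that cannot be freed from M
-- by a modification inside a single tight set, and let S be a maximal set obtained in this way.  Deleting from B ∪ M
-- the edges of M at S leaves a set J, and every edge of G between different classes of J is in J or meets S.
-- Enlarge S to S' greedily: the classes are treated one after the other, those meeting S first; if a class has more
-- vertices outside S than J-edges to the surviving earlier classes, it survives and only its ends of these edges are
-- added, and otherwise it is swallowed entirely.  Then G \ S' has at least as many components as there are surviving
-- classes, and adding up the size bounds of the classes contradicts the toughness condition.

module Submission where

open import Defs
open import Data.Nat using (ℕ; zero; suc; _≤_; _<_; _+_; _*_; _∸_; z≤n; s≤s; _≤?_)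
open import Data.Nat.Properties
open import Data.Nat.Tactic.RingSolver using (solve-∀)
open import Data.Fin as Fin using (Fin; zero; suc; toℕ)
open import Data.Fin.Properties using (any?; all?; toℕ-injective; toℕ<n)
  renaming (suc-injective to Fin-suc-injective)
open import Data.Fin.Subset using (Subset; _∈_; _∉_; _⊆_; ⊤; ∣_∣; ∁; ⁅_⁆) renaming (_∩_ to _∩ˢ_; _∪_ to _∪ˢ_)
open import Data.Fin.Subset.Properties using (x∈p∩q⁺; x∈p∩q⁻; x∈∁p⇒x∉p; x∈⁅x⁆; ∈⊤; ⊆-antisym; p⊆p∪q; anySubset?; _⊆?_)
open import Data.Vec using (Vec; tabulate; lookup; []; _∷_)
open import Data.Vec.Properties using ([]=⇒lookup; lookup⇒[]=; lookup∘tabulate; lookup-zipWith)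
open import Data.Bool using (Bool; true; false; _∧_; _∨_; _xor_; not; if_then_else_)
open import Data.Product using (Σ; ∃; _×_; _,_; proj₁; proj₂)
open import Data.Sum using (_⊎_; inj₁; inj₂)
open import Data.Empty using (⊥; ⊥-elim)
open import Data.List using (List; []; _∷_)
open import Data.Unit using (tt) renaming (⊤ to Unit)
open import Function using (_∘_)
open import Relation.Binary.PropositionalEquality
  using (_≡_; _≢_; refl; sym; trans; cong; cong₂; subst; subst₂)
open import Relation.Nullary using (¬_; Dec; yes; no; ⌊_⌋; contradiction)
open import Relation.Nullary.Decidable using (toWitness; map′; _→-dec_; _×-dec_)
open import Axiom.UniquenessOfIdentityProofs using (module Decidable⇒UIP)
open import Data.Integer as ℤ using (ℤ; -[1+_])
import Data.Integer.Properties as ℤ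
open import Data.Nat.Coprimality as Coprime using (1-coprimeTo)
open import Data.Rational as ℚ using (ℚ; mkℚ)
  renaming (_≤_ to _≤ℚ_; _+_ to _+ℚ_; _*_ to _*ℚ_; _-_ to _-ℚ_)
import Data.Rational.Properties as ℚ
open import Data.Rational.Solver using (module +-*-Solver)
open import Data.Rational.Unnormalised using (mkℚᵘ; *≡*)
open import Algebra.Properties.CommutativeMonoid.Sum +-0-commutativeMonoid
  using () renaming (sum to vsum; sum-cong-≗ to vsum-cong; ∑-distrib-+ to vsum-+; ∑-comm to vsum-swap; sum-replicate-zero to vsum-zero)
open import Algebra.Properties.Semiring.Sum +-*-semiring using () renaming (*-distribˡ-sum to vsum-*)

-- Since the conclusion is decidable, existence statements on the way to it may be used in doubly negated form.

-- Why no edge of `G` outside `F` and `J` can miss `S` and join two classes of `J`: its ends could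
-- be freed in disjoint tight sets, hence by one matching, and then the edge would either enlarge
-- the matching or free a vertex of `S` after all. So the missing connections are due to `S` alone,
-- and each vertex of `S` except `u` is an end of a deleted edge of `M`. The obstacle is that edges
-- of `J` still join classes outside `S`, and deleting one end of each may use up a small class. The
-- survival rule leaves a vertex in each surviving class. A swallowed class has few vertices
-- compared with its back edges, so the size hypothesis gives it many crossing edges, of which
-- sparsity allows fewer than `m` per class on average. Treating the classes that meet `S` before
-- the others keeps their back edges among themselves, where sparsity gives a second bound that
-- helps to pay for `S`. The hypothesis concerns components of `F`, which are the classes of `B`; it
-- passes to the coarser classes of `J` because sparsity limits the edges between the parts.

by-cases : ∀ {a} (P : Set a) → (P → ⊥) → (¬ P → ⊥) → ⊥
by-cases P y n = n y

choice : ∀ {a n} {P : Fin n → Set a} → (∀ i → (P i → ⊥) → ⊥) → ((∀ i → P i) → ⊥) → ⊥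
choice {n = zero}  h k = k (λ ())
choice {n = suc n} h k =
  h zero λ p → choice (h ∘ suc) λ ps → k λ { zero → p ; (suc i) → ps i }

argmin : ∀ {a} {A : Set a} (μ : A → ℕ) → A → ((a : A) → (∀ b → μ a ≤ μ b) → ⊥) → ⊥
argmin {A = A} μ a₀ k = go (suc (μ a₀)) a₀ ≤-refl
  where
  go : ∀ N a → μ a < N → ⊥
  go (suc N) a (s≤s a≤N) = k a λ b → case b
    where
    case : ∀ b → μ a ≤ μ b
    case b with μ a ≤? μ b
    ... | yes p = p
    ... | no ¬p = ⊥-elim (go N b (<-≤-trans (≰⇒> ¬p) a≤N))

-- Linear inequalities

-- A certificate for linear arithmetic: b - a exceeds R - L by d.

lin : ∀ {a b L R} d → L ≤ R → a + R + d ≡ b + L → a ≤ b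
lin {a} {b} {L} {R} d L≤R eq = +-cancelʳ-≤ R a b
  (≤-trans (m≤m+n (a + R) d) (≤-trans (≤-reflexive eq) (+-monoʳ-≤ b L≤R)))

lin-absurd : ∀ {L R} d → L ≤ R → suc (R + d) ≡ L → ⊥
lin-absurd {R = R} d L≤R eq = <⇒≱ (s≤s (m≤m+n R d)) (≤-trans (≤-reflexive eq) L≤R)

infixr 6 _⊕_
_⊕_ : ∀ {a b c d} → a ≤ b → c ≤ d → a + c ≤ b + d
_⊕_ = +-mono-≤

mul-mono : ∀ m {a b} → a ≤ b → m * a ≤ m * b
mul-mono m = *-monoʳ-≤ m

-- Booleans and indicators

[_] : Bool → ℕ
[ false ] = 0
[ true ]  = 1

-- Makes truth tables available: in the counting lemmas the contribution of a single edge or vertex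
-- is a Boolean expression, and `toWitness` checks all its cases.
∀B? : ∀ {a} {P : Bool → Set a} → (∀ b → Dec (P b)) → Dec (∀ b → P b)
∀B? d = map′ (λ { (p , q) → λ { false → p ; true → q } }) (λ h → h false , h true) (d false ×-dec d true)

infix 4 _≟B_
_≟B_ = Data.Bool._≟_

[]≤1 : ∀ b → [ b ] ≤ 1
[]≤1 false = z≤n
[]≤1 true  = ≤-refl

∧-left : ∀ x {y} → x ∧ y ≡ true → x ≡ true
∧-left true _ = refl

∧-right : ∀ x {y} → x ∧ y ≡ true → y ≡ true
∧-right true h = h

∨-right : ∀ x {y} → y ≡ true → x ∨ y ≡ true
∨-right false h = h
∨-right true  _ = refl

true-∧ : ∀ {x y} → x ≡ true → y ≡ true → x ∧ y ≡ true
true-∧ refl refl = refl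

not-true : ∀ {x} → not x ≡ true → x ≡ false
not-true {false} _ = refl

true≢false : ∀ {x} → x ≡ true → x ≡ false → ⊥
true≢false refl ()

≢true : ∀ {x} → x ≢ true → x ≡ false
≢true {false} _ = refl
≢true {true}  h = ⊥-elim (h refl)

≢false : ∀ {x} → ¬ (x ≡ false) → x ≡ true
≢false {true}  _ = refl
≢false {false} h = ⊥-elim (h refl)

xor-true : ∀ x y → x xor y ≡ true → x ≢ y
xor-true true  false _ ()
xor-true false true  _ ()

xor-false : ∀ x y → x xor y ≡ false → x ≡ y
xor-false false false _ = refl
xor-false true  true  _ = refl

bool-ext : ∀ {x y} → (x ≡ true → y ≡ true) → (y ≡ true → x ≡ true) → x ≡ y
bool-ext {false} {false} f g = refl
bool-ext {true}  {true}  f g = refl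
bool-ext {false} {true}  f g = g refl
bool-ext {true}  {false} f g = sym (f refl)

⌊⌋-true : ∀ {a} {P : Set a} {d : Dec P} → ⌊ d ⌋ ≡ true → P
⌊⌋-true {d = yes p} _ = p

true-⌊⌋ : ∀ {a} {P : Set a} {d : Dec P} → P → ⌊ d ⌋ ≡ true
true-⌊⌋ {d = yes p} _ = refl
true-⌊⌋ {d = no ¬p} p = ⊥-elim (¬p p)

⌊⌋-false : ∀ {a} {P : Set a} {d : Dec P} → ⌊ d ⌋ ≡ false → ¬ P
⌊⌋-false h p = true≢false (true-⌊⌋ p) h

false-⌊⌋ : ∀ {a} {P : Set a} {d : Dec P} → ¬ P → ⌊ d ⌋ ≡ false
false-⌊⌋ ¬p = ≢true (¬p ∘ ⌊⌋-true)

infix 7 _==_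
opaque
  _==_ : ∀ {n} → Fin n → Fin n → Bool
  i == j = ⌊ i Fin.≟ j ⌋

  ==-def : ∀ {n} (i j : Fin n) → i == j ≡ ⌊ i Fin.≟ j ⌋
  ==-def i j = refl

  ≡⇒== : ∀ {n} {i j : Fin n} → i ≡ j → i == j ≡ true
  ≡⇒== = true-⌊⌋

  ==⇒≡ : ∀ {n} {i j : Fin n} → i == j ≡ true → i ≡ j
  ==⇒≡ = ⌊⌋-true

  ≢⇒== : ∀ {n} {i j : Fin n} → i ≢ j → i == j ≡ false
  ≢⇒== = false-⌊⌋

  ==⇒≢ : ∀ {n} {i j : Fin n} → i == j ≡ false → i ≢ j
  ==⇒≢ = ⌊⌋-false

==-refl : ∀ {n} (i : Fin n) → i == i ≡ true
==-refl i = ≡⇒== refl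

==-sym : ∀ {n} (i j : Fin n) → i == j ≡ j == i
==-sym i j = bool-ext (≡⇒== ∘ sym ∘ ==⇒≡) (≡⇒== ∘ sym ∘ ==⇒≡)

-- Finite sums and counting

-- Sums are opaque so that unification treats sum f as injective in f.

opaque
  sum : ∀ {n} → (Fin n → ℕ) → ℕ
  sum f = vsum f

  sum-cong : ∀ {n} {f g : Fin n → ℕ} → (∀ i → f i ≡ g i) → sum f ≡ sum g
  sum-cong h = vsum-cong h

  sum-+ : ∀ {n} (f g : Fin n → ℕ) → sum (λ i → f i + g i) ≡ sum f + sum g
  sum-+ f g = vsum-+ f g

  sum-* : ∀ {n} c (f : Fin n → ℕ) → sum (λ i → c * f i) ≡ c * sum f
  sum-* c f = sym (vsum-* c f)

  sum-swap : ∀ {n k} (f : Fin n → Fin k → ℕ) → sum (λ i → sum (f i)) ≡ sum (λ j → sum λ i → f i j)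
  sum-swap {n} {k} f = vsum-swap {n} {k} f

  sum-zero : ∀ {n} {f : Fin n → ℕ} → (∀ i → f i ≡ 0) → sum f ≡ 0
  sum-zero {n} h = trans (vsum-cong h) (vsum-zero n)

  sum-mono : ∀ {n} {f g : Fin n → ℕ} → (∀ i → f i ≤ g i) → sum f ≤ sum g
  sum-mono {zero}  h = z≤n
  sum-mono {suc n} h = h zero ⊕ sum-mono (h ∘ suc)

  sum-const : ∀ n c → sum {n} (λ _ → c) ≡ n * c
  sum-const zero    c = refl
  sum-const (suc n) c = cong (c +_) (sum-const n c)

  term≤sum : ∀ {n} (f : Fin n → ℕ) i → f i ≤ sum f
  term≤sum f zero    = m≤m+n _ _
  term≤sum f (suc i) = ≤-trans (term≤sum (f ∘ suc) i) (m≤n+m _ (f zero))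

opaque
  unfolding sum _==_

  sum-δ : ∀ {n} (i : Fin n) (f : Fin n → ℕ) → sum (λ j → [ i == j ] * f j) ≡ f i
  sum-δ {suc n} zero f =
    trans (cong₂ _+_ (+-identityʳ _) (sum-zero {n} {λ j → [ zero == suc j ] * f (suc j)} λ j → refl)) (+-identityʳ _)
  sum-δ {suc n} (suc i) f =
    trans (sum-cong {n} λ j → cong (λ b → [ b ] * f (suc j)) (suc== i j)) (sum-δ i (f ∘ suc))
    where
    suc== : ∀ {n} (i j : Fin n) → suc i == suc j ≡ i == j
    suc== i j with i Fin.≟ j
    ... | yes _ = refl
    ... | no  _ = refl

sum-+₃ : ∀ {n} (f g h : Fin n → ℕ) → sum (λ i → f i + g i + h i) ≡ sum f + sum g + sum h
sum-+₃ f g h = trans (sum-+ (λ i → f i + g i) h) (cong (_+ sum h) (sum-+ f g))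

sum-+₄ : ∀ {n} (f g h k : Fin n → ℕ) → sum (λ i → f i + g i + h i + k i) ≡ sum f + sum g + sum h + sum k
sum-+₄ f g h k = trans (sum-+ (λ i → f i + g i + h i) k) (cong (_+ sum k) (sum-+₃ f g h))

sum-δ₁ : ∀ {n} (i : Fin n) → sum (λ j → [ i == j ]) ≡ 1
sum-δ₁ i = trans (sum-cong λ j → sym (*-identityʳ _)) (sum-δ i (λ _ → 1))

sum-mono₁₂ : ∀ {n} {f g₁ g₂ : Fin n → ℕ} → (∀ i → f i ≤ g₁ i + g₂ i) → sum f ≤ sum g₁ + sum g₂
sum-mono₁₂ h = ≤-trans (sum-mono h) (≤-reflexive (sum-+ _ _))

sum-mono₂₁ : ∀ {n} {f₁ f₂ g : Fin n → ℕ} → (∀ i → f₁ i + f₂ i ≤ g i) → sum f₁ + sum f₂ ≤ sum g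
sum-mono₂₁ h = ≤-trans (≤-reflexive (sym (sum-+ _ _))) (sum-mono h)

sum-mono₂₂ : ∀ {n} {f₁ f₂ g₁ g₂ : Fin n → ℕ} → (∀ i → f₁ i + f₂ i ≤ g₁ i + g₂ i) →
  sum f₁ + sum f₂ ≤ sum g₁ + sum g₂
sum-mono₂₂ h = ≤-trans (sum-mono₂₁ h) (≤-reflexive (sum-+ _ _))

sum-cong₂₂ : ∀ {n} {f₁ f₂ g₁ g₂ : Fin n → ℕ} → (∀ i → f₁ i + f₂ i ≡ g₁ i + g₂ i) →
  sum f₁ + sum f₂ ≡ sum g₁ + sum g₂
sum-cong₂₂ h = trans (sym (sum-+ _ _)) (trans (sum-cong h) (sum-+ _ _))

-- Interchanging the `i`-th terms keeps `f ≤ g` elsewhere and gives equality at `i`, so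
-- `sum f + g i ≤ sum g + f i`; with `sum g ≤ sum f` this isolates position `i`.
sum-mono-tight : ∀ {n} {f g : Fin n → ℕ} → (∀ i → f i ≤ g i) → sum g ≤ sum f → ∀ i → g i ≤ f i
sum-mono-tight {f = f} {g} h s i =
  lin 0 (s ⊕ sum-mono₂₂ {f₁ = f} {λ j → [ i == j ] * g j} {g} {λ j → [ i == j ] * f j} pointwise ⊕
         ≤-reflexive (sum-δ i f) ⊕ ≤-reflexive (sym (sum-δ i g)))
    (eq (g i) (f i) (sum f) (sum g) _ _)
  where
  pointwise : ∀ j → f j + [ i == j ] * g j ≤ g j + [ i == j ] * f j
  pointwise j with i == j
  ... | false = +-monoˡ-≤ 0 (h j)
  ... | true  = ≤-reflexive (swap (f j) (g j))
    where
    swap : ∀ a b → a + (b + 0) ≡ b + (a + 0)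
    swap = solve-∀
  eq : ∀ gi fi sf sg x y → gi + (sf + (sg + x + (fi + y))) + 0 ≡ fi + (sg + (sf + y + (x + gi)))
  eq = solve-∀

sum-< : ∀ {n} {f g : Fin n → ℕ} → sum f < sum g → ∃ λ i → f i < g i
sum-< {f = f} {g} h with any? (λ i → suc (f i) ≤? g i)
... | yes p = p
... | no ¬p = contradiction h (≤⇒≯ (sum-mono λ i → ≮⇒≥ λ q → ¬p (i , q)))

count : ∀ {n} → (Fin n → Bool) → ℕ
count p = sum λ i → [ p i ]

-- Sparse and tight sets

-- Loops are allowed, so that a graph may be contracted by composing s and t with a map of the vertices.

module Edges {n k : ℕ} (s t : Fin k → Fin n) where

  VSet ESet : Set
  VSet = Fin n → Bool
  ESet = Fin k → Bool

  ins : VSet → ESet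
  ins W e = W (s e) ∧ W (t e)

  ins-s : ∀ W {e} → ins W e ≡ true → W (s e) ≡ true
  ins-s W {e} = ∧-left (W (s e))

  ins-t : ∀ W {e} → ins W e ≡ true → W (t e) ≡ true
  ins-t W {e} = ∧-right (W (s e))

  opaque
    E : ESet → VSet → ℕ
    E X W = count λ e → X e ∧ ins W e

    E-def : ∀ X W → E X W ≡ count λ e → X e ∧ ins W e
    E-def X W = refl

  _∪_ _∩_ : VSet → VSet → VSet
  (V ∪ W) v = V v ∨ W v
  (V ∩ W) v = V v ∧ W v

  insert : ESet → Fin k → ESet
  insert X e e′ = X e′ ∨ e == e′

  delete : ESet → Fin k → ESet
  delete X e e′ = X e′ ∧ not (e == e′)

  insert-self : ∀ X e → insert X e e ≡ true
  insert-self X e = ∨-right (X e) (==-refl e)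

  insert-old : ∀ X e e′ → X e′ ≡ true → insert X e e′ ≡ true
  insert-old X e e′ h = cong (_∨ e == e′) h

  delete-intro : ∀ {X e e′} → X e′ ≡ true → e ≢ e′ → delete X e e′ ≡ true
  delete-intro h e≢ = true-∧ h (cong not (≢⇒== e≢))

  delete-elim : ∀ {X e e′} → delete X e e′ ≡ true → X e′ ≡ true × e ≢ e′
  delete-elim {X} {e} {e′} h = ∧-left (X e′) h , ==⇒≢ (not-true (∧-right (X e′) h))

  -- The bound `m(|W| - 1)` without subtraction; the member `v` makes `W` nonempty. For positive
  -- `m`, singletons exclude loops. `Sparse 1` describes forests.
  Sparse : ℕ → ESet → Set
  Sparse m X = ∀ W v → W v ≡ true → E X W + m ≤ m * count W

  -- Only the inequality opposite to sparsity. In a forest, with `m` equal to 1, a nonempty tight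
  -- set is one on which the forest induces a tree. The empty set is formally tight, so results that
  -- need a nonempty set also ask for a member.
  Tight : ℕ → ESet → VSet → Set
  Tight m X W = m * count W ≤ E X W + m

  opaque
    unfolding E

    E-mono : ∀ {X Y} W → (∀ e → ins W e ≡ true → X e ≡ true → Y e ≡ true) → E X W ≤ E Y W
    E-mono {X} {Y} W h = sum-mono λ e → aux (X e) (Y e) (ins W e) (h e)
      where
      aux : ∀ x y w → (w ≡ true → x ≡ true → y ≡ true) → [ x ∧ w ] ≤ [ y ∧ w ]
      aux false y w h = z≤n
      aux true y false h = z≤n
      aux true y true h rewrite h refl refl = ≤-refl

  sparse-⊆ : ∀ {m X Y} → (∀ e → X e ≡ true → Y e ≡ true) → Sparse m Y → Sparse m X
  sparse-⊆ {m} h sp W v v∈W = ≤-trans (+-monoˡ-≤ m (E-mono W λ e _ → h e)) (sp W v v∈W)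

  tight-⊆ : ∀ {m X Y W} → (∀ e → ins W e ≡ true → X e ≡ true → Y e ≡ true) → Tight m X W → Tight m Y W
  tight-⊆ {m} {W = W} h tg = ≤-trans tg (+-monoˡ-≤ m (E-mono W h))

  count-∪∩ : ∀ V W → count (V ∪ W) + count (V ∩ W) ≡ count V + count W
  count-∪∩ V W = sum-cong₂₂ λ v → aux (V v) (W v)
    where
    aux : ∀ x y → [ x ∨ y ] + [ x ∧ y ] ≡ [ x ] + [ y ]
    aux = toWitness {a? = ∀B? λ x → ∀B? λ y → _ ≟ _} tt

  opaque
    unfolding E

    E-∪∩ : ∀ X V W → E X V + E X W ≤ E X (V ∪ W) + E X (V ∩ W)
    E-∪∩ X V W = sum-mono₂₂ λ e → aux (X e) (V (s e)) (V (t e)) (W (s e)) (W (t e))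
      where
      aux : ∀ x a b c d → [ x ∧ (a ∧ b) ] + [ x ∧ (c ∧ d) ] ≤
        [ x ∧ ((a ∨ c) ∧ (b ∨ d)) ] + [ x ∧ ((a ∧ c) ∧ (b ∧ d)) ]
      aux = toWitness {a? = ∀B? λ x → ∀B? λ a → ∀B? λ b → ∀B? λ c → ∀B? λ d → _ ≤? _} tt

  module _ {m X} (sp : Sparse m X) {V W v} (tV : Tight m X V) (tW : Tight m X W)
           (v∈V : V v ≡ true) (v∈W : W v ≡ true) where

    private
      -- `E` is supermodular and `count` is modular. With two sets at the bound, sparsity of one of
      -- union and intersection therefore forces the other to reach it; `p` is the set in question
      -- and `x` its counterpart.
      uncross : ∀ p q a b c d x y → a + b ≤ c + d → p + x ≡ q + y → m * q ≤ a + m → m * y ≤ b + m →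
        d + m ≤ m * x → m * p ≤ c + m
      uncross p q a b c d x y h₁ h₂ h₃ h₄ h₅ =
        lin 0 (h₁ ⊕ mul-mono m (≤-reflexive h₂) ⊕ h₃ ⊕ h₄ ⊕ h₅) (eq m p q a b c d x y)
        where
        eq : ∀ m p q a b c d x y → m * p + (c + d + (m * (q + y) + (a + m + (b + m + m * x)))) + 0 ≡
          c + m + (a + b + (m * (p + x) + (m * q + (m * y + (d + m)))))
        eq = solve-∀

    tight-∪ : Tight m X (V ∪ W)
    tight-∪ = uncross _ _ (E X V) (E X W) _ (E X (V ∩ W)) (count (V ∩ W)) _ (E-∪∩ X V W) (count-∪∩ V W) tV tW
      (sp (V ∩ W) v (true-∧ v∈V v∈W))

    tight-∩ : Tight m X (V ∩ W)
    tight-∩ = uncross _ _ (E X V) (E X W) _ (E X (V ∪ W)) (count (V ∪ W)) _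
      (≤-trans (E-∪∩ X V W) (≤-reflexive (+-comm (E X (V ∪ W)) _)))
      (trans (+-comm (count (V ∩ W)) _) (count-∪∩ V W)) tV tW
      (sp (V ∪ W) v (cong (_∨ W v) v∈V))

count-insert : ∀ {n} (W : Fin n → Bool) v → W v ≡ false → count (λ w → W w ∨ v == w) ≡ suc (count W)
count-insert W v v∉W = trans (sum-cong pointwise)
  (trans (sum-+ _ _) (trans (cong (count W +_) (sum-δ₁ v)) (+-comm _ 1)))
  where
  pointwise : ∀ w → [ W w ∨ v == w ] ≡ [ W w ] + [ v == w ]
  aux : ∀ x i → (i ≡ true → x ≡ false) → [ x ∨ i ] ≡ [ x ] + [ i ]
  aux = toWitness {a? = ∀B? λ x → ∀B? λ i → (_ ≟B _ →-dec _ ≟B _) →-dec _ ≟ _} tt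
  pointwise w = aux (W w) (v == w) λ h → subst (λ z → W z ≡ false) (==⇒≡ h) v∉W

count≤ : ∀ {n} (W : Fin n → Bool) → count W ≤ n
count≤ {n} W = ≤-trans (sum-mono λ i → []≤1 (W i)) (≤-reflexive (trans (sum-const n 1) (*-identityʳ n)))

count-mono : ∀ {n} {V W : Fin n → Bool} → (∀ v → V v ≡ true → W v ≡ true) → count V ≤ count W
count-mono {V = V} {W} h = sum-mono λ v → aux (V v) (W v) (h v)
  where
  aux : ∀ x y → (x ≡ true → y ≡ true) → [ x ] ≤ [ y ]
  aux false y h = z≤n
  aux true  y h rewrite h refl = ≤-refl

-- Modifying sparse sets; cuts and components

module Sparsity {n k : ℕ} (s t : Fin k → Fin n) where
  open Edges s t

  opaque
    unfolding E

    E-insert : ∀ X e W → E (insert X e) W ≤ E X W + [ ins W e ]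
    E-insert X e W = ≤-trans (sum-mono₁₂ λ e′ → aux (X e′) (e == e′) (ins W e′))
      (≤-reflexive (cong (E X W +_) (sum-δ e _)))
      where
      aux : ∀ x d w → [ (x ∨ d) ∧ w ] ≤ [ x ∧ w ] + [ d ] * [ w ]
      aux = toWitness {a? = ∀B? λ x → ∀B? λ d → ∀B? λ w → _ ≤? _} tt

    E-delete : ∀ X e W → X e ≡ true → E (delete X e) W + [ ins W e ] ≤ E X W
    E-delete X e W e∈X = ≤-trans (≤-reflexive (cong (E (delete X e) W +_) (sym (sum-δ e _)))) (sum-mono₂₁ pointwise)
      where
      aux : ∀ x d w → (d ≡ true → x ≡ true) → [ (x ∧ not d) ∧ w ] + [ d ] * [ w ] ≤ [ x ∧ w ]
      aux = toWitness {a? = ∀B? λ x → ∀B? λ d → ∀B? λ w → (_ ≟B _ →-dec _ ≟B _) →-dec _ ≤? _} tt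
      pointwise : ∀ e′ → [ (X e′ ∧ not (e == e′)) ∧ ins W e′ ] + [ e == e′ ] * [ ins W e′ ] ≤ [ X e′ ∧ ins W e′ ]
      pointwise e′ = aux (X e′) (e == e′) (ins W e′) λ h → subst (λ z → X z ≡ true) (==⇒≡ h) e∈X

  opaque
    unfolding E

    E-zero : ∀ X W → (∀ e → X e ≡ false) → E X W ≡ 0
    E-zero X W h = sum-zero λ e → cong (λ b → [ b ∧ ins W e ]) (h e)

    E-exchange : ∀ {X Y W f g} → X f ≡ false → Y f ≡ true → ins W f ≡ true →
      (∀ e → X e ≡ true → g ≢ e → Y e ≡ true) → E X W ≤ E Y W
    E-exchange {X} {Y} {W} {f} {g} f∉X f∈Y f∈W X⊆Y = +-cancelʳ-≤ 1 _ _
      (≤-trans (≤-reflexive (cong (E X W +_) (sym (sum-δ₁ f))))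
        (≤-trans (sum-mono₂₂ pointwise) (≤-reflexive (cong (E Y W +_) (sum-δ₁ g)))))
      where
      aux : ∀ x y w i j → (i ≡ true → x ≡ false) → (i ≡ true → y ∧ w ≡ true) →
        (x ≡ true → j ≡ false → y ≡ true) → [ x ∧ w ] + [ i ] ≤ [ y ∧ w ] + [ j ]
      aux = toWitness {a? = ∀B? λ x → ∀B? λ y → ∀B? λ w → ∀B? λ i → ∀B? λ j →
        (_ ≟B _ →-dec _ ≟B _) →-dec (_ ≟B _ →-dec _ ≟B _) →-dec
        (_ ≟B _ →-dec (_ ≟B _ →-dec _ ≟B _)) →-dec _ ≤? _} tt
      pointwise : ∀ e → [ X e ∧ ins W e ] + [ f == e ] ≤ [ Y e ∧ ins W e ] + [ g == e ]
      pointwise e = aux (X e) (Y e) (ins W e) (f == e) (g == e)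
        (λ f≡e → subst (λ z → X z ≡ false) (==⇒≡ f≡e) f∉X)
        (λ f≡e → subst (λ z → Y z ∧ ins W z ≡ true) (==⇒≡ f≡e) (true-∧ f∈Y f∈W))
        (λ h g≢e → X⊆Y e h (==⇒≢ g≢e))

  -- Only a set containing both ends of `e` gains an edge, and it gains at most one, so only a tight
  -- set could be overfilled.
  insert-sparse : ∀ {m X e} → Sparse m X → (∀ W → Tight m X W → ins W e ≡ true → ⊥) → Sparse m (insert X e)
  insert-sparse {m} {X} {e} sp none W v v∈W with ins W e in eq
  ... | false = ≤-trans (+-monoˡ-≤ m (≤-trans (E-insert X e W)
          (≤-reflexive (trans (cong (λ b → E X W + [ b ]) eq) (+-identityʳ _))))) (sp W v v∈W)
  ... | true with E X W + m ≤? m * count W | m * count W ≤? E X W + m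
  ...   | _      | yes tight = ⊥-elim (none W tight eq)
  ...   | no ¬sp | no _      = ⊥-elim (¬sp (sp W v v∈W))
  ...   | yes _  | no loose  = lin 0 (E-insert X e W ⊕ ≤-reflexive (cong [_] eq) ⊕ ≰⇒> loose)
          (eq′ (E (insert X e) W) m (E X W) [ ins W e ] (m * count W))
    where
    eq′ : ∀ a m b c d → a + m + (b + c + (1 + d)) + 0 ≡ d + (a + (c + suc (b + m)))
    eq′ = solve-∀

  opaque
    unfolding E

    tight-insert-absurd : ∀ {m X e W} → Sparse m (insert X e) → X e ≡ false → Tight m X W → ins W e ≡ true → ⊥
    tight-insert-absurd {m} {X} {e} {W} sp e∉X tW e∈W =
      lin-absurd 0 (sp W (s e) (ins-s W e∈W) ⊕ tW ⊕ grown) (eq (E (insert X e) W) m (m * count W) (E X W))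
      where
      grown : E X W + 1 ≤ E (insert X e) W
      grown = ≤-trans (≤-reflexive (cong (E X W +_) (sym (sum-δ₁ e)))) (sum-mono₂₁ pointwise)
        where
        aux : ∀ x d w → (d ≡ true → x ≡ false) → (d ≡ true → w ≡ true) → [ x ∧ w ] + [ d ] ≤ [ (x ∨ d) ∧ w ]
        aux = toWitness {a? = ∀B? λ x → ∀B? λ d → ∀B? λ w → (_ ≟B _ →-dec _ ≟B _) →-dec (_ ≟B _ →-dec _ ≟B _) →-dec _ ≤? _} tt
        pointwise : ∀ e′ → [ X e′ ∧ ins W e′ ] + [ e == e′ ] ≤ [ (X e′ ∨ e == e′) ∧ ins W e′ ]
        pointwise e′ = aux (X e′) (e == e′) (ins W e′)
          (λ h → subst (λ z → X z ≡ false) (==⇒≡ h) e∉X) (λ h → subst (λ z → ins W z ≡ true) (==⇒≡ h) e∈W)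
      eq : ∀ a m c x → suc (c + (x + m + a) + 0) ≡ a + m + (c + (x + 1))
      eq = solve-∀

    -- The inside of a tight set may be exchanged for any other sparse set. For `W` meeting `V`, the
    -- edges of `Z` in `W` and of `X` in `V` together number at most those of `Y` in the
    -- intersection plus those of `X` in the union; since `V` is tight, the bounds for these two
    -- sets leave exactly the bound for `W`.
    replace-sparse : ∀ {m X Y Z} V → Sparse m X → Sparse m Y → Tight m X V →
      (∀ e → ins V e ≡ false → Z e ≡ true → X e ≡ true) →
      (∀ e → ins V e ≡ true → Z e ≡ true → Y e ≡ true) → Sparse m Z
    replace-sparse {m} {X} {Y} {Z} V spX spY tV outside inside W w w∈W
      with any? (λ v → W v ∧ V v ≟B true)
    ... | no disjoint = ≤-trans (+-monoˡ-≤ m (E-mono {Z} {X} W λ e e∈W → outside e (≢true λ e∈V →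
            disjoint (s e , true-∧ (ins-s W e∈W) (ins-s V e∈V))))) (spX W w w∈W)
    ... | yes (v , v∈) = combine (E Z W) (E X V) (E Y (W ∩ V)) (E X (W ∪ V)) _ _ (count (W ∩ V)) (count (W ∪ V)) exchange (count-∪∩ W V)
            (spY (W ∩ V) v v∈) (spX (W ∪ V) w (cong (_∨ V w) w∈W)) tV
      where
      exchange : E Z W + E X V ≤ E Y (W ∩ V) + E X (W ∪ V)
      exchange = sum-mono₂₂ λ e → aux (Z e) (X e) (Y e) (W (s e)) (W (t e)) (V (s e)) (V (t e)) (outside e) (inside e)
        where
        aux : ∀ z x y a b c d → (c ∧ d ≡ false → z ≡ true → x ≡ true) → (c ∧ d ≡ true → z ≡ true → y ≡ true) →
          [ z ∧ (a ∧ b) ] + [ x ∧ (c ∧ d) ] ≤ [ y ∧ ((a ∧ c) ∧ (b ∧ d)) ] + [ x ∧ ((a ∨ c) ∧ (b ∨ d)) ]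
        aux = toWitness {a? = ∀B? λ z → ∀B? λ x → ∀B? λ y → ∀B? λ a → ∀B? λ b → ∀B? λ c → ∀B? λ d →
          (_ ≟B _ →-dec (_ ≟B _ →-dec _ ≟B _)) →-dec (_ ≟B _ →-dec (_ ≟B _ →-dec _ ≟B _)) →-dec _ ≤? _} tt
      combine : ∀ a b c d w v i u → a + b ≤ c + d → u + i ≡ w + v → c + m ≤ m * i → d + m ≤ m * u →
        m * v ≤ b + m → a + m ≤ m * w
      combine a b c d w v i u h₁ h₂ h₃ h₄ h₅ =
        lin 0 (h₁ ⊕ mul-mono m (≤-reflexive h₂) ⊕ h₃ ⊕ h₄ ⊕ h₅) (eq m a b c d w v i u)
        where
        eq : ∀ m a b c d w v i u → a + m + (c + d + (m * (w + v) + (m * i + (m * u + (b + m))))) + 0 ≡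
          m * w + (a + b + (m * (u + i) + (c + m + (d + m + m * v))))
        eq = solve-∀

    -- A tree has an edge across every cut: otherwise the two sides of `D` would span at most
    -- `|D| - 2` edges together, one fewer than tightness requires.
    crossing-edge : ∀ {T D x y} → Sparse 1 T → Tight 1 T D → (Z : VSet) →
      D x ≡ true → Z x ≡ true → D y ≡ true → Z y ≡ false →
      ∃ λ g → T g ≡ true × ins D g ≡ true × Z (s g) xor Z (t g) ≡ true
    crossing-edge {T} {D} {x} {y} sp tD Z x∈D x∈Z y∈D y∉Z
      with any? (λ g → (T g ∧ ins D g) ∧ (Z (s g) xor Z (t g)) ≟B true)
    ... | yes (g , h) = g , ∧-left (T g) (∧-left (T g ∧ ins D g) h) , ∧-right (T g) (∧-left (T g ∧ ins D g) h) ,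
                        ∧-right (T g ∧ ins D g) h
    ... | no none = ⊥-elim (lin-absurd 0
            (tD ⊕ splitE ⊕ sp (D ∩ Z) x (true-∧ x∈D x∈Z) ⊕ sp (D ∩ (not ∘ Z)) y (true-∧ y∈D (cong not y∉Z)) ⊕
             ≤-reflexive splitV)
            (eq (count D) (E T D) (E T (D ∩ Z)) (count (D ∩ Z)) (E T (D ∩ (not ∘ Z))) (count (D ∩ (not ∘ Z)))))
      where
      splitV : count (D ∩ Z) + count (D ∩ (not ∘ Z)) ≡ count D
      splitV = trans (sym (sum-+ _ _)) (sum-cong λ v → aux (D v) (Z v))
        where
        aux : ∀ d z → [ d ∧ z ] + [ d ∧ not z ] ≡ [ d ]
        aux = toWitness {a? = ∀B? λ d → ∀B? λ z → _ ≟ _} tt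
      splitE : E T D ≤ E T (D ∩ Z) + E T (D ∩ (not ∘ Z))
      splitE = sum-mono₁₂ λ e → aux (T e) (D (s e)) (D (t e)) (Z (s e)) (Z (t e)) (≢true λ h → none (e , h))
        where
        aux : ∀ x a b c d → (x ∧ (a ∧ b)) ∧ (c xor d) ≡ false → [ x ∧ (a ∧ b) ] ≤
          [ x ∧ ((a ∧ c) ∧ (b ∧ d)) ] + [ x ∧ ((a ∧ not c) ∧ (b ∧ not d)) ]
        aux = toWitness {a? = ∀B? λ x → ∀B? λ a → ∀B? λ b → ∀B? λ c → ∀B? λ d → _ ≟B _ →-dec _ ≤? _} tt
      eq : ∀ d e f g h i → suc (e + 1 + (f + h + (1 * g + (1 * i + d))) + 0) ≡
        1 * d + (e + (f + 1 + (h + 1 + (g + i))))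
      eq = solve-∀

  -- The component of `u`, described through a predicate `Q` that holds throughout it; reachability
  -- as `Q` recovers paths. The field `edges` keeps the edge count of a spanning tree, the form in
  -- which connectedness enters the counting arguments.
  record Component (X : ESet) (u : Fin n) (Q : Fin n → Set) : Set where
    field
      R       : VSet
      root    : R u ≡ true
      reached : ∀ v → R v ≡ true → Q v
      closed  : ∀ e → X e ≡ true → R (s e) ≡ R (t e)
      edges   : count R ≤ E X R + 1

  opaque
    unfolding E

    component : ∀ X u (Q : Fin n → Set) → Q u →
      (∀ e → X e ≡ true → Q (s e) → Q (t e)) → (∀ e → X e ≡ true → Q (t e) → Q (s e)) → Component X u Q
    component X u Q Qu fwd bwd = grow (suc n) (u ==_) (m≤n+m (suc n) _) (==-refl u)
        (λ v h → subst Q (==⇒≡ h) Qu) (≤-trans (≤-reflexive (sum-δ₁ u)) (m≤n+m 1 _))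
      where
      grow : ∀ N (R : VSet) → suc n ≤ count R + N → R u ≡ true → (∀ v → R v ≡ true → Q v) →
        count R ≤ E X R + 1 → Component X u Q
      grow zero R fuel _ _ _ = ⊥-elim (<⇒≱ fuel (≤-trans (≤-reflexive (+-identityʳ _)) (count≤ R)))
      grow (suc N) R fuel root reached edges with any? (λ e → X e ∧ (R (s e) xor R (t e)) ≟B true)
      ... | no none = record
        { R = R ; root = root ; reached = reached ; edges = edges
        ; closed = λ e e∈X → xor-false (R (s e)) (R (t e)) (≢true λ h → none (e , true-∧ e∈X h)) }
      ... | yes (e , he) = cases (R (s e)) (R (t e)) refl refl (∧-right (X e) he)
        where
        e∈X : X e ≡ true
        e∈X = ∧-left (X e) he

        extend : ∀ w → R w ≡ false → Q w → ins R e ≡ false → ins (λ v → R v ∨ w == v) e ≡ true → Component X u Q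
        extend w w∉R Qw e∉R e∈R⁺ = grow N R⁺
            (≤-trans fuel (≤-reflexive (trans (+-suc _ N) (cong (_+ N) (sym (count-insert R w w∉R))))))
            (cong (_∨ w == u) root) reached⁺
            (≤-trans (≤-reflexive (trans (count-insert R w w∉R) (+-comm 1 _))) (+-monoˡ-≤ 1 (≤-trans edges more)))
          where
          R⁺ : VSet
          R⁺ v = R v ∨ w == v
          reached⁺ : ∀ v → R⁺ v ≡ true → Q v
          reached⁺ v v∈ with R v in ev
          ... | true  = reached v ev
          ... | false = subst Q (==⇒≡ v∈) Qw
          aux : ∀ x a b c d i → (i ≡ true → x ≡ true) → (i ≡ true → a ∧ b ≡ false) →
            (i ≡ true → (a ∨ c) ∧ (b ∨ d) ≡ true) → [ x ∧ (a ∧ b) ] + [ i ] ≤ [ x ∧ ((a ∨ c) ∧ (b ∨ d)) ]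
          aux = toWitness {a? = ∀B? λ x → ∀B? λ a → ∀B? λ b → ∀B? λ c → ∀B? λ d → ∀B? λ i →
            (_ ≟B _ →-dec _ ≟B _) →-dec (_ ≟B _ →-dec _ ≟B _) →-dec (_ ≟B _ →-dec _ ≟B _) →-dec _ ≤? _} tt
          more : E X R + 1 ≤ E X R⁺
          more = ≤-trans (≤-reflexive (cong (E X R +_) (sym (sum-δ₁ e)))) (sum-mono₂₁ λ e′ →
            aux (X e′) (R (s e′)) (R (t e′)) (w == s e′) (w == t e′) (e == e′)
              (λ h → subst (λ z → X z ≡ true) (==⇒≡ h) e∈X)
              (λ h → subst (λ z → ins R z ≡ false) (==⇒≡ h) e∉R)
              (λ h → subst (λ z → ins R⁺ z ≡ true) (==⇒≡ h) e∈R⁺))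

        cases : ∀ x y → R (s e) ≡ x → R (t e) ≡ y → x xor y ≡ true → Component X u Q
        cases true false es et _ = extend (t e) et (fwd e e∈X (reached (s e) es)) (trans (cong (R (s e) ∧_) et) (cong (_∧ false) es))
          (true-∧ (cong (_∨ t e == s e) es) (trans (cong (_∨ t e == t e) et) (==-refl (t e))))
        cases false true es et _ = extend (s e) es (bwd e e∈X (reached (t e) et)) (cong (_∧ R (t e)) es)
          (true-∧ (trans (cong (_∨ s e == s e) es) (==-refl (s e))) (cong (_∨ s e == t e) et))

-- Decomposing a sparse set into forests

module Packing {n k : ℕ} (s t : Fin k → Fin n) where
  open Edges s t
  open Sparsity s t

  opaque
    unfolding E

    E-⊆ : ∀ X {V W} → (∀ v → V v ≡ true → W v ≡ true) → E X V ≤ E X W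
    E-⊆ X {V} {W} h = sum-mono λ e → aux (X e) (V (s e)) (V (t e)) (W (s e)) (W (t e)) (h (s e)) (h (t e))
      where
      aux : ∀ x a b c d → (a ≡ true → c ≡ true) → (b ≡ true → d ≡ true) → [ x ∧ (a ∧ b) ] ≤ [ x ∧ (c ∧ d) ]
      aux = toWitness {a? = ∀B? λ x → ∀B? λ a → ∀B? λ b → ∀B? λ c → ∀B? λ d →
        (_ ≟B _ →-dec _ ≟B _) →-dec (_ ≟B _ →-dec _ ≟B _) →-dec _ ≤? _} tt

  module _ {m : ℕ} where

    part : ESet → (Fin k → Fin m) → Fin m → ESet
    part A col i e = A e ∧ i == col e

    Forests : ESet → (Fin k → Fin m) → Set
    Forests A col = ∀ i → Sparse 1 (part A col i)

    recolour : (Fin k → Fin m) → Fin k → Fin m → Fin k → Fin m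
    recolour col f c e = if f == e then c else col e

    recolour-self : ∀ col f c → recolour col f c f ≡ c
    recolour-self col f c rewrite ==-refl f = refl

    recolour-other : ∀ col {f} c {e} → f ≢ e → recolour col f c e ≡ col e
    recolour-other col c f≢e rewrite ≢⇒== f≢e = refl

    opaque
      unfolding E

      part-sum : ∀ A col W → sum (λ i → E (part A col i) W) ≡ E A W
      part-sum A col W = trans (sum-swap _) (sum-cong λ e → trans (sum-cong λ i → aux (A e) (i == col e) (ins W e) )
        (trans (sum-cong λ i → cong (λ b → [ b ] * [ A e ∧ ins W e ]) (==-sym i (col e))) (sum-δ (col e) _)))
        where
        aux : ∀ a i w → [ (a ∧ i) ∧ w ] ≡ [ i ] * [ a ∧ w ]
        aux = toWitness {a? = ∀B? λ a → ∀B? λ i → ∀B? λ w → _ ≟ _} tt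

  module Augment {m : ℕ} (A : ESet) (fail : ∀ (col : Fin k → Fin m) → ¬ Forests A col) where

    T : Fin k → (Fin k → Fin m) → Fin m → ESet
    T f col = part (delete A f) col

    T-intro : ∀ {f col i e} → A e ≡ true → f ≢ e → i ≡ col e → T f col i e ≡ true
    T-intro e∈A f≢e i≡ = true-∧ (true-∧ e∈A (cong not (≢⇒== f≢e))) (≡⇒== i≡)

    T-elim : ∀ {f col i e} → T f col i e ≡ true → A e ≡ true × f ≢ e × i ≡ col e
    T-elim {f} {col} {i} {e} h = ∧-left (A e) (∧-left (A e ∧ not (f == e)) h) ,
      ==⇒≢ (not-true (∧-right (A e) (∧-left (A e ∧ not (f == e)) h))) , ==⇒≡ (∧-right (A e ∧ not (f == e)) h)

    -- In a forest the smallest tight set containing the ends of `f` is the vertex set of the path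
    -- that would close a cycle with `f`.
    record Fundamental (f : Fin k) (col : Fin k → Fin m) (c : Fin m) : Set where
      field
        D       : VSet
        tight   : Tight 1 (T f col c) D
        f∈D     : ins D f ≡ true
        minimal : ∀ W → Tight 1 (T f col c) W → ins W f ≡ true → count D ≤ count W

    -- If no tight set of colour `c` contained both ends of `f`, giving `f` this colour would extend
    -- the forests to all of `A`, against `fail`.
    fundamental : ∀ f col c → Forests (delete A f) col → (Fundamental f col c → ⊥) → ⊥
    fundamental f col c forests k₀ =
      by-cases (Σ VSet λ W → Tight 1 (T f col c) W × ins W f ≡ true)
        (λ w → argmin (count ∘ proj₁) w λ (D , tD , f∈D) minimal →
          k₀ record { D = D ; tight = tD ; f∈D = f∈D ; minimal = λ W tW f∈W → minimal (W , tW , f∈W) })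
        (λ none → fail (recolour col f c) λ i → recoloured i none (i Fin.≟ c))
      where
      recoloured : ∀ i → ¬ (Σ VSet λ W → Tight 1 (T f col c) W × ins W f ≡ true) →
        Dec (i ≡ c) → Sparse 1 (part A (recolour col f c) i)
      recoloured i none (yes refl) =
        sparse-⊆ (λ e h → sub e h (f Fin.≟ e)) (insert-sparse (forests i) λ W tW f∈W → none (W , tW , f∈W))
        where
        sub : ∀ e → part A (recolour col f i) i e ≡ true → Dec (f ≡ e) → insert (T f col i) f e ≡ true
        sub e h (yes refl) = insert-self (T f col i) f
        sub e h (no f≢e)   = insert-old (T f col i) f e
          (T-intro {f} {col} (∧-left (A e) h) f≢e (trans (==⇒≡ (∧-right (A e) h)) (recolour-other col i f≢e)))
      recoloured i none (no i≢c) = sparse-⊆ (λ e h → sub e h (f Fin.≟ e)) (forests i)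
        where
        sub : ∀ e → part A (recolour col f c) i e ≡ true → Dec (f ≡ e) → T f col i e ≡ true
        sub e h (yes refl) = ⊥-elim (i≢c (trans (==⇒≡ (∧-right (A e) h)) (recolour-self col f c)))
        sub e h (no f≢e)   =
          T-intro {f} {col} (∧-left (A e) h) f≢e (trans (==⇒≡ (∧-right (A e) h)) (recolour-other col c f≢e))

    Chain : Set
    Chain = List (Fin m × VSet)

    last : Chain → VSet
    last []             = λ _ → true
    last ((_ , C) ∷ ch) = C

    -- The third clause lets no edge of colour `d` inside the preceding piece leave `C`; with
    -- tightness, `C` is a full component of colour `d` there. The head of the list is the newest
    -- and smallest piece.
    Consistent : (Fin m → ESet) → Chain → Set
    Consistent T []             = Unit
    Consistent T ((d , C) ∷ ch) =
      (∀ v → C v ≡ true → last ch v ≡ true) × Tight 1 (T d) C ×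
      (∀ e → T d e ≡ true → ins (last ch) e ≡ true → C (s e) ≡ C (t e)) × Consistent T ch

    outside? : ∀ (D C : VSet) → (∃ λ v → D v ≡ true × C v ≡ false) ⊎ (∀ v → D v ≡ true → C v ≡ true)
    outside? D C with any? (λ v → D v ∧ not (C v) ≟B true)
    ... | yes (v , h) = inj₁ (v , ∧-left (D v) h , not-true (∧-right (D v) h))
    ... | no none = inj₂ λ v v∈D → ≢false λ v∉C → none (v , true-∧ v∈D (cong not v∉C))

    ins-⊆ : ∀ {V W : VSet} {e} → (∀ v → V v ≡ true → W v ≡ true) → ins V e ≡ true → ins W e ≡ true
    ins-⊆ {V} {W} {e} V⊆W h = true-∧ (V⊆W (s e) (ins-s V {e} h)) (V⊆W (t e) (ins-t V {e} h))

    -- Colouring f with c and uncolouring g instead; minimality of the fundamental set of f keeps colour c a forest.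
    module Exchange (f : Fin k) (col : Fin k → Fin m) (f∈A : A f ≡ true) (forests : Forests (delete A f) col)
                    (c : Fin m) (fund : Fundamental f col c) (g : Fin k)
                    (g∈T : T f col c g ≡ true) (g∈D : ins (Fundamental.D fund) g ≡ true) where
      open Fundamental fund

      col′ : Fin k → Fin m
      col′ = recolour col f c

      f≢g : f ≢ g
      f≢g = proj₁ (proj₂ (T-elim {f} {col} g∈T))

      other⇒ : ∀ {i} → i ≢ c → ∀ e → T g col′ i e ≡ true → T f col i e ≡ true
      other⇒ {i} i≢c e h = cases (f Fin.≟ e) (T-elim {g} {col′} h)
        where
        cases : Dec (f ≡ e) → A e ≡ true × g ≢ e × i ≡ col′ e → T f col i e ≡ true
        cases (yes refl) (_ , _ , i≡)  = ⊥-elim (i≢c (trans i≡ (recolour-self col f c)))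
        cases (no f≢e) (e∈A , _ , i≡) = T-intro {f} {col} e∈A f≢e (trans i≡ (recolour-other col c f≢e))

      other⇐ : ∀ {i} → i ≢ c → ∀ e → T f col i e ≡ true → T g col′ i e ≡ true
      other⇐ i≢c e h with T-elim {f} {col} h
      ... | e∈A , f≢e , i≡ = T-intro {g} {col′} e∈A
        (λ { refl → i≢c (trans i≡ (sym (proj₂ (proj₂ (T-elim {f} {col} g∈T))))) })
        (trans i≡ (sym (recolour-other col c f≢e)))

      same⇒ : ∀ e → T g col′ c e ≡ true → f ≢ e → T f col c e ≡ true
      same⇒ e h f≢e with T-elim {g} {col′} h
      ... | e∈A , _ , i≡ = T-intro {f} {col} e∈A f≢e (trans i≡ (recolour-other col c f≢e))

      same⇐ : ∀ e → T f col c e ≡ true → g ≢ e → T g col′ c e ≡ true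
      same⇐ e h g≢e with T-elim {f} {col} h
      ... | e∈A , f≢e , i≡ = T-intro {g} {col′} e∈A g≢e (trans i≡ (sym (recolour-other col c f≢e)))

      f∈T′ : T g col′ c f ≡ true
      f∈T′ = T-intro {g} {col′} f∈A (f≢g ∘ sym) (sym (recolour-self col f c))

      forests′ : Forests (delete A g) col′
      forests′ i with i Fin.≟ c
      ... | no i≢c = sparse-⊆ (other⇒ i≢c) (forests i)
      ... | yes refl = sparse-⊆ (λ e h → sub e h (f Fin.≟ e))
              (insert-sparse (sparse-⊆ (λ e → ∧-left (T f col c e)) (forests c)) none)
        where
        sub : ∀ e → T g col′ c e ≡ true → Dec (f ≡ e) → insert (delete (T f col c) g) f e ≡ true
        sub e h (yes refl) = insert-self (delete (T f col c) g) f
        sub e h (no f≢e)   = insert-old (delete (T f col c) g) f e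
          (delete-intro {T f col c} (same⇒ e h f≢e) (proj₁ (proj₂ (T-elim {g} {col′} h))))
        none : ∀ W → Tight 1 (delete (T f col c) g) W → ins W f ≡ true → ⊥
        none W tW f∈W = lin-absurd 0 (forests c W (s f) (ins-s W {f} f∈W) ⊕ tW ⊕ E-delete (T f col c) g W g∈T)
            (trans (eq (E (T f col c) W) (1 * count W) (E (delete (T f col c) g) W))
              (cong (λ b → E (T f col c) W + 1 + (1 * count W + (E (delete (T f col c) g) W + [ b ]))) (sym (ins-⊆ {D} {W} D⊆W g∈D))))
          where
          tW′ : Tight 1 (T f col c) W
          tW′ = tight-⊆ (λ e _ → ∧-left (T f col c e)) tW
          -- Otherwise `D ∩ W` would be a smaller tight set through `f`. Hence `W` contains `g`, and
          -- it cannot be tight both with and without this edge.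
          D⊆W : ∀ v → D v ≡ true → W v ≡ true
          D⊆W with outside? D W
          ... | inj₂ h = h
          ... | inj₁ (v , v∈D , v∉W) = ⊥-elim (<⇒≱ smaller (minimal (D ∩ W)
                  (tight-∩ (forests c) tight tW′ (ins-s D {f} f∈D) (ins-s W {f} f∈W))
                  (true-∧ (true-∧ (ins-s D {f} f∈D) (ins-s W {f} f∈W)) (true-∧ (ins-t D {f} f∈D) (ins-t W {f} f∈W)))))
            where
            ∩v : (D ∩ W) v ≡ false
            ∩v rewrite v∉W | v∈D = refl
            smaller : count (D ∩ W) < count D
            smaller = ≤-trans (≤-reflexive (sym (count-insert (D ∩ W) v ∩v))) (count-mono sub′)
              where
              sub′ : ∀ w → (D ∩ W) w ∨ v == w ≡ true → D w ≡ true
              sub′ w h = aux (D w) (W w) (v == w) (λ v≡w → subst (λ z → D z ≡ true) (==⇒≡ v≡w) v∈D) h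
                where
                aux : ∀ d w i → (i ≡ true → d ≡ true) → (d ∧ w) ∨ i ≡ true → d ≡ true
                aux true  _ _    _ _ = refl
                aux false _ true h _ = h refl
          eq : ∀ a w d → suc (w + (d + 1 + a) + 0) ≡ a + 1 + (w + (d + 1))
          eq = solve-∀

      -- Both `f` and `g` lie inside `D` and so inside every piece: the exchange trades one edge
      -- within the pieces for another, and neither of them leaves a piece.
      consistent′ : ∀ ch → (∀ v → D v ≡ true → last ch v ≡ true) → Consistent (T f col) ch → Consistent (T g col′) ch
      consistent′ [] D⊆ _ = tt
      consistent′ ((d , C) ∷ ch) D⊆C (C⊆ , tC , closed , cons) =
        C⊆ , tC′ , closed′ , consistent′ ch (λ v → C⊆ v ∘ D⊆C v) cons
        where
        tC′ : Tight 1 (T g col′ d) C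
        tC′ with d Fin.≟ c
        ... | no d≢c = tight-⊆ (λ e _ → other⇐ d≢c e) tC
        ... | yes refl = ≤-trans tC (+-monoˡ-≤ 1 (E-exchange {f = f} {g}
                (≢true λ h → proj₁ (proj₂ (T-elim {f} {col} h)) refl) f∈T′ (ins-⊆ {D} {C} D⊆C f∈D) same⇐))
        closed′ : ∀ e → T g col′ d e ≡ true → ins (last ch) e ≡ true → C (s e) ≡ C (t e)
        closed′ e h e∈ with d Fin.≟ c
        ... | no d≢c = closed e (other⇒ d≢c e h) e∈
        ... | yes refl = cases (f Fin.≟ e)
          where
          cases : Dec (f ≡ e) → C (s e) ≡ C (t e)
          cases (yes refl) = trans (D⊆C _ (ins-s D {f} f∈D)) (sym (D⊆C _ (ins-t D {f} f∈D)))
          cases (no f≢e)   = closed e (same⇒ e h f≢e) e∈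

    -- A chain shrinks from the whole vertex set to connected pieces, each for one colour, that contain the uncoloured
    -- edge f.  When the fundamental set D of f leaves the chain at some piece C, exchanging f for an edge of D that
    -- leaves C gives an uncoloured edge whose ends are separated at an earlier stage of the chain.
    walk : ∀ ch f col → A f ≡ true → Forests (delete A f) col → Consistent (T f col) ch → ins (last ch) f ≡ true →
      ∀ c (fund : Fundamental f col c) v → Fundamental.D fund v ≡ true → last ch v ≡ false → ⊥
    walk [] f col f∈A forests cons f∈ c fund v v∈D v∉ = true≢false refl v∉
    walk ((d , C) ∷ ch) f col f∈A forests (C⊆ , tC , closed , cons) f∈ c fund v v∈D v∉C
      with outside? (Fundamental.D fund) (last ch)
    ... | inj₁ (w , w∈D , w∉) = walk ch f col f∈A forests cons (ins-⊆ {C} {last ch} C⊆ f∈) c fund w w∈D w∉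
    ... | inj₂ D⊆ with crossing-edge {T f col c} (forests c) (Fundamental.tight fund) C
                         (ins-s (Fundamental.D fund) {f} (Fundamental.f∈D fund)) (ins-s C {f} f∈) v∈D v∉C
    ...   | g , g∈T , g∈D , g-cross = fundamental g col′ d forests′ escape
      where
      open Exchange f col f∈A forests c fund g g∈T g∈D

      g∈last : ins (last ch) g ≡ true
      g∈last = ins-⊆ {Fundamental.D fund} {last ch} D⊆ g∈D

      d≢c : d ≢ c
      d≢c refl = xor-true (C (s g)) (C (t g)) g-cross (closed g g∈T g∈last)

      escape : Fundamental g col′ d → ⊥
      escape fund′ with outside? (Fundamental.D fund′) (last ch)
      ... | inj₁ (w , w∈D , w∉) = walk ch g col′ (proj₁ (T-elim {f} {col} g∈T)) forests′
              (consistent′ ch D⊆ cons) g∈last d fund′ w w∈D w∉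
      -- As `g` crosses `C`, the tree on `D′` would need an edge of colour `d` across `C` inside the
      -- preceding piece, which `closed` forbids.
      ... | inj₂ D′⊆ = split (C (s g)) (C (t g)) refl refl g-cross
        where
        open Fundamental fund′ renaming (D to D′; tight to tight′; f∈D to g∈D′)
        uncrossed : ∀ {x y} → D′ x ≡ true → C x ≡ true → D′ y ≡ true → C y ≡ false → ⊥
        uncrossed x∈D x∈C y∈D y∉C with crossing-edge {T g col′ d} (forests′ d) tight′ C x∈D x∈C y∈D y∉C
        ... | h , h∈T , h∈D , h-cross = xor-true (C (s h)) (C (t h)) h-cross
                (closed h (other⇒ d≢c h h∈T) (ins-⊆ {D′} {last ch} D′⊆ h∈D))
        split : ∀ x y → C (s g) ≡ x → C (t g) ≡ y → x xor y ≡ true → ⊥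
        split true false p q _ = uncrossed (ins-s D′ {g} g∈D′) p (ins-t D′ {g} g∈D′) q
        split false true p q _ = uncrossed (ins-t D′ {g} g∈D′) q (ins-s D′ {g} g∈D′) p

    -- The last piece contains `f`, so by sparsity of `A` the other edges inside it are too few to
    -- connect it in all `m` colours. In a colour `c` with too few edges, the component of one end
    -- of `f` either contains the other end and becomes a smaller piece, or the fundamental set of
    -- `f` leaves the last piece and `walk` applies.
    augment : ∀ f col → Sparse m A → A f ≡ true → Forests (delete A f) col → ⊥
    augment f col sp f∈A forests = go (suc n) [] (s≤s (count≤ {n} _)) refl tt
      where
      go : ∀ N ch → count (last ch) < N → ins (last ch) f ≡ true → Consistent (T f col) ch → ⊥
      go (suc N) ch (s≤s fuel) f∈ cons with any? (λ c → suc (E (T f col c) (last ch) + 1) ≤? 1 * count (last ch))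
      ... | no all = lin-absurd 0
              (sp (last ch) (s f) (ins-s (last ch) {f} f∈) ⊕ E-delete A f (last ch) f∈A ⊕ total ⊕
               ≤-reflexive (cong [_] (sym f∈)))
              (eq m (count (last ch)) (E A (last ch)) (E (delete A f) (last ch)) [ ins (last ch) f ])
        where
        total : m * count (last ch) ≤ E (delete A f) (last ch) + m
        total = ≤-trans (≤-reflexive (sym (sum-const m _)))
          (≤-trans (sum-mono λ c → ≤-trans (≤-reflexive (sym (*-identityˡ _))) (≮⇒≥ λ h → all (c , h)))
            (≤-reflexive (trans (sum-+ _ _) (cong₂ _+_ (part-sum (delete A f) col (last ch))
              (trans (sum-const m 1) (*-identityʳ m))))))
        eq : ∀ m c a d i → suc (m * c + (a + (d + m + i)) + 0) ≡ a + m + (d + i + (m * c + 1))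
        eq = solve-∀
      ... | yes (c , loose) = cases (R (t f)) refl
        where
        open Component (component (λ e → T f col c e ∧ ins (last ch) e) (s f) (λ v → last ch v ≡ true)
          (ins-s (last ch) {f} f∈) (λ e h _ → ins-t (last ch) {e} (∧-right (T f col c e) h))
          (λ e h _ → ins-s (last ch) {e} (∧-right (T f col c e) h)))

        cases : ∀ b → R (t f) ≡ b → ⊥
        cases true tf∈R = go N ((c , R) ∷ ch) (≤-trans smaller fuel) (true-∧ root tf∈R)
            (reached , ≤-trans (≤-reflexive (*-identityˡ _)) edgesT ,
             (λ e e∈T e∈ → closed e (true-∧ e∈T e∈)) , cons)
          where
          edgesT : count R ≤ E (T f col c) R + 1
          edgesT = ≤-trans edges (+-monoˡ-≤ 1 (E-mono R λ e _ → ∧-left (T f col c e)))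
          smaller : count R < count (last ch)
          smaller = ≤-trans (s≤s (≤-trans edgesT (+-monoˡ-≤ 1 (E-⊆ (T f col c) reached))))
            (≤-trans loose (≤-reflexive (*-identityˡ _)))
        cases false tf∉R = fundamental f col c forests λ fund → leaves fund
          where
          leaves : Fundamental f col c → ⊥
          leaves fund with outside? (Fundamental.D fund) (last ch)
          ... | inj₁ (v , v∈D , v∉) = walk ch f col f∈A forests cons f∈ c fund v v∈D v∉
          ... | inj₂ D⊆ with crossing-edge {T f col c} (forests c) (Fundamental.tight fund) R
                               (ins-s (Fundamental.D fund) {f} (Fundamental.f∈D fund)) root
                               (ins-t (Fundamental.D fund) {f} (Fundamental.f∈D fund)) tf∉R
          ...   | h , h∈T , h∈D , h-cross = xor-true (R (s h)) (R (t h)) h-cross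
                    (closed h (true-∧ h∈T (ins-⊆ {Fundamental.D fund} {last ch} D⊆ h∈D)))

  -- Nash-Williams' arboricity theorem
  arboricity : ∀ {m} A → Sparse (suc m) A → ((col : Fin k → Fin (suc m)) → Forests A col → ⊥) → ⊥
  arboricity {m} A = go (suc (count A)) A ≤-refl
    where
    go : ∀ N A → count A < N → Sparse (suc m) A → ((col : Fin k → Fin (suc m)) → Forests A col → ⊥) → ⊥
    go (suc N) A (s≤s fuel) sp fail with any? (λ e → A e ≟B true)
    ... | yes (e , e∈A) = go N (delete A e) (≤-trans smaller fuel) (sparse-⊆ (λ e′ → ∧-left (A e′)) sp)
            λ col forests → Augment.augment A fail e col sp e∈A forests
      where
      smaller : count (delete A e) < count A
      smaller = ≤-trans (≤-reflexive (sym (count-insert (delete A e) e removed))) (count-mono back)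
        where
        removed : delete A e e ≡ false
        removed = ≢true λ h → proj₂ (delete-elim {A} h) refl
        back : ∀ e′ → delete A e e′ ∨ e == e′ ≡ true → A e′ ≡ true
        back e′ h = aux (A e′) (e == e′) (λ i → subst (λ z → A z ≡ true) (==⇒≡ i) e∈A) h
          where
          aux : ∀ a i → (i ≡ true → a ≡ true) → (a ∧ not i) ∨ i ≡ true → a ≡ true
          aux true  _    _ _ = refl
          aux false true h _ = h refl
    ... | no none = fail (λ _ → zero) λ i W v v∈W → ≤-trans
            (≤-reflexive (cong (_+ 1) (E-zero _ W λ e → cong (_∧ i == zero) (≢true λ h → none (e , h)))))
            (≤-trans (≤-trans (≤-reflexive (cong [_] (sym v∈W))) (term≤sum (λ w → [ W w ]) v)) (≤-reflexive (sym (*-identityˡ _))))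

-- From forests to spanning trees

∈⇒true : ∀ {n} {p : Subset n} {v} → v ∈ p → lookup p v ≡ true
∈⇒true = []=⇒lookup

true⇒∈ : ∀ {n} {p : Subset n} {v} → lookup p v ≡ true → v ∈ p
true⇒∈ {p = p} {v} = lookup⇒[]= v p

∈-tabulate⁺ : ∀ {n} {f : Fin n → Bool} {v} → f v ≡ true → v ∈ tabulate f
∈-tabulate⁺ {f = f} {v} h = true⇒∈ (trans (lookup∘tabulate f v) h)

∈-tabulate⁻ : ∀ {n} {f : Fin n → Bool} {v} → v ∈ tabulate f → f v ≡ true
∈-tabulate⁻ {f = f} {v} h = trans (sym (lookup∘tabulate f v)) (∈⇒true h)

opaque
  unfolding sum

  ∣∣≡count : ∀ {n} (p : Subset n) → ∣ p ∣ ≡ count (lookup p)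
  ∣∣≡count []          = refl
  ∣∣≡count (true ∷ p)  = cong suc (∣∣≡count p)
  ∣∣≡count (false ∷ p) = ∣∣≡count p

count-tabulate : ∀ {n} (f : Fin n → Bool) → ∣ tabulate f ∣ ≡ count f
count-tabulate f = trans (∣∣≡count (tabulate f)) (sum-cong λ v → cong [_] (lookup∘tabulate f v))

module Multigraph (G : Graph) where
  open Graph G

  s t : Fin k → Fin n
  s = proj₁ ∘ ends
  t = proj₂ ∘ ends

  open Edges s t public
  open Sparsity s t public
  open Packing s t public

  snoc : ∀ {X u v w} e → Reach G X u v → e ∈ X → Joins G e v w → Reach G X u w
  snoc e here             e∈X j = step e e∈X j here
  snoc e (step e′ h j′ p) e∈X j = step e′ h j′ (snoc e p e∈X j)

  reach-closed : ∀ {X u v} (R : VSet) → (∀ e → e ∈ X → R (s e) ≡ R (t e)) → Reach G X u v → R u ≡ R v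
  reach-closed R closed here = refl
  reach-closed R closed (step e e∈X (inj₁ refl) p) = trans (closed e e∈X) (reach-closed R closed p)
  reach-closed R closed (step e e∈X (inj₂ refl) p) = trans (sym (closed e e∈X)) (reach-closed R closed p)

  reach-component : ∀ X u → Component (lookup X) u (Reach G X u)
  reach-component X u = component (lookup X) u (Reach G X u) here
    (λ e e∈X p → snoc e p (true⇒∈ e∈X) (inj₁ refl)) (λ e e∈X p → snoc e p (true⇒∈ e∈X) (inj₂ refl))

  spanningTree : ∀ {T W} (X : Subset k) → Sparse 1 T → Tight 1 T W → (∀ e → T e ≡ true → e ∈ X) →
    SpanningTree G (tabulate W) (X ∩ˢ inside G (tabulate W)) (tabulate λ e → T e ∧ ins W e)
  spanningTree {T} {W} X sp tW T⊆X = contained , connected , acyclic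
    where
    TW : Subset k
    TW = tabulate λ e → T e ∧ ins W e

    contained : TW ⊆ X ∩ˢ inside G (tabulate W)
    contained {e} h = x∈p∩q⁺ (T⊆X e (∧-left (T e) (∈-tabulate⁻ h)) ,
      ∈-tabulate⁺ (trans (cong₂ _∧_ (lookup∘tabulate W (s e)) (lookup∘tabulate W (t e))) (∧-right (T e) (∈-tabulate⁻ h))))

    connected : ∀ u v → u ∈ tabulate W → v ∈ tabulate W → Reach G TW u v
    connected u v u∈W v∈W = reached v (all (R v) refl)
      where
      open Component (reach-component TW u)
      all : ∀ b → R v ≡ b → R v ≡ true
      all true  h = h
      all false h with crossing-edge sp tW R (∈-tabulate⁻ u∈W) root (∈-tabulate⁻ v∈W) h
      ... | g , g∈T , g∈W , g-cross = ⊥-elim (xor-true (R (s g)) (R (t g)) g-cross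
              (closed g (trans (lookup∘tabulate _ g) (true-∧ g∈T g∈W))))

    acyclic : ∀ e → e ∈ TW → ¬ Reach G (TW ∩ˢ ∁ ⁅ e ⁆) (s e) (t e)
    -- The component `R` of one end of `e` in the tree without `e` has at least `|R| - 1` edges; if
    -- it contained the other end, `e` would be one edge too many for a forest.
    acyclic e e∈ p = lin-absurd 0 (sp R (s e) root ⊕ edges ⊕ more) (eq (E T R) (count R) (E (lookup Y) R))
      where
      Y : Subset k
      Y = TW ∩ˢ ∁ ⁅ e ⁆
      open Component (reach-component Y (s e))
      te∈R : R (t e) ≡ true
      te∈R = trans (sym (reach-closed R (λ e′ h → closed e′ (∈⇒true h)) p)) root
      Y⊆ : ∀ e′ → lookup Y e′ ≡ true → delete T e e′ ≡ true
      Y⊆ e′ h with x∈p∩q⁻ TW (∁ ⁅ e ⁆) (true⇒∈ h)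
      ... | h₁ , h₂ = delete-intro {T} (∧-left (T e′) (∈-tabulate⁻ h₁)) λ { refl → x∈∁p⇒x∉p h₂ (x∈⁅x⁆ e) }
      more : E (lookup Y) R + 1 ≤ E T R
      more = ≤-trans (+-mono-≤ (E-mono R λ e′ _ → Y⊆ e′) (≤-reflexive (cong [_] (sym (true-∧ root te∈R)))))
        (E-delete T e R (∧-left (T e) (∈-tabulate⁻ e∈)))
      eq : ∀ a c y → suc (1 * c + (y + 1 + a) + 0) ≡ a + 1 + (c + (y + 1))
      eq = solve-∀

  -- The `m` forests span at most `|W| - 1` edges each and `m(|W| - 1)` together, so none of them
  -- falls short.
  forests-tight : ∀ {m A col W} → Forests {m} A col → Sparse m A → Tight m A W → ∀ {v} → W v ≡ true →
    ∀ i → Tight 1 (part A col i) W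
  forests-tight {m} {A} {col} {W} forests sp tW {v} v∈W i =
    ≤-trans (≤-reflexive (*-identityˡ _)) (sum-mono-tight {f = λ i → E (part A col i) W + 1} {λ _ → count W}
      (λ i → ≤-trans (forests i W v v∈W) (≤-reflexive (*-identityˡ _)))
      (≤-trans (≤-reflexive (sum-const m (count W))) (≤-trans tW (≤-reflexive (sym total)))) i)
    where
    total : sum (λ i → E (part A col i) W + 1) ≡ E A W + m
    total = trans (sum-+ _ _) (cong₂ _+_ (part-sum A col W) (trans (sum-const m 1) (*-identityʳ m)))

  treeConnected : ∀ {m A col W v} (X : Subset k) → Forests {m} A col → Sparse m A → Tight m A W → W v ≡ true →
    (∀ e → A e ≡ true → e ∈ X) → TreeConnected G m X (tabulate W)
  treeConnected {A = A} {col} {W} X forests sp tW v∈W A⊆X =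
    (λ i → tabulate λ e → part A col i e ∧ ins W e) ,
    (λ i → spanningTree X (forests i) (forests-tight forests sp tW v∈W i) λ e h → A⊆X e (∧-left (A e) h)) ,
    λ i j i≢j e e∈i e∈j → i≢j (trans (colour i e∈i) (sym (colour j e∈j)))
    where
    colour : ∀ i {e} → e ∈ tabulate (λ e → part A col i e ∧ ins W e) → i ≡ col e
    colour i {e} h = ==⇒≡ (∧-right (A e) (∧-left (part A col i e) (∈-tabulate⁻ h)))

-- The partition into maximal tight sets

fibre-sum : ∀ {n k} (φ : Fin k → Fin n) (g : Fin n → ℕ) (f : Fin k → ℕ) →
  sum (λ i → g i * sum (λ e → [ φ e == i ] * f e)) ≡ sum (λ e → g (φ e) * f e)
fibre-sum φ g f =
  trans (sum-cong λ i → sym (sum-* (g i) _))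
    (trans (sum-swap _) (sum-cong λ e →
      trans (sum-cong λ i → rearrange (g i) [ φ e == i ] (f e)) (sum-δ (φ e) (λ i → g i * f e))))
  where
  rearrange : ∀ a b c → a * (b * c) ≡ b * (a * c)
  rearrange = solve-∀

-- The search runs up to `d` and falls back on `d` itself. Started at a member it returns the least
-- member, whichever member that was, and so gives a canonical representative.
first : ∀ {n} → (Fin n → Bool) → Fin n → Fin n
first W zero    = zero
first W (suc d) = if W zero then zero else suc (first (W ∘ suc) d)

first-∈ : ∀ {n} (W : Fin n → Bool) d → W d ≡ true → W (first W d) ≡ true
first-∈ W zero    h = h
first-∈ W (suc d) h with W zero in eq
... | true  = eq
... | false = first-∈ (W ∘ suc) d h

first-unique : ∀ {n} (V W : Fin n → Bool) → (∀ v → V v ≡ W v) → ∀ c d → V c ≡ true → W d ≡ true →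
  first V c ≡ first W d
first-unique V W V≗W zero    zero    _ _ = refl
first-unique V W V≗W zero    (suc d) h _ rewrite trans (sym (V≗W zero)) h = refl
first-unique V W V≗W (suc c) zero    _ h rewrite trans (V≗W zero) h = refl
first-unique V W V≗W (suc c) (suc d) h₁ h₂ rewrite V≗W zero with W zero
... | true  = refl
... | false = cong suc (first-unique (V ∘ suc) (W ∘ suc) (V≗W ∘ suc) c d h₁ h₂)

module Partition {n k : ℕ} (s t : Fin k → Fin n) where
  open Edges s t
  open Sparsity s t
  open Packing s t

  -- The partition of the vertices into maximal tight sets; cls v is the least vertex of the class of v.
  record Classes (m : ℕ) (J : ESet) : Set where
    field
      sparse : Sparse m J
      cls    : Fin n → Fin n
      idem   : ∀ v → cls (cls v) ≡ cls v
      tight  : ∀ v → Tight m J (λ w → cls w == cls v)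
      max    : ∀ {W v w} → Tight m J W → W v ≡ true → W w ≡ true → cls v ≡ cls w

    root : Fin n → Bool
    root i = cls i == i

    crossing : ESet
    crossing e = J e ∧ not (cls (s e) == cls (t e))

    union : (Fin n → Bool) → VSet
    union U v = U (cls v)

    #classes : (Fin n → Bool) → ℕ
    #classes U = count λ i → root i ∧ U i

    root-cls : ∀ v → root (cls v) ≡ true
    root-cls v = ≡⇒== (idem v)

    -- The factor `root i` selects one index per class, so quantities attached to vertices or to
    -- ends of edges and summed class by class become plain sums.
    class-sum : ∀ {k} (φ : Fin k → Fin n) U (f : Fin k → ℕ) →
      sum (λ i → [ root i ∧ U i ] * sum (λ e → [ cls (φ e) == i ] * f e)) ≡ sum (λ e → [ union U (φ e) ] * f e)
    class-sum φ U f = trans (fibre-sum (cls ∘ φ) (λ i → [ root i ∧ U i ]) f)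
      (sum-cong λ e → cong (λ b → [ b ∧ U (cls (φ e)) ] * f e) (root-cls (φ e)))

    root-tight : ∀ i → root i ≡ true → E J (λ w → cls w == i) + m ≡ m * count (λ w → cls w == i)
    root-tight i h = ≤-antisym (sparse _ i h) (subst (λ z → Tight m J (λ w → cls w == z)) (==⇒≡ h) (tight i))

    opaque
      unfolding E

      -- Each class spans exactly `m` times its size minus `m` edges; adding this up over `U`
      -- accounts for all edges of `J` in the union except the crossing ones.
      partition : ∀ U → E J (union U) + m * #classes U ≡ m * count (union U) + E crossing (union U)
      partition U = trans (cong (_+ m * #classes U) (sym splitE)) (trans (swap (E inner (union U)) _ (m * #classes U)) (cong (_+ E crossing (union U)) classwise))
        where
        swap : ∀ a b c → a + b + c ≡ a + c + b
        swap = solve-∀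

        inner : ESet
        inner e = J e ∧ cls (t e) == cls (s e)

        splitE : E inner (union U) + E crossing (union U) ≡ E J (union U)
        splitE = trans (sym (sum-+ _ _)) (sum-cong λ e → trans
          (cong (λ b → [ (J e ∧ b) ∧ ins (union U) e ] + [ crossing e ∧ ins (union U) e ]) (==-sym (cls (t e)) (cls (s e))))
          (aux (J e) (cls (s e) == cls (t e)) (ins (union U) e)))
          where
          aux : ∀ j c u → [ (j ∧ c) ∧ u ] + [ (j ∧ not c) ∧ u ] ≡ [ j ∧ u ]
          aux = toWitness {a? = ∀B? λ j → ∀B? λ c → ∀B? λ u → _ ≟ _} tt

        innerE : sum (λ i → [ root i ∧ U i ] * E J (λ w → cls w == i)) ≡ E inner (union U)
        innerE = trans (sum-cong λ i → cong ([ root i ∧ U i ] *_) (sum-cong λ e → pointwise i e))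
          (trans (class-sum s U (λ e → [ inner e ])) (sum-cong λ e →
            aux (J e) (cls (t e) == cls (s e)) (U (cls (s e))) (U (cls (t e))) λ h → cong U (==⇒≡ h)))
          where
          aux′ : ∀ j a b c → (a ≡ true → b ≡ c) → [ j ∧ (a ∧ b) ] ≡ [ a ] * [ j ∧ c ]
          aux′ = toWitness {a? = ∀B? λ j → ∀B? λ a → ∀B? λ b → ∀B? λ c → (_ ≟B _ →-dec _ ≟B _) →-dec _ ≟ _} tt
          pointwise : ∀ i e → [ J e ∧ ins (λ w → cls w == i) e ] ≡ [ cls (s e) == i ] * [ inner e ]
          pointwise i e = aux′ (J e) (cls (s e) == i) (cls (t e) == i) (cls (t e) == cls (s e))
            λ h → cong (cls (t e) ==_) (sym (==⇒≡ h))
          aux : ∀ j c a b → (c ≡ true → b ≡ a) → [ a ] * [ j ∧ c ] ≡ [ (j ∧ c) ∧ (a ∧ b) ]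
          aux = toWitness {a? = ∀B? λ j → ∀B? λ c → ∀B? λ a → ∀B? λ b → (_ ≟B _ →-dec _ ≟B _) →-dec _ ≟ _} tt

        countV : sum (λ i → [ root i ∧ U i ] * count (λ w → cls w == i)) ≡ count (union U)
        countV = trans (sum-cong λ i → cong ([ root i ∧ U i ] *_) (sum-cong λ w → sym (*-identityʳ _)))
          (trans (class-sum (λ w → w) U (λ _ → 1)) (sum-cong λ w → *-identityʳ _))

        classwise : E inner (union U) + m * #classes U ≡ m * count (union U)
        classwise = trans (cong₂ _+_ (sym innerE) (sym (sum-* m _)))
          (trans (sym (sum-+ _ _)) (trans (sum-cong pointwise) (trans (sum-* m _) (cong (m *_) countV))))
          where
          distrib : ∀ a b m → a * b + m * a ≡ a * (b + m)
          distrib = solve-∀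
          rearrange : ∀ a b m → a * (m * b) ≡ m * (a * b)
          rearrange = solve-∀
          at : ∀ i b → root i ≡ b → [ b ∧ U i ] * (E J (λ w → cls w == i) + m) ≡ [ b ∧ U i ] * (m * count (λ w → cls w == i))
          at i true  h = cong ([ true ∧ U i ] *_) (root-tight i h)
          at i false h = refl
          pointwise : ∀ i → [ root i ∧ U i ] * E J (λ w → cls w == i) + m * [ root i ∧ U i ] ≡
            m * ([ root i ∧ U i ] * count (λ w → cls w == i))
          pointwise i = trans (distrib [ root i ∧ U i ] _ m) (trans (at i (root i) refl) (rearrange [ root i ∧ U i ] _ m))

  tight-ext : ∀ {m X V W} → (∀ v → V v ≡ W v) → Tight m X V → Tight m X W
  tight-ext {m} {X} {V} {W} h tV =
    ≤-trans (mul-mono m (count-mono λ v w → trans (h v) w)) (≤-trans tV (+-monoˡ-≤ m (E-⊆ X λ v w → trans (sym (h v)) w)))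

  singleton-tight : ∀ {m X} v → Tight m X (v ==_)
  singleton-tight {m} {X} v = ≤-trans (≤-reflexive (trans (cong (m *_) (sum-δ₁ v)) (*-identityʳ m))) (m≤n+m m _)

  classes : ∀ {m J} → Sparse m J → (Classes m J → ⊥) → ⊥
  classes {m} {J} sp k₀ = choice {P = Maximal} maximal λ C → k₀ (build C)
    where
    Maximal : Fin n → Set
    Maximal v = Σ VSet λ C → C v ≡ true × Tight m J C × (∀ W → Tight m J W → W v ≡ true → ∀ w → W w ≡ true → C w ≡ true)

    maximal : ∀ v → (Maximal v → ⊥) → ⊥
    maximal v k₁ = argmin {A = Σ VSet λ C → C v ≡ true × Tight m J C} (λ C → n ∸ count (proj₁ C))
        ((v ==_) , ==-refl v , singleton-tight v)
        λ { (C , v∈C , tC) least → k₁ (C , v∈C , tC , λ W tW v∈W w w∈W → ≢false λ w∉C →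
          <⇒≱ (∸-monoʳ-< {n} {count (W ∪ C)} {count C} (grown C W w w∈W w∉C) (count≤ (W ∪ C)))
            (least (W ∪ C , cong (_∨ C v) v∈W , tight-∪ sp tW tC v∈W v∈C))) }
      where
      grown : ∀ C W w → W w ≡ true → C w ≡ false → count C < count (W ∪ C)
      grown C W w w∈W w∉C = ≤-trans (≤-reflexive (sym (count-insert C w w∉C))) (count-mono λ x →
        aux (C x) (W x) (w == x) λ h → subst (λ z → W z ≡ true) (==⇒≡ h) w∈W)
        where
        aux : ∀ c w i → (i ≡ true → w ≡ true) → c ∨ i ≡ true → w ∨ c ≡ true
        aux c    true  _     _ _ = refl
        aux true false _     _ _ = refl
        aux false false true h _ = h refl

    build : (∀ v → Maximal v) → Classes m J
    build M = record { sparse = sp ; cls = cls ; idem = λ v → same (sub v (cls v) (cls∈ v))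
                     ; tight = λ v → tight-ext (λ w → bool-ext (λ h → ≡⇒== (same (sub v w h))) (λ h → sub⁻ v w (==⇒≡ h)))
                                 (proj₁ (proj₂ (proj₂ (M v))))
                     ; max = λ {W} {v} {w} tW v∈W w∈W → sym (same (sub v w (proj₂ (proj₂ (proj₂ (M v))) W tW v∈W w w∈W))) }
      where
      C : Fin n → VSet
      C v = proj₁ (M v)
      self : ∀ v → C v v ≡ true
      self v = proj₁ (proj₂ (M v))
      tC : ∀ v → Tight m J (C v)
      tC v = proj₁ (proj₂ (proj₂ (M v)))
      maxC : ∀ v W → Tight m J W → W v ≡ true → ∀ w → W w ≡ true → C v w ≡ true
      maxC v = proj₂ (proj₂ (proj₂ (M v)))
      sub : ∀ v w → C v w ≡ true → ∀ x → C w x ≡ C v x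
      sub v w w∈ x = bool-ext (maxC v (C w) (tC w) (maxC w (C v) (tC v) w∈ v (self v)) x) (maxC w (C v) (tC v) w∈ x)
      cls : Fin n → Fin n
      cls v = first (C v) v
      cls∈ : ∀ v → C v (cls v) ≡ true
      cls∈ v = first-∈ (C v) v (self v)
      same : ∀ {w v} → (∀ x → C w x ≡ C v x) → cls w ≡ cls v
      same {w} {v} h = first-unique (C w) (C v) h w v (self w) (self v)
      sub⁻ : ∀ v w → cls w ≡ cls v → C v w ≡ true
      sub⁻ v w eq = trans (sym (sub v (cls v) (cls∈ v) w)) (trans (cong (λ z → C z w) (sym eq))
        (trans (sub w (cls w) (cls∈ w) w) (self w)))

-- Modifying the matching inside tight sets

∨-elim : ∀ x {y} → x ∨ y ≡ true → x ≡ true ⊎ y ≡ true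
∨-elim true  _ = inj₁ refl
∨-elim false h = inj₂ h

∨-false : ∀ {x y} → x ∨ y ≡ false → x ≡ false × y ≡ false
∨-false {false} {false} _ = refl , refl

∨-left : ∀ {x} y → x ≡ true → x ∨ y ≡ true
∨-left y refl = refl

bool-cases : ∀ b → b ≡ true ⊎ b ≡ false
bool-cases true  = inj₁ refl
bool-cases false = inj₂ refl

count-ext : ∀ {n} {V W : Fin n → Bool} → (∀ v → V v ≡ W v) → count V ≡ count W
count-ext h = sum-cong λ v → cong [_] (h v)

module LocalSearch {n k : ℕ} (s t : Fin k → Fin n) (m : ℕ) (F B : Fin k → Bool) (u : Fin n)
                   (B⊆F : ∀ e → B e ≡ true → F e ≡ true) where
  open Edges s t
  open Sparsity s t
  open Packing s t
  open Partition s t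

  Inc : Fin n → Fin k → Set
  Inc v e = s e ≡ v ⊎ t e ≡ v

  touches : VSet → ESet
  touches S e = S (s e) ∨ S (t e)

  touches-inc : ∀ {S v e} → Inc v e → S v ≡ true → touches S e ≡ true
  touches-inc {S} {v} {e} (inj₁ refl) h = ∨-left (S (t e)) h
  touches-inc {S} {v} {e} (inj₂ refl) h = ∨-right (S (s e)) h

  ins-inc : ∀ {W v e} → Inc v e → ins W e ≡ true → W v ≡ true
  ins-inc {W} {e = e} (inj₁ refl) h = ins-s W {e} h
  ins-inc {W} {e = e} (inj₂ refl) h = ins-t W {e} h

  with-base : ESet → ESet
  with-base M e = B e ∨ M e

  restrict : VSet → ESet → ESet
  restrict S M e = B e ∨ (M e ∧ not (touches S e))

  -- The condition `v ≢ u` means that `u` can never be freed. It therefore ends up in a maximal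
  -- frozen set and costs the `+ 1` in the count of that set.
  Unsaturated : ESet → Fin n → Set
  Unsaturated M v = v ≢ u × (∀ e → M e ≡ true → ¬ Inc v e)

  record Feasible (M : ESet) : Set where
    field
      new      : ∀ e → M e ≡ true → F e ≡ false
      sparse   : Sparse m (with-base M)
      matching : ∀ {v e e′} → M e ≡ true → M e′ ≡ true → Inc v e → Inc v e′ → e ≡ e′
      avoids   : ∀ e → M e ≡ true → ¬ Inc u e

  restrict⊆ : ∀ {S M} e → restrict S M e ≡ true → with-base M e ≡ true
  restrict⊆ {S} {M} e h with B e
  ... | true  = refl
  ... | false = ∧-left (M e) h

  restrict-intro : ∀ {S M} e → M e ≡ true → touches S e ≡ false → restrict S M e ≡ true
  restrict-intro {S} {M} e h₁ h₂ = ∨-right (B e) (true-∧ h₁ (cong not h₂))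

  restrict-elim : ∀ {S M} e → restrict S M e ≡ true → B e ≡ true ⊎ (M e ≡ true × touches S e ≡ false)
  restrict-elim {S} {M} e h with ∨-elim (B e) h
  ... | inj₁ b = inj₁ b
  ... | inj₂ h′ = inj₂ (∧-left (M e) h′ , not-true (∧-right (M e) h′))

  restrict-false : ∀ {S M} e → F e ≡ false → M e ≡ false → restrict S M e ≡ false
  restrict-false {S} {M} e e∉F e∉M = ≢true λ h → contra (restrict-elim {S} {M} e h)
    where
    contra : B e ≡ true ⊎ (M e ≡ true × touches S e ≡ false) → ⊥
    contra (inj₁ b)       = true≢false (B⊆F e b) e∉F
    contra (inj₂ (h , _)) = true≢false h e∉M

  -- A tight set is already full: a further edge of `Y` inside `Q` would violate the sparsity of
  -- `Y`.
  tight-closed : ∀ {X Y Q e} → Sparse m Y → (∀ e → X e ≡ true → Y e ≡ true) → Tight m X Q →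
    Y e ≡ true → ins Q e ≡ true → X e ≡ true
  tight-closed {X} {Y} {Q} {e} sp X⊆Y tQ e∈Y e∈Q with bool-cases (X e)
  ... | inj₁ h = h
  ... | inj₂ h = ⊥-elim (tight-insert-absurd (sparse-⊆ sub sp) h tQ e∈Q)
    where
    sub : ∀ e′ → insert X e e′ ≡ true → Y e′ ≡ true
    sub e′ h′ with ∨-elim (X e′) h′
    ... | inj₁ p = X⊆Y e′ p
    ... | inj₂ p = subst (λ z → Y z ≡ true) (==⇒≡ p) e∈Y

  opaque
    unfolding E

    restrict-count : ∀ {S M N Q} → Feasible M → Feasible N →
      (∀ e → ins Q e ≡ false ⊎ touches S e ≡ true → N e ≡ M e) →
      E (restrict S N) Q + count M ≡ E (restrict S M) Q + count N
    restrict-count {S} {M} {N} {Q} fM fN agree = sum-cong₂₂ λ e →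
      aux (B e) (M e) (N e) (touches S e) (ins Q e)
        (λ h → agree e (inj₁ h)) (λ h → agree e (inj₂ h))
        (λ h → ≢true λ b → true≢false (B⊆F e b) (Feasible.new fM e h))
        (λ h → ≢true λ b → true≢false (B⊆F e b) (Feasible.new fN e h))
      where
      aux : ∀ b x y c i → (i ≡ false → y ≡ x) → (c ≡ true → y ≡ x) → (x ≡ true → b ≡ false) → (y ≡ true → b ≡ false) →
        [ (b ∨ (y ∧ not c)) ∧ i ] + [ x ] ≡ [ (b ∨ (x ∧ not c)) ∧ i ] + [ y ]
      aux = toWitness {a? = ∀B? λ b → ∀B? λ x → ∀B? λ y → ∀B? λ c → ∀B? λ i →
        (_ ≟B _ →-dec _ ≟B _) →-dec (_ ≟B _ →-dec _ ≟B _) →-dec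
        (_ ≟B _ →-dec _ ≟B _) →-dec (_ ≟B _ →-dec _ ≟B _) →-dec _ ≟ _} tt

  -- `M` and `N` have the same size and differ only inside `Q` and away from `S`, so there they have
  -- equally many edges; `B` is disjoint from both.
  restrict-tight : ∀ {S M N Q} → Feasible M → Feasible N → count N ≡ count M →
    (∀ e → ins Q e ≡ false ⊎ touches S e ≡ true → N e ≡ M e) →
    Tight m (restrict S M) Q → Tight m (restrict S N) Q
  restrict-tight {S} {M} {N} {Q} fM fN eq agree tQ = ≤-trans tQ (+-monoˡ-≤ m (≤-reflexive
    (+-cancelʳ-≡ (count M) _ _ (sym (trans (restrict-count {S} fM fN agree) (cong (E (restrict S M) Q +_) eq))))))

  module _ (M : ESet) (feasible : Feasible M) (maximum : ∀ N → Feasible N → count N ≤ count M) where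

    -- Changes confined to a tight set `Z` can be combined with changes in a disjoint tight set, and
    -- sparsity survives there by `replace-sparse`. Leaving the edges at `S` alone preserves the
    -- part of the matching that `restrict S` drops.
    record Free (S : VSet) (v : Fin n) : Set where
      field
        N           : ESet
        feasibleN   : Feasible N
        size        : count N ≡ count M
        Z           : VSet
        tightZ      : Tight m (restrict S M) Z
        v∈Z         : Z v ≡ true
        agree       : ∀ e → ins Z e ≡ false ⊎ touches S e ≡ true → N e ≡ M e
        unsaturated : Unsaturated N v

    -- Each vertex is tested against the set as it was when that vertex was added. The derivation
    -- records this history, and `separated-absurd` unwinds it from the last vertex to the first.
    data Frozen : VSet → Set where
      empty : Frozen λ _ → false
      add   : ∀ {S z} → Frozen S → ¬ Free S z → Frozen λ v → S v ∨ z == v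

    -- The state after both ends of `e` have been freed, at the stage `S`. Only a tight set through
    -- both ends could now prevent the addition of `e`, and `apart` excludes one for `M`. Tightness
    -- of `X` and `Y` is recorded for `M` and for `N`, since unions with them are formed on both
    -- sides.
    record Separated (S : VSet) (N : ESet) (X Y : VSet) (e : Fin k) : Set where
      field
        feasibleN : Feasible N
        size      : count N ≡ count M
        tightX    : Tight m (restrict S M) X
        tightY    : Tight m (restrict S M) Y
        tightX′   : Tight m (restrict S N) X
        tightY′   : Tight m (restrict S N) Y
        s∈X       : X (s e) ≡ true
        t∈Y       : Y (t e) ≡ true
        agree     : ∀ e′ → (ins X e′ ≡ false × ins Y e′ ≡ false) ⊎ touches S e′ ≡ true → N e′ ≡ M e′
        unsat-s   : Unsaturated N (s e)
        unsat-t   : Unsaturated N (t e)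
        untouched : touches S e ≡ false
        e∉F       : F e ≡ false
        apart     : ∀ W → Tight m (restrict S M) W → ins W e ≡ true → ⊥

    module _ {S N X Y e} (sep : Separated S N X Y e) where
      open Separated sep
      open Feasible feasibleN

      e∉N : N e ≡ false
      e∉N = ≢true λ h → proj₂ unsat-s e h (inj₁ refl)

      restrict-sparse : Sparse m (restrict S N)
      restrict-sparse = sparse-⊆ (restrict⊆ {S} {N}) sparse

      hull : VSet → VSet
      hull W = (W ∪ X) ∪ Y

      hull-off : ∀ {W} e′ → ins (hull W) e′ ≡ false → ins X e′ ≡ false × ins Y e′ ≡ false
      hull-off {W} e′ h =
        ≢true (λ p → true≢false (ins-⊆′ (λ v q → ∨-left (Y v) (∨-right (W v) q)) p) h) ,
        ≢true (λ p → true≢false (ins-⊆′ (λ v q → ∨-right (W v ∨ X v) q) p) h)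
        where
        ins-⊆′ : ∀ {V} → (∀ v → V v ≡ true → hull W v ≡ true) → ins V e′ ≡ true → ins (hull W) e′ ≡ true
        ins-⊆′ {V} f p = true-∧ (f (s e′) (ins-s V {e′} p)) (f (t e′) (ins-t V {e′} p))

      hull-e : ∀ {W} → ins W e ≡ true → ins (hull W) e ≡ true
      hull-e {W} h = true-∧ (∨-left (Y (s e)) (∨-left (X (s e)) (ins-s W {e} h)))
                            (∨-left (Y (t e)) (∨-left (X (t e)) (ins-t W {e} h)))

      hull-tight : ∀ {K W} → Sparse m K → Tight m K X → Tight m K Y → Tight m K W → ins W e ≡ true → Tight m K (hull W)
      hull-tight {K} {W} sp tX tY tW h =
        tight-∪ sp (tight-∪ sp tW tX (ins-s W {e} h) s∈X) tY (∨-left (X (t e)) (ins-t W {e} h)) t∈Y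

      -- A tight set of `restrict S N` through `e` joins with `X` and `Y` to a tight hull. Outside
      -- the hull `M` and `N` agree, so the hull is tight for `M` too, against `apart`.
      insert-e-sparse : Sparse m (insert (restrict S N) e)
      insert-e-sparse = insert-sparse restrict-sparse λ W tW e∈W →
        apart (hull W) (restrict-tight {S} feasibleN feasible (sym size)
          (λ e′ → λ { (inj₁ h) → sym (agree e′ (inj₁ (hull-off {W} e′ h))) ; (inj₂ h) → sym (agree e′ (inj₂ h)) })
          (hull-tight restrict-sparse tightX′ tightY′ tW e∈W)) (hull-e {W} e∈W)

    insert-elim : ∀ {X e e′} → insert X e e′ ≡ true → X e′ ≡ true ⊎ e ≡ e′
    insert-elim {X} {e} {e′} h with ∨-elim (X e′) h
    ... | inj₁ p = inj₁ p
    ... | inj₂ p = inj₂ (==⇒≡ p)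

    -- For the last vertex z added to S: if some set tight for the smaller S contains both ends of e, then exchanging
    -- the edge of N at z for e frees z.  With no vertex left, adding e to N contradicts maximality.
    separated-absurd : ∀ {S N X Y e} → Frozen S → Separated S N X Y e → ⊥
    separated-absurd {N = N} {e = e} empty sep =
      <⇒≱ (≤-reflexive (cong suc (sym size))) (≤-trans (≤-reflexive (sym (count-insert N e (e∉N sep))))
        (maximum (insert N e) record
          { new = λ e′ h → cases (insert-elim {N} h) (new e′) λ { refl → e∉F }
          ; sparse = sparse-⊆ sub (insert-e-sparse sep)
          ; matching = match
          ; avoids = λ e′ h → cases (insert-elim {N} h) (avoids e′)
              λ { refl (inj₁ p) → proj₁ unsat-s p ; refl (inj₂ p) → proj₁ unsat-t p } }))
      where
      open Separated sep
      open Feasible feasibleN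
      cases : ∀ {P Q R : Set} → P ⊎ Q → (P → R) → (Q → R) → R
      cases (inj₁ p) f g = f p
      cases (inj₂ q) f g = g q
      sub : ∀ e′ → with-base (insert N e) e′ ≡ true → insert (restrict (λ _ → false) N) e e′ ≡ true
      sub e′ h with ∨-elim (B e′) h
      ... | inj₁ b = insert-old (restrict (λ _ → false) N) e e′ (∨-left _ b)
      ... | inj₂ h′ with insert-elim {N} h′
      ...   | inj₁ p    = insert-old (restrict (λ _ → false) N) e e′ (restrict-intro {λ _ → false} {N} e′ p refl)
      ...   | inj₂ refl = insert-self (restrict (λ _ → false) N) e
      unsat : ∀ {v e′} → N e′ ≡ true → Inc v e → Inc v e′ → ⊥
      unsat h (inj₁ refl) i = proj₂ unsat-s _ h i
      unsat h (inj₂ refl) i = proj₂ unsat-t _ h i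
      match : ∀ {v e₁ e₂} → insert N e e₁ ≡ true → insert N e e₂ ≡ true → Inc v e₁ → Inc v e₂ → e₁ ≡ e₂
      match h₁ h₂ i₁ i₂ with insert-elim {N} h₁ | insert-elim {N} h₂
      ... | inj₁ p₁   | inj₁ p₂   = matching p₁ p₂ i₁ i₂
      ... | inj₂ refl | inj₂ refl = refl
      ... | inj₁ p₁   | inj₂ refl = ⊥-elim (unsat p₁ i₂ i₁)
      ... | inj₂ refl | inj₁ p₂   = ⊥-elim (unsat p₂ i₁ i₂)
    separated-absurd {N = N} {X} {Y} {e} (add {S} {z} frozen ¬free) sep =
      by-cases (Σ VSet λ W → Tight m (restrict S M) W × ins W e ≡ true) together
        λ none → separated-absurd {S} {N} {X} {Y} {e} frozen record
          { feasibleN = feasibleN ; size = size ; tightX = weaken tightX ; tightY = weaken tightY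
          ; tightX′ = weaken tightX′ ; tightY′ = weaken tightY′ ; s∈X = s∈X ; t∈Y = t∈Y
          ; agree = λ e′ → λ { (inj₁ h) → agree e′ (inj₁ h) ; (inj₂ h) → agree e′ (inj₂ (touch⁺ e′ h)) }
          ; unsat-s = unsat-s ; unsat-t = unsat-t ; untouched = untouchedS ; e∉F = e∉F
          ; apart = λ W tW h → none (W , tW , h) }
      where
      open Separated sep
      open Feasible feasibleN
      S⁺ : VSet
      S⁺ v = S v ∨ z == v

      touch⁺ : ∀ e′ → touches S e′ ≡ true → touches S⁺ e′ ≡ true
      touch⁺ e′ h with ∨-elim (S (s e′)) h
      ... | inj₁ p = ∨-left _ (∨-left _ p)
      ... | inj₂ p = ∨-right (S⁺ (s e′)) (∨-left _ p)

      touch⁻ : ∀ e′ → touches S⁺ e′ ≡ true → touches S e′ ≡ true ⊎ Inc z e′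
      touch⁻ e′ h with ∨-elim (S⁺ (s e′)) h
      touch⁻ e′ h | inj₁ p with ∨-elim (S (s e′)) p
      ... | inj₁ q = inj₁ (∨-left _ q)
      ... | inj₂ q = inj₂ (inj₁ (sym (==⇒≡ q)))
      touch⁻ e′ h | inj₂ p with ∨-elim (S (t e′)) p
      ... | inj₁ q = inj₁ (∨-right (S (s e′)) q)
      ... | inj₂ q = inj₂ (inj₂ (sym (==⇒≡ q)))

      untouchedS : touches S e ≡ false
      untouchedS = ≢true λ h → true≢false (touch⁺ e h) untouched

      restrict⁺ : ∀ {K} e′ → restrict S⁺ K e′ ≡ true → restrict S K e′ ≡ true
      restrict⁺ {K} e′ h with restrict-elim {S⁺} {K} e′ h
      ... | inj₁ b = ∨-left _ b
      ... | inj₂ (p , q) = restrict-intro {S} {K} e′ p (≢true λ r → true≢false (touch⁺ e′ r) q)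

      weaken : ∀ {K W} → Tight m (restrict S⁺ K) W → Tight m (restrict S K) W
      weaken {K} = tight-⊆ (λ e′ _ → restrict⁺ {K} e′)

      z∉e : ¬ Inc z e
      z∉e i = true≢false (touches-inc {S⁺} i (∨-right (S z) (==-refl z))) untouched

      together : (Σ VSet λ W → Tight m (restrict S M) W × ins W e ≡ true) → ⊥
      together (W , tW , e∈W) = exchange (any? (λ g → (N g ∧ not (touches S g)) ∧ (s g == z ∨ t g == z) ≟B true))
        where
        Q : VSet
        Q = hull sep W

        tQ : Tight m (restrict S M) Q
        tQ = hull-tight sep (sparse-⊆ (restrict⊆ {S} {M}) (Feasible.sparse feasible)) (weaken tightX) (weaken tightY) tW e∈W

        agreeQ : ∀ e′ → ins Q e′ ≡ false ⊎ touches S e′ ≡ true → N e′ ≡ M e′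
        agreeQ e′ (inj₁ h) = agree e′ (inj₁ (hull-off sep {W} e′ h))
        agreeQ e′ (inj₂ h) = agree e′ (inj₂ (touch⁺ e′ h))

        tQ′ : Tight m (restrict S N) Q
        tQ′ = restrict-tight {S} feasible feasibleN size agreeQ tQ

        e∈Q : ins Q e ≡ true
        e∈Q = hull-e sep {W} e∈W

        -- `Q` contains both ends of `e`, and `e` can be added to `restrict S⁺ N`; so `Q` is not
        -- tight there, although it is tight for the smaller `S`. The loss must come from an edge
        -- `g` of `N` at `z` inside `Q`.
        untight : ¬ Tight m (restrict S⁺ N) Q
        untight tQ⁺ = tight-insert-absurd (insert-e-sparse sep) (restrict-false {S⁺} {N} e e∉F (e∉N sep)) tQ⁺ e∈Q

        exchange : Dec (∃ λ g → (N g ∧ not (touches S g)) ∧ (s g == z ∨ t g == z) ≡ true) → ⊥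
        exchange (no none) = untight (tight-⊆ sub tQ′)
          where
          sub : ∀ e′ → ins Q e′ ≡ true → restrict S N e′ ≡ true → restrict S⁺ N e′ ≡ true
          sub e′ _ h with restrict-elim {S} {N} e′ h
          ... | inj₁ b = ∨-left _ b
          ... | inj₂ (p , q) = restrict-intro {S⁺} {N} e′ p (≢true λ r → contra (touch⁻ e′ r))
            where
            contra : touches S e′ ≡ true ⊎ Inc z e′ → ⊥
            contra (inj₁ r) = true≢false r q
            contra (inj₂ (inj₁ r)) = none (e′ , true-∧ (true-∧ p (cong not q)) (∨-left _ (≡⇒== r)))
            contra (inj₂ (inj₂ r)) = none (e′ , true-∧ (true-∧ p (cong not q)) (∨-right (s e′ == z) (≡⇒== r)))
        exchange (yes (g , hg)) = ¬free record
            { N = N′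
            ; feasibleN = record { new = new′ ; sparse = sparse′ ; matching = match ; avoids = avoids′ }
            ; size = trans count′ size
            ; Z = Q ; tightZ = tQ ; v∈Z = ins-inc {Q} z∈g g∈Q
            ; agree = agree′ ; unsaturated = z≢u , unsat-z }
          where
          g∈N : N g ≡ true
          g∈N = ∧-left (N g) (∧-left (N g ∧ not (touches S g)) hg)
          g-untouched : touches S g ≡ false
          g-untouched = not-true (∧-right (N g) (∧-left (N g ∧ not (touches S g)) hg))
          z∈g : Inc z g
          z∈g with ∨-elim (s g == z) (∧-right (N g ∧ not (touches S g)) hg)
          ... | inj₁ p = inj₁ (==⇒≡ p)
          ... | inj₂ p = inj₂ (==⇒≡ p)
          z≢u : z ≢ u
          z≢u refl = avoids g g∈N z∈g

          N′ : ESet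
          N′ = insert (delete N g) e

          N′-elim : ∀ {e′} → N′ e′ ≡ true → (N e′ ≡ true × g ≢ e′) ⊎ e ≡ e′
          N′-elim h with insert-elim {delete N g} h
          ... | inj₁ p = inj₁ (delete-elim {N} p)
          ... | inj₂ p = inj₂ p

          g∈Q : ins Q g ≡ true
          g∈Q with bool-cases (ins Q g)
          ... | inj₁ h = h
          ... | inj₂ h = ⊥-elim (untight (tight-⊆ sub tQ′))
            where
            sub : ∀ e′ → ins Q e′ ≡ true → restrict S N e′ ≡ true → restrict S⁺ N e′ ≡ true
            sub e′ e′∈Q h′ with restrict-elim {S} {N} e′ h′
            ... | inj₁ b = ∨-left _ b
            ... | inj₂ (p , q) = restrict-intro {S⁺} {N} e′ p (≢true λ r → contra (touch⁻ e′ r))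
              where
              contra : touches S e′ ≡ true ⊎ Inc z e′ → ⊥
              contra (inj₁ r) = true≢false r q
              contra (inj₂ r) = true≢false e′∈Q (subst (λ x → ins Q x ≡ false) (matching g∈N p z∈g r) h)

          new′ : ∀ e′ → N′ e′ ≡ true → F e′ ≡ false
          new′ e′ h with N′-elim h
          ... | inj₁ (p , _) = new e′ p
          ... | inj₂ refl    = e∉F

          unsat : ∀ {v e′} → N e′ ≡ true → Inc v e → Inc v e′ → ⊥
          unsat h (inj₁ refl) i = proj₂ unsat-s _ h i
          unsat h (inj₂ refl) i = proj₂ unsat-t _ h i

          match : ∀ {v e₁ e₂} → N′ e₁ ≡ true → N′ e₂ ≡ true → Inc v e₁ → Inc v e₂ → e₁ ≡ e₂
          match h₁ h₂ i₁ i₂ with N′-elim h₁ | N′-elim h₂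
          ... | inj₁ (p₁ , _) | inj₁ (p₂ , _) = matching p₁ p₂ i₁ i₂
          ... | inj₂ refl     | inj₂ refl     = refl
          ... | inj₁ (p₁ , _) | inj₂ refl     = ⊥-elim (unsat p₁ i₂ i₁)
          ... | inj₂ refl     | inj₁ (p₂ , _) = ⊥-elim (unsat p₂ i₁ i₂)

          avoids′ : ∀ e′ → N′ e′ ≡ true → ¬ Inc u e′
          avoids′ e′ h i with N′-elim h
          avoids′ e′ h i        | inj₁ (p , _) = avoids e′ p i
          avoids′ e′ h (inj₁ p) | inj₂ refl = proj₁ unsat-s p
          avoids′ e′ h (inj₂ p) | inj₂ refl = proj₁ unsat-t p

          sparse′ : Sparse m (with-base N′)
          -- Outside `Q` nothing changes. Inside, tightness puts all edges of `N` into
          -- `restrict S N`, and `g` is the only edge of `N` at `z`; the others lie in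
          -- `restrict S⁺ N`, to which `e` may be added.
          sparse′ = replace-sparse {Y = insert (restrict S⁺ N) e} Q sparse (insert-e-sparse sep)
              (tight-⊆ (λ e′ _ → restrict⊆ {S} {N} e′) tQ′) beyond within
            where
            beyond : ∀ e′ → ins Q e′ ≡ false → with-base N′ e′ ≡ true → with-base N e′ ≡ true
            beyond e′ h₁ h with ∨-elim (B e′) h
            ... | inj₁ b = ∨-left _ b
            ... | inj₂ h′ with N′-elim h′
            ...   | inj₁ (p , _) = ∨-right (B e′) p
            ...   | inj₂ refl    = ⊥-elim (true≢false e∈Q h₁)
            within : ∀ e′ → ins Q e′ ≡ true → with-base N′ e′ ≡ true → insert (restrict S⁺ N) e e′ ≡ true
            within e′ e′∈Q h with ∨-elim (B e′) h
            ... | inj₁ b = insert-old (restrict S⁺ N) e e′ (∨-left _ b)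
            ... | inj₂ h′ with N′-elim h′
            ...   | inj₂ refl      = insert-self (restrict S⁺ N) e
            ...   | inj₁ (p , g≢) with restrict-elim {S} {N} e′
                      (tight-closed sparse (restrict⊆ {S} {N}) tQ′ (∨-right (B e′) p) e′∈Q)
            ...     | inj₁ b = insert-old (restrict S⁺ N) e e′ (∨-left _ b)
            ...     | inj₂ (_ , q) = insert-old (restrict S⁺ N) e e′ (restrict-intro {S⁺} {N} e′ p (≢true λ r → contra (touch⁻ e′ r)))
              where
              contra : touches S e′ ≡ true ⊎ Inc z e′ → ⊥
              contra (inj₁ r) = true≢false r q
              contra (inj₂ r) = g≢ (matching g∈N p z∈g r)

          count′ : count N′ ≡ count N
          count′ = trans (count-insert (delete N g) e (≢true λ h → true≢false (proj₁ (delete-elim {N} h)) (e∉N sep)))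
            (trans (sym (count-insert (delete N g) g (≢true λ h → proj₂ (delete-elim {N} h) refl))) (count-ext back))
            where
            back : ∀ e′ → insert (delete N g) g e′ ≡ N e′
            back e′ = aux (N e′) (g == e′) λ h → subst (λ x → N x ≡ true) (==⇒≡ h) g∈N
              where
              aux : ∀ x i → (i ≡ true → x ≡ true) → (x ∧ not i) ∨ i ≡ x
              aux = toWitness {a? = ∀B? λ x → ∀B? λ i → (_ ≟B _ →-dec _ ≟B _) →-dec _ ≟B _} tt

          agree′ : ∀ e′ → ins Q e′ ≡ false ⊎ touches S e′ ≡ true → N′ e′ ≡ M e′
          agree′ e′ h = trans (bool-ext down up) (agreeQ e′ h)
            where
            contra : ∀ {f} → ins Q f ≡ true → touches S f ≡ false → ins Q f ≡ false ⊎ touches S f ≡ true → ⊥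
            contra p q (inj₁ r) = true≢false p r
            contra p q (inj₂ r) = true≢false r q
            down : N′ e′ ≡ true → N e′ ≡ true
            down p with N′-elim p
            ... | inj₁ (q , _) = q
            ... | inj₂ refl    = ⊥-elim (contra e∈Q untouchedS h)
            up : N e′ ≡ true → N′ e′ ≡ true
            up p = insert-old (delete N g) e e′ (delete-intro {N} p λ { refl → contra g∈Q g-untouched h })

          unsat-z : ∀ e′ → N′ e′ ≡ true → ¬ Inc z e′
          unsat-z e′ h i with N′-elim h
          ... | inj₁ (p , g≢) = g≢ (matching g∈N p z∈g i)
          ... | inj₂ refl     = z∉e i

    -- For `e` in `F`, maximality of `B` decides. Otherwise the ends can be freed in two tight sets,
    -- which are disjoint because their union would be a tight set through `e`; the merged matching
    -- `N` misses both ends.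
    closure : ∀ {S} → Frozen S → (∀ v → S v ≡ false → ¬ ¬ Free S v) →
      (∀ e → F e ≡ true → B e ≡ false → ¬ Sparse m (insert B e)) → Sparse m B →
      ∀ e → touches S e ≡ false → restrict S M e ≡ false →
      (∀ W → Tight m (restrict S M) W → ins W e ≡ true → ⊥) → ⊥
    closure {S} frozen free maximalB sparseB e untouched e∉J apart with bool-cases (F e)
    ... | inj₁ e∈F = maximalB e e∈F (≢true λ h → true≢false (∨-left _ h) e∉J)
            (insert-sparse sparseB λ W tW e∈W → apart W (tight-⊆ (λ e′ _ h → ∨-left _ h) tW) e∈W)
    ... | inj₂ e∉F = free (s e) (proj₁ (∨-false untouched)) λ fs → free (t e) (proj₂ (∨-false {S (s e)} untouched)) λ ft →
            combine fs ft
      where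
      combine : Free S (s e) → Free S (t e) → ⊥
      combine fs ft = separated-absurd frozen record
          { feasibleN = feasibleN ; size = size ; tightX = X.tightZ ; tightY = Y.tightZ
          ; tightX′ = tight-⊆ (λ e′ h → restrict-mono X.N N e′ (onX h)) (restrict-tight {S} feasible X.feasibleN X.size X.agree X.tightZ)
          ; tightY′ = tight-⊆ (λ e′ h → restrict-mono Y.N N e′ (onY h)) (restrict-tight {S} feasible Y.feasibleN Y.size Y.agree Y.tightZ)
          ; s∈X = X.v∈Z ; t∈Y = Y.v∈Z ; agree = agree
          ; unsat-s = proj₁ X.unsaturated , unsatX ; unsat-t = proj₁ Y.unsaturated , unsatY
          ; untouched = untouched ; e∉F = e∉F ; apart = apart }
        where
        module X = Free fs
        module Y = Free ft

        disjoint : ∀ v → X.Z v ≡ true → Y.Z v ≡ true → ⊥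
        disjoint v v∈X v∈Y = apart (X.Z ∪ Y.Z)
          (tight-∪ (sparse-⊆ (restrict⊆ {S} {M}) (Feasible.sparse feasible)) X.tightZ Y.tightZ v∈X v∈Y)
          (true-∧ (∨-left (Y.Z (s e)) X.v∈Z) (∨-right (X.Z (t e)) Y.v∈Z))

        N : ESet
        N e′ = if ins X.Z e′ then X.N e′ else (if ins Y.Z e′ then Y.N e′ else M e′)

        X∌ : ∀ {e′} → ins Y.Z e′ ≡ true → ins X.Z e′ ≡ false
        X∌ {e′} h = ≢true λ h′ → disjoint (s e′) (ins-s X.Z {e′} h′) (ins-s Y.Z {e′} h)

        onX : ∀ {e′} → ins X.Z e′ ≡ true → N e′ ≡ X.N e′
        onX h rewrite h = refl

        onY : ∀ {e′} → ins Y.Z e′ ≡ true → N e′ ≡ Y.N e′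
        onY {e′} h rewrite X∌ {e′} h | h = refl

        off : ∀ {e′} → ins X.Z e′ ≡ false → ins Y.Z e′ ≡ false → N e′ ≡ M e′
        off h₁ h₂ rewrite h₁ | h₂ = refl

        offY : ∀ {e′} → ins Y.Z e′ ≡ false → N e′ ≡ X.N e′
        offY {e′} h with bool-cases (ins X.Z e′)
        ... | inj₁ p = onX p
        ... | inj₂ p = trans (off p h) (sym (X.agree e′ (inj₁ p)))

        offX : ∀ {e′} → ins X.Z e′ ≡ false → N e′ ≡ Y.N e′
        offX {e′} h with bool-cases (ins Y.Z e′)
        ... | inj₁ p = onY p
        ... | inj₂ p = trans (off h p) (sym (Y.agree e′ (inj₁ p)))

        restrict-mono : ∀ K L e′ → L e′ ≡ K e′ → restrict S K e′ ≡ true → restrict S L e′ ≡ true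
        restrict-mono K L e′ eq h = trans (cong (λ b → B e′ ∨ (b ∧ not (touches S e′))) eq) h

        agree : ∀ e′ → (ins X.Z e′ ≡ false × ins Y.Z e′ ≡ false) ⊎ touches S e′ ≡ true → N e′ ≡ M e′
        agree e′ (inj₁ (p , q)) = off p q
        agree e′ (inj₂ h) with bool-cases (ins Y.Z e′)
        ... | inj₁ p = trans (onY p) (Y.agree e′ (inj₂ h))
        ... | inj₂ p = trans (offY p) (X.agree e′ (inj₂ h))

        size : count N ≡ count M
        size = +-cancelʳ-≡ (count M) _ _ (trans (sum-cong₂₂ λ e′ →
            aux (ins X.Z e′) (ins Y.Z e′) (X.N e′) (Y.N e′) (M e′) (X∌ {e′})
              (λ h → X.agree e′ (inj₁ h)) (λ h → Y.agree e′ (inj₁ h)))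
          (cong₂ _+_ X.size Y.size))
          where
          aux : ∀ i j x y c → (j ≡ true → i ≡ false) → (i ≡ false → x ≡ c) → (j ≡ false → y ≡ c) →
            [ (if i then x else (if j then y else c)) ] + [ c ] ≡ [ x ] + [ y ]
          aux = toWitness {a? = ∀B? λ i → ∀B? λ j → ∀B? λ x → ∀B? λ y → ∀B? λ c →
            (_ ≟B _ →-dec _ ≟B _) →-dec (_ ≟B _ →-dec _ ≟B _) →-dec (_ ≟B _ →-dec _ ≟B _) →-dec _ ≟ _} tt

        feasibleN : Feasible N
        feasibleN = record
          { new = λ e′ h → split e′ (λ p → Feasible.new X.feasibleN e′ (trans (sym p) h))
                                    (λ p → Feasible.new Y.feasibleN e′ (trans (sym p) h))
          ; sparse = replace-sparse {X = with-base X.N} {with-base Y.N} Y.Z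
              (Feasible.sparse X.feasibleN) (Feasible.sparse Y.feasibleN)
              (tight-⊆ (λ e′ h → base-mono X.N e′ (off⁻ {e′} h)) Y.tightZ)
              (λ e′ h p → trans (cong (B e′ ∨_) (sym (offY h))) p) (λ e′ h p → trans (cong (B e′ ∨_) (sym (onY h))) p)
          ; matching = match
          ; avoids = λ e′ h → split e′ (λ p → Feasible.avoids X.feasibleN e′ (trans (sym p) h))
                                       (λ p → Feasible.avoids Y.feasibleN e′ (trans (sym p) h)) }
          where
          split : ∀ {P : Set} e′ → (N e′ ≡ X.N e′ → P) → (N e′ ≡ Y.N e′ → P) → P
          split e′ f g with bool-cases (ins Y.Z e′)
          ... | inj₁ p = g (onY p)
          ... | inj₂ p = f (offY p)
          off⁻ : ∀ {e′} → ins Y.Z e′ ≡ true → M e′ ≡ X.N e′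
          off⁻ {e′} h = sym (X.agree e′ (inj₁ (X∌ {e′} h)))
          base-mono : ∀ K e′ → M e′ ≡ K e′ → restrict S M e′ ≡ true → with-base K e′ ≡ true
          base-mono K e′ eq h = trans (cong (B e′ ∨_) (sym eq)) (restrict⊆ {S} {M} e′ h)
          match : ∀ {v e₁ e₂} → N e₁ ≡ true → N e₂ ≡ true → Inc v e₁ → Inc v e₂ → e₁ ≡ e₂
          -- An edge at a vertex of `Y.Z` cannot lie inside `X.Z`, so `N` agrees there with `Y.N`;
          -- at any other vertex no edge lies inside `Y.Z`, and `N` agrees with `X.N`.
          match {v} {e₁} {e₂} h₁ h₂ i₁ i₂ with bool-cases (Y.Z v)
          ... | inj₁ v∈Y = Feasible.matching Y.feasibleN (trans (sym (offX (X∌v e₁ i₁))) h₁) (trans (sym (offX (X∌v e₂ i₂))) h₂) i₁ i₂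
            where
            X∌v : ∀ e′ → Inc v e′ → ins X.Z e′ ≡ false
            X∌v e′ i = ≢true λ h → disjoint v (ins-inc {X.Z} i h) v∈Y
          ... | inj₂ v∉Y = Feasible.matching X.feasibleN (trans (sym (offY (Y∌v e₁ i₁))) h₁) (trans (sym (offY (Y∌v e₂ i₂))) h₂) i₁ i₂
            where
            Y∌v : ∀ e′ → Inc v e′ → ins Y.Z e′ ≡ false
            Y∌v e′ i = ≢true λ h → true≢false (ins-inc {Y.Z} i h) v∉Y

        unsatX : ∀ e′ → N e′ ≡ true → ¬ Inc (s e) e′
        unsatX e′ h i = proj₂ X.unsaturated e′
          (trans (sym (offY (≢true λ p → disjoint (s e) X.v∈Z (ins-inc {Y.Z} i p)))) h) i

        unsatY : ∀ e′ → N e′ ≡ true → ¬ Inc (t e) e′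
        unsatY e′ h i = proj₂ Y.unsaturated e′
          (trans (sym (offX (≢true λ p → disjoint (t e) (ins-inc {X.Z} i p) Y.v∈Z))) h) i

sum-≥1 : ∀ {n} (f : Fin n → ℕ) i → 1 ≤ f i → 1 ≤ sum f
sum-≥1 f i h = ≤-trans h (term≤sum f i)

all-vertices : ∀ {n} → Fin n → Bool
all-vertices _ = true

module Covering {n k : ℕ} (s t : Fin k → Fin n) {m : ℕ} {J : Fin k → Bool}
                (C : Partition.Classes s t m J) (S : Fin n → Bool) where
  open Edges s t
  open Sparsity s t
  open Packing s t
  open Partition s t
  open Classes C

  touchesS : ESet
  touchesS e = S (s e) ∨ S (t e)

  -- σ marks the classes meeting S; τ orders the classes, those meeting S first.
  σ : Fin n → Bool
  σ i = ⌊ any? (λ v → cls v == i ∧ S v ≟B true) ⌋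

  τ : Fin n → ℕ
  τ i = if σ i then toℕ i else n + toℕ i

  τ-inj : ∀ i j → τ i ≡ τ j → i ≡ j
  τ-inj i j eq with σ i | σ j
  ... | true  | true  = toℕ-injective eq
  ... | false | false = toℕ-injective (+-cancelˡ-≡ n _ _ eq)
  ... | true  | false = ⊥-elim (<⇒≱ (toℕ<n i) (≤-trans (m≤m+n n _) (≤-reflexive (sym eq))))
  ... | false | true  = ⊥-elim (<⇒≱ (toℕ<n j) (≤-trans (m≤m+n n _) (≤-reflexive eq)))

  τ<2n : ∀ i → τ i < n + n
  τ<2n i with σ i
  ... | true  = ≤-trans (toℕ<n i) (m≤m+n n n)
  ... | false = +-monoʳ-< n (toℕ<n i)

  τ-σ : ∀ i j → τ i < τ j → σ j ≡ true → σ i ≡ true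
  τ-σ i j h σj with σ i
  ... | true  = refl
  ... | false rewrite σj = ⊥-elim (<⇒≱ (toℕ<n j) (≤-trans (m≤m+n n _) (<⇒≤ h)))

  low high : Fin k → Fin n
  low  e = if ⌊ τ (cls (s e)) ≤? τ (cls (t e)) ⌋ then s e else t e
  high e = if ⌊ τ (cls (s e)) ≤? τ (cls (t e)) ⌋ then t e else s e

  ends-split : ∀ e → (low e ≡ s e × high e ≡ t e) ⊎ (low e ≡ t e × high e ≡ s e)
  ends-split e with τ (cls (s e)) ≤? τ (cls (t e))
  ... | yes _ = inj₁ (refl , refl)
  ... | no  _ = inj₂ (refl , refl)

  low<high : ∀ e → cls (s e) ≢ cls (t e) → τ (cls (low e)) < τ (cls (high e))
  low<high e ≢ with τ (cls (s e)) ≤? τ (cls (t e))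
  ... | yes p = ≤∧≢⇒< p (≢ ∘ τ-inj _ _)
  ... | no ¬p = ≰⇒> ¬p

  -- Crossing edges at `S` need no further vertex: they disappear together with `S`.
  open-crossing : ESet
  open-crossing e = crossing e ∧ not (touchesS e)

  crossing-≢ : ∀ {e} → crossing e ≡ true → cls (s e) ≢ cls (t e)
  crossing-≢ {e} h = ==⇒≢ (not-true (∧-right (J e) h))

  #free #frozen : Fin n → ℕ
  #free   i = sum λ v → [ cls v == i ] * [ not (S v) ]
  #frozen i = sum λ v → [ cls v == i ] * [ S v ]

  degree : Fin n → ℕ
  degree i = sum (λ e → [ cls (s e) == i ] * [ crossing e ]) + sum (λ e → [ cls (t e) == i ] * [ crossing e ])

  module _ (𝒩 : Fin n → Bool) where

    covered : ESet
    covered e = open-crossing e ∧ 𝒩 (cls (low e))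

    back : Fin n → ℕ
    back i = sum λ e → [ cls (high e) == i ] * [ covered e ]

  back-local : ∀ 𝒩 𝒩′ i → (∀ j → τ j < τ i → 𝒩 j ≡ 𝒩′ j) → back 𝒩 i ≡ back 𝒩′ i
  back-local 𝒩 𝒩′ i h = sum-cong λ e → cases e (bool-cases (open-crossing e)) (bool-cases (cls (high e) == i))
    where
    cases : ∀ e → open-crossing e ≡ true ⊎ open-crossing e ≡ false → cls (high e) == i ≡ true ⊎ cls (high e) == i ≡ false →
      [ cls (high e) == i ] * [ covered 𝒩 e ] ≡ [ cls (high e) == i ] * [ covered 𝒩′ e ]
    cases e (inj₂ p) _        rewrite p = refl
    cases e (inj₁ _) (inj₂ p) rewrite p = refl
    cases e (inj₁ o) (inj₁ p) = cong (λ b → [ cls (high e) == i ] * [ open-crossing e ∧ b ])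
      (h (cls (low e)) (subst (λ z → τ (cls (low e)) < τ z) (==⇒≡ p)
        (low<high e (crossing-≢ (∧-left (crossing e) o)))))

  -- The greedy rule as a fixed-point equation. Since `back 𝒩 i` consults only classes earlier than
  -- `i`, a solution can be built by recursion along `τ`.
  Greedy : (Fin n → Bool) → Set
  Greedy 𝒩 = ∀ i → 𝒩 i ≡ ⌊ suc (back 𝒩 i) ≤? #free i ⌋

  greedy : Σ (Fin n → Bool) Greedy
  greedy = proj₁ (upTo (n + n)) , λ i → proj₂ (upTo (n + n)) i (τ<2n i)
    where
    upTo : ∀ T → Σ (Fin n → Bool) λ 𝒩 → ∀ i → τ i < T → 𝒩 i ≡ ⌊ suc (back 𝒩 i) ≤? #free i ⌋
    upTo zero    = (λ _ → false) , λ i ()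
    upTo (suc T) = 𝒩′ , good
      where
      𝒩 : Fin n → Bool
      𝒩 = proj₁ (upTo T)
      𝒩′ : Fin n → Bool
      𝒩′ i = if ⌊ suc (τ i) ≤? T ⌋ then 𝒩 i else ⌊ suc (back 𝒩 i) ≤? #free i ⌋
      old : ∀ i → τ i < T → 𝒩′ i ≡ 𝒩 i
      old i h with suc (τ i) ≤? T
      ... | yes _ = refl
      ... | no ¬p = ⊥-elim (¬p h)
      good : ∀ i → τ i < suc T → 𝒩′ i ≡ ⌊ suc (back 𝒩′ i) ≤? #free i ⌋
      good i (s≤s h) = trans value (cong (λ b → ⌊ suc b ≤? #free i ⌋)
          (back-local 𝒩 𝒩′ i λ j j<i → sym (old j (<-≤-trans j<i h))))
        where
        value : 𝒩′ i ≡ ⌊ suc (back 𝒩 i) ≤? #free i ⌋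
        value with suc (τ i) ≤? T
        ... | yes p = proj₂ (upTo T) i p
        ... | no  _ = refl

  σ-count : ∀ i → [ σ i ] ≤ #frozen i
  σ-count i with any? (λ v → cls v == i ∧ S v ≟B true)
  ... | no  _ = z≤n
  ... | yes (v , h) = sum-≥1 _ v (≤-reflexive (sym (aux (cls v == i) (S v) h)))
    where
    aux : ∀ x y → x ∧ y ≡ true → [ x ] * [ y ] ≡ 1
    aux true true _ = refl

  class-size : ∀ i → count (λ v → cls v == i) ≡ #frozen i + #free i
  class-size i = trans (sum-cong λ v → aux (cls v == i) (S v)) (sum-+ _ _)
    where
    aux : ∀ x y → [ x ] ≡ [ x ] * [ y ] + [ x ] * [ not y ]
    aux = toWitness {a? = ∀B? λ x → ∀B? λ y → _ ≟ _} tt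

  module Cover (𝒩 : Fin n → Bool) (isGreedy : Greedy 𝒩) where

    hit : VSet
    hit v = ⌊ any? (λ e → covered 𝒩 e ∧ high e == v ≟B true) ⌋

    S′ : VSet
    S′ v = S v ∨ (not (𝒩 (cls v)) ∨ hit v)

    hit-intro : ∀ e → covered 𝒩 e ≡ true → hit (high e) ≡ true
    hit-intro e h = true-⌊⌋ (e , true-∧ h (==-refl (high e)))

    -- An edge between different classes with both ends outside `S′` would miss `S` and hence belong
    -- to `J`; as both classes survive it is covered, and then its later end was put into `S′`.
    S′-separates : (∀ e → touchesS e ≡ false → cls (s e) ≢ cls (t e) → J e ≡ true) →
      ∀ e → S′ (s e) ≡ false → S′ (t e) ≡ false → cls (s e) ≡ cls (t e)
    S′-separates closure e s∉ t∉ with cls (s e) Fin.≟ cls (t e)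
    ... | yes p = p
    ... | no ≢ = ⊥-elim (cases (ends-split e))
      where
      parts : ∀ {v} → S′ v ≡ false → S v ≡ false × 𝒩 (cls v) ≡ true × hit v ≡ false
      parts {v} h = proj₁ (∨-false h) , ¬false (proj₁ (∨-false (proj₂ (∨-false {S v} h)))) ,
        proj₂ (∨-false {not (𝒩 (cls v))} (proj₂ (∨-false {S v} h)))
        where
        ¬false : ∀ {b} → not b ≡ false → b ≡ true
        ¬false {true} _ = refl
      untouched : touchesS e ≡ false
      untouched = trans (cong (_∨ S (t e)) (proj₁ (parts s∉))) (proj₁ (parts t∉))
      opened : open-crossing e ≡ true
      opened = true-∧ (true-∧ (closure e untouched ≢) (cong not (≢⇒== ≢))) (cong not untouched)
      cases : (low e ≡ s e × high e ≡ t e) ⊎ (low e ≡ t e × high e ≡ s e) → ⊥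
      cases (inj₁ (l , h)) = true≢false (subst (λ v → hit v ≡ true) h (hit-intro e
        (true-∧ opened (trans (cong (𝒩 ∘ cls) l) (proj₁ (proj₂ (parts s∉))))))) (proj₂ (proj₂ (parts t∉)))
      cases (inj₂ (l , h)) = true≢false (subst (λ v → hit v ≡ true) h (hit-intro e
        (true-∧ opened (trans (cong (𝒩 ∘ cls) l) (proj₁ (proj₂ (parts t∉))))))) (proj₂ (proj₂ (parts s∉)))

    hits : Fin n → ℕ
    hits v = sum λ e → [ high e == v ] * [ covered 𝒩 e ]

    hit≤hits : ∀ v → [ hit v ] ≤ hits v
    hit≤hits v with any? (λ e → covered 𝒩 e ∧ high e == v ≟B true)
    ... | no  _ = z≤n
    ... | yes (e , h) = sum-≥1 _ e (≤-reflexive (sym (aux (covered 𝒩 e) (high e == v) h)))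
      where
      aux : ∀ x y → x ∧ y ≡ true → [ y ] * [ x ] ≡ 1
      aux true true _ = refl

    class-hits : ∀ (g : Fin n → ℕ) → sum (λ v → g (cls v) * hits v) ≡ sum (λ e → g (cls (high e)) * [ covered 𝒩 e ])
    class-hits g = fibre-sum high (g ∘ cls) (λ e → [ covered 𝒩 e ])

    -- In a surviving class fewer covered edges end than there are vertices outside `S`, so one of
    -- these vertices is not hit.
    survivor : ∀ i → 𝒩 i ≡ true → ∃ λ v → cls v ≡ i × S′ v ≡ false
    survivor i i∈𝒩 with sum-< fewer
      where
      back-hits : back 𝒩 i ≡ sum λ v → [ cls v == i ] * hits v
      back-hits = sym (class-hits (λ j → [ j == i ]))
      fewer : sum (λ v → [ cls v == i ] * hits v) < #free i
      fewer = subst (_< #free i) back-hits (⌊⌋-true (trans (sym (isGreedy i)) i∈𝒩))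
    ... | v , h = v , v∈i , trans (cong₂ _∨_ (∉S (S v) refl) (cong (_∨ hit v) (cong not (trans (cong 𝒩 v∈i) i∈𝒩)))) unhit
      where
      class? : ∀ b x → cls v == i ≡ b → [ b ] * x < [ b ] * [ not (S v) ] → cls v ≡ i
      class? true x p _ = ==⇒≡ p
      v∈i : cls v ≡ i
      v∈i = class? (cls v == i) (hits v) refl h
      h′ : hits v < [ not (S v) ]
      h′ = strip (subst (λ b → [ b ] * hits v < [ b ] * [ not (S v) ]) (≡⇒== v∈i) h)
        where
        strip : ∀ {x y} → 1 * x < 1 * y → x < y
        strip {x} {y} p = subst₂ _<_ (*-identityˡ x) (*-identityˡ y) p
      ∉S : ∀ b → S v ≡ b → S v ≡ false
      ∉S false p = p
      ∉S true  p = ⊥-elim (≮0 (subst (λ b → hits v < [ not b ]) p h′))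
        where
        ≮0 : ∀ {x} → ¬ (x < 0)
        ≮0 ()
      unhit : hit v ≡ false
      unhit = ≢true λ p → <⇒≱ h′ (≤-trans ([]≤1 (not (S v))) (≤-trans (≤-reflexive (cong [_] (sym p))) (hit≤hits v)))

    gained retained : ℕ
    gained   = sum λ i → [ root i ∧ not (𝒩 i) ] * #free i
    retained = sum λ i → [ root i ∧ 𝒩 i ] * back 𝒩 i

    S′-size : count S′ ≤ count S + (gained + retained)
    S′-size = ≤-trans (sum-mono pointwise) (≤-reflexive (trans (sum-+ _ _) (cong (count S +_) (trans (sum-+ _ _)
        (cong₂ _+_ (sym (class-sum (λ v → v) (not ∘ 𝒩) (λ v → [ not (S v) ])))
          (trans (class-hits (λ i → [ 𝒩 i ])) (sym (class-sum high 𝒩 (λ e → [ covered 𝒩 e ])))))))))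
      where
      aux : ∀ a b c x → [ c ] ≤ x → [ a ∨ (not b ∨ c) ] ≤ [ a ] + ([ not b ] * [ not a ] + [ b ] * x)
      aux true  b     c x _ = s≤s z≤n
      aux false false c x _ = s≤s z≤n
      aux false true  c x h = ≤-trans h (m≤m+n x 0)
      pointwise : ∀ v → [ S′ v ] ≤ [ S v ] + ([ not (𝒩 (cls v)) ] * [ not (S v) ] + [ 𝒩 (cls v) ] * hits v)
      pointwise v = aux (S v) (𝒩 (cls v)) (hit v) (hits v) (hit≤hits v)

    back≤degree : ∀ i → back 𝒩 i ≤ degree i
    back≤degree i = sum-mono₁₂ λ e → cases e (ends-split e)
      where
      aux : ∀ a b c d e → [ b ] * [ ((c ∧ d) ∧ e) ] ≤ [ a ] * [ c ] + [ b ] * [ c ]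
      aux = toWitness {a? = ∀B? λ a → ∀B? λ b → ∀B? λ c → ∀B? λ d → ∀B? λ e → _ ≤? _} tt
      aux′ : ∀ a b c d e → [ a ] * [ ((c ∧ d) ∧ e) ] ≤ [ a ] * [ c ] + [ b ] * [ c ]
      aux′ = toWitness {a? = ∀B? λ a → ∀B? λ b → ∀B? λ c → ∀B? λ d → ∀B? λ e → _ ≤? _} tt
      cases : ∀ e → (low e ≡ s e × high e ≡ t e) ⊎ (low e ≡ t e × high e ≡ s e) →
        [ cls (high e) == i ] * [ covered 𝒩 e ] ≤ [ cls (s e) == i ] * [ crossing e ] + [ cls (t e) == i ] * [ crossing e ]
      cases e (inj₁ (_ , h)) rewrite h =
        aux (cls (s e) == i) (cls (t e) == i) (crossing e) (not (touchesS e)) (𝒩 (cls (low e)))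
      cases e (inj₂ (_ , h)) rewrite h =
        aux′ (cls (s e) == i) (cls (t e) == i) (crossing e) (not (touchesS e)) (𝒩 (cls (low e)))

    over : (Fin n → Bool) → (Fin n → ℕ) → ℕ
    over U f = sum λ i → [ root i ∧ U i ] * f i

    -- Every crossing edge is charged at most 2. A covered edge has a surviving earlier class: it is
    -- charged 2 if the later class survives, and otherwise 1 through `degree` and 1 through `back`.
    -- Any other edge is charged through `degree` only.
    crossing-budget : over (not ∘ 𝒩) degree + over (not ∘ 𝒩) (back 𝒩) + 2 * over 𝒩 (back 𝒩) ≤ 2 * count crossing
    crossing-budget = ≤-trans (≤-reflexive (cong₂ _+_ (cong₂ _+_ degrees (class-sum high (not ∘ 𝒩) (λ e → [ covered 𝒩 e ])))
          (trans (cong (2 *_) (class-sum high 𝒩 (λ e → [ covered 𝒩 e ]))) (sym (sum-* 2 _)))))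
        (≤-trans (≤-reflexive (sym (sum-+₄ _ _ _ _)))
          (≤-trans (sum-mono λ e → cases e (ends-split e)) (≤-reflexive (sum-* 2 _))))
      where
      degrees : over (not ∘ 𝒩) degree ≡
        sum (λ e → [ not (𝒩 (cls (s e))) ] * [ crossing e ]) + sum (λ e → [ not (𝒩 (cls (t e))) ] * [ crossing e ])
      degrees = trans (sum-cong λ i → *-distribˡ-+ [ root i ∧ not (𝒩 i) ] _ _)
        (trans (sum-+ _ _) (cong₂ _+_ (class-sum s (not ∘ 𝒩) (λ e → [ crossing e ])) (class-sum t (not ∘ 𝒩) (λ e → [ crossing e ]))))
      aux : ∀ x y c d → [ not x ] * [ c ] + [ not y ] * [ c ] + [ not y ] * [ (c ∧ d) ∧ x ] + 2 * ([ y ] * [ (c ∧ d) ∧ x ]) ≤ 2 * [ c ]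
      aux = toWitness {a? = ∀B? λ x → ∀B? λ y → ∀B? λ c → ∀B? λ d → _ ≤? _} tt
      aux′ : ∀ x y c d → [ not y ] * [ c ] + [ not x ] * [ c ] + [ not y ] * [ (c ∧ d) ∧ x ] + 2 * ([ y ] * [ (c ∧ d) ∧ x ]) ≤ 2 * [ c ]
      aux′ = toWitness {a? = ∀B? λ x → ∀B? λ y → ∀B? λ c → ∀B? λ d → _ ≤? _} tt
      cases : ∀ e → (low e ≡ s e × high e ≡ t e) ⊎ (low e ≡ t e × high e ≡ s e) →
        [ not (𝒩 (cls (s e))) ] * [ crossing e ] + [ not (𝒩 (cls (t e))) ] * [ crossing e ] +
        [ not (𝒩 (cls (high e))) ] * [ covered 𝒩 e ] + 2 * ([ 𝒩 (cls (high e)) ] * [ covered 𝒩 e ]) ≤ 2 * [ crossing e ]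
      cases e (inj₁ (l , h)) rewrite l | h = aux (𝒩 (cls (s e))) (𝒩 (cls (t e))) (crossing e) (not (touchesS e))
      cases e (inj₂ (l , h)) rewrite l | h = aux′ (𝒩 (cls (t e))) (𝒩 (cls (s e))) (crossing e) (not (touchesS e))

    opaque
      unfolding E

      -- Here the order `τ` matters: the earlier class of a back edge of a class meeting `S` meets
      -- `S` as well, so these edges stay inside the union of such classes.
      frozen-budget : over (λ i → not (𝒩 i) ∧ σ i) (back 𝒩) ≤ E crossing (union σ)
      frozen-budget = ≤-trans (≤-reflexive (class-sum high (λ i → not (𝒩 i) ∧ σ i) (λ e → [ covered 𝒩 e ])))
          (sum-mono λ e → cases e (ends-split e))
        where
        aux : ∀ y x c d z w → ((c ∧ d) ∧ z ≡ true → x ≡ true → w ≡ true) →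
          [ y ∧ x ] * [ (c ∧ d) ∧ z ] ≤ [ c ∧ (w ∧ x) ]
        aux = toWitness {a? = ∀B? λ y → ∀B? λ x → ∀B? λ c → ∀B? λ d → ∀B? λ z → ∀B? λ w →
          (_ ≟B _ →-dec (_ ≟B _ →-dec _ ≟B _)) →-dec _ ≤? _} tt
        aux′ : ∀ y x c d z w → ((c ∧ d) ∧ z ≡ true → x ≡ true → w ≡ true) →
          [ y ∧ x ] * [ (c ∧ d) ∧ z ] ≤ [ c ∧ (x ∧ w) ]
        aux′ = toWitness {a? = ∀B? λ y → ∀B? λ x → ∀B? λ c → ∀B? λ d → ∀B? λ z → ∀B? λ w →
          (_ ≟B _ →-dec (_ ≟B _ →-dec _ ≟B _)) →-dec _ ≤? _} tt
        down : ∀ e → covered 𝒩 e ≡ true → σ (cls (high e)) ≡ true → σ (cls (low e)) ≡ true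
        down e h = τ-σ _ _ (low<high e (crossing-≢ (∧-left (crossing e) (∧-left (open-crossing e) h))))
        cases : ∀ e → (low e ≡ s e × high e ≡ t e) ⊎ (low e ≡ t e × high e ≡ s e) →
          [ not (𝒩 (cls (high e))) ∧ σ (cls (high e)) ] * [ covered 𝒩 e ] ≤ [ crossing e ∧ ins (union σ) e ]
        cases e (inj₁ (l , h)) with down e
        ... | d rewrite l | h =
          aux (not (𝒩 (cls (t e)))) (σ (cls (t e))) (crossing e) (not (touchesS e)) (𝒩 (cls (s e))) (σ (cls (s e))) d
        cases e (inj₂ (l , h)) with down e
        ... | d rewrite l | h =
          aux′ (not (𝒩 (cls (s e)))) (σ (cls (s e))) (crossing e) (not (touchesS e)) (𝒩 (cls (t e))) (σ (cls (t e))) d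

    frozen-total : count S ≡ over all-vertices #frozen
    frozen-total = trans (sum-cong λ v → sym (+-identityʳ _)) (sym (class-sum (λ v → v) all-vertices (λ v → [ S v ])))

    split-classes : #classes all-vertices ≡ #classes (not ∘ 𝒩) + #classes 𝒩
    split-classes = trans (sum-cong λ i → aux (root i) (𝒩 i)) (sum-+ _ _)
      where
      aux : ∀ r x → [ r ∧ true ] ≡ [ r ∧ not x ] + [ r ∧ x ]
      aux = toWitness {a? = ∀B? λ r → ∀B? λ x → _ ≟ _} tt

-- The weighted count

-- The constants of the counting argument, for tree-connectivity m = suc m′ and c = (α + q) / q with
-- c - 1 = α / q and c - 2m = β / q.
module Weights (m′ q′ β : ℕ) where

  -- `A` and `W` are `2m(c - 1)` and `2m` multiplied by `q`. In these terms toughness reads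
  -- `A ω ≤ β |S| + A`, and the size bound reads `2m(α + q) ≤ α d + W |C|`.
  m q α A W : ℕ
  m = suc m′
  q = suc q′
  α = β + q + 2 * m′ * q
  A = 2 * m * α
  W = 2 * m * q

  enlarge : ∀ {x d w} d′ w′ → x ≤ α * d + W * w → d ≤ d′ → w ≡ w′ → x ≤ α * d′ + W * w′
  enlarge {w = w} _ _ h d≤ refl = ≤-trans h (+-monoˡ-≤ (W * w) (*-monoʳ-≤ α d≤))

  too-tough : ∀ N ω s s′ → suc (β * s + A) ≤ A * N → N ≤ ω → s′ ≡ s → A * ω ≤ β * s′ + A → ⊥
  too-tough N ω s _ lower N≤ω refl upper = <⇒≱ lower (≤-trans (*-monoʳ-≤ A N≤ω) upper)

  -- One class, with s vertices in S and t outside; d and k are its numbers of crossing and of back edges.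
  class-balance : ∀ r b g {s t d k} → (g ≡ true → 1 ≤ s) → (b ≡ false → t ≤ k) → k ≤ d →
    (r ≡ true → 2 * m * (α + q) ≤ α * d + W * (s + t)) →
    A * [ r ∧ not b ] + β * ([ r ∧ not b ] * t) + β * ([ r ∧ b ] * k) + W * [ r ∧ g ] ≤
    W * ([ r ∧ true ] * s) + 2 * q * ([ r ∧ (not b ∧ g) ] * k) + α * ([ r ∧ not b ] * d) + α * ([ r ∧ not b ] * k)
      + 2 * α * ([ r ∧ b ] * k)
  class-balance false b g _ _ _ _ = ≤-trans (≤-reflexive zeros) z≤n
    where
    zeros : A * 0 + β * 0 + β * 0 + W * 0 ≡ 0
    zeros = trans (cong₂ _+_ (cong₂ _+_ (cong₂ _+_ (*-zeroʳ A) (*-zeroʳ β)) (*-zeroʳ β)) (*-zeroʳ W)) refl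
  class-balance true true true {s} {t} {d} {k} s≥1 _ _ _ =
    lin ((β + 2 * q + 4 * m′ * q) * k) (mul-mono W (s≥1 refl)) (eq m′ q β s t d k)
    where
    eq : ∀ m′ q β s t d k → let m = suc m′ ; α = β + q + 2 * m′ * q ; A = 2 * m * α ; W = 2 * m * q in
      A * 0 + β * (0 * t) + β * (1 * k) + W * 1 + W * s + (β + 2 * q + 4 * m′ * q) * k ≡
      W * (1 * s) + 2 * q * (0 * k) + α * (0 * d) + α * (0 * k) + 2 * α * (1 * k) + W * 1
    eq = solve-∀
  class-balance true true false {s} {t} {d} {k} _ _ _ _ =
    lin ((β + 2 * q + 4 * m′ * q) * k + W * s) z≤n (eq m′ q β s t d k)
    where
    eq : ∀ m′ q β s t d k → let m = suc m′ ; α = β + q + 2 * m′ * q ; A = 2 * m * α ; W = 2 * m * q in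
      A * 0 + β * (0 * t) + β * (1 * k) + W * 0 + 0 + ((β + 2 * q + 4 * m′ * q) * k + W * s) ≡
      W * (1 * s) + 2 * q * (0 * k) + α * (0 * d) + α * (0 * k) + 2 * α * (1 * k) + 0
    eq = solve-∀
  -- Here `2m(α + q) = A + W` and `β + W = α + q`. The size bound yields `A + W`, and the remaining
  -- `(α + q) t` is paid for by `α k` together with half of `2q k`.
  class-balance true false true {s} {t} {d} {k} _ t≤k _ H₁ =
    lin (q * k) (H₁ refl ⊕ mul-mono (β + W) (t≤k refl)) (eq m′ q β s t d k)
    where
    eq : ∀ m′ q β s t d k → let m = suc m′ ; α = β + q + 2 * m′ * q ; A = 2 * m * α ; W = 2 * m * q in
      A * 1 + β * (1 * t) + β * (0 * k) + W * 1 + (α * d + W * (s + t) + (β + W) * k) + q * k ≡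
      W * (1 * s) + 2 * q * (1 * k) + α * (1 * d) + α * (1 * k) + 2 * α * (0 * k) + (2 * m * (α + q) + (β + W) * t)
    eq = solve-∀
  -- Without the `2q k`, the amount `(α + q) t - W` must fit into `α k`, which works for `t ≤ 2m`.
  -- For larger `t` the size bound is replaced by `A = 2mα ≤ α t ≤ α d`, and `β t ≤ α k`.
  class-balance true false false {s} {t} {d} {k} _ t≤k k≤d H₁ with t ≤? 2 * m
  ... | yes t≤2m = lin 0 (H₁ refl ⊕ mul-mono α (t≤k refl) ⊕ mul-mono q t≤2m) (eq m′ q β s t d k)
    where
    eq : ∀ m′ q β s t d k → let m = suc m′ ; α = β + q + 2 * m′ * q ; A = 2 * m * α ; W = 2 * m * q in
      A * 1 + β * (1 * t) + β * (0 * k) + W * 0 + (α * d + W * (s + t) + (α * k + q * (2 * m))) + 0 ≡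
      W * (1 * s) + 2 * q * (0 * k) + α * (1 * d) + α * (1 * k) + 2 * α * (0 * k) + (2 * m * (α + q) + (α * t + q * t))
    eq = solve-∀
  ... | no t≰2m = lin ((q + 2 * m′ * q) * t + W * s)
          (mul-mono α (≤-trans (≰⇒≥ t≰2m) (≤-trans (t≤k refl) k≤d)) ⊕ mul-mono α (t≤k refl)) (eq m′ q β s t d k)
    where
    eq : ∀ m′ q β s t d k → let m = suc m′ ; α = β + q + 2 * m′ * q ; A = 2 * m * α ; W = 2 * m * q in
      A * 1 + β * (1 * t) + β * (0 * k) + W * 0 + (α * d + α * k) + ((q + 2 * m′ * q) * t + W * s) ≡
      W * (1 * s) + 2 * q * (0 * k) + α * (1 * d) + α * (1 * k) + 2 * α * (0 * k) + (α * (2 * m) + α * t)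
    eq = solve-∀

  -- `M` and `b` count the matching edges at `S` and inside `S`. The multipliers eliminate
  -- everything else: since `β + W = α + q`, what remains is `(α - q)(M - b) + W + α - q` with
  -- `α - q = β + 2m′q`, and this is positive.
  final-balance : ∀ {s′ s a N p e eσ eU gained retained fd cb db M b} →
    e + M + 1 + m ≤ m * (a + N) → b + eU + m ≤ m * p → s ≤ M + b + 1 → b ≤ M → eσ ≤ eU →
    s′ ≤ s + (gained + retained) → fd + cb + 2 * db ≤ 2 * e →
    A * a + β * gained + β * retained + W * p ≤ W * s + 2 * q * eσ + α * fd + α * cb + 2 * α * db →
    suc (β * s′ + A) ≤ A * N
  final-balance {s′} {s} {a} {N} {p} {e} {eσ} {eU} {g} {r} {fd} {cb} {db} {M} {b} h₁ h₂ h₃ h₄ h₅ h₆ h₇ h₈ =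
    lin (β + 2 * m′ * q + 2 * (q′ * m′ + q′ + m′) + 1)
      (mul-mono (2 * α) h₁ ⊕ mul-mono (2 * q) h₂ ⊕ mul-mono (β + W) h₃ ⊕ mul-mono (β + 2 * m′ * q) h₄ ⊕
       mul-mono (2 * q) h₅ ⊕ mul-mono β h₆ ⊕ mul-mono α h₇ ⊕ h₈)
      (eq m′ q′ β s′ s a N p e eσ eU g r fd cb db M b)
    where
    eq : ∀ m′ q′ β s′ s a N p e eσ eU g r fd cb db M b →
      let m = suc m′ ; q = suc q′ ; α = β + q + 2 * m′ * q ; A = 2 * m * α ; W = 2 * m * q in
      suc (β * s′ + A) +
        (2 * α * (m * (a + N)) + (2 * q * (m * p) + ((β + W) * (M + b + 1) + ((β + 2 * m′ * q) * M +
         (2 * q * eU + (β * (s + (g + r)) + (α * (2 * e) + (W * s + 2 * q * eσ + α * fd + α * cb + 2 * α * db))))))))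
        + (β + 2 * m′ * q + 2 * (q′ * m′ + q′ + m′) + 1) ≡
      A * N +
        (2 * α * (e + M + 1 + m) + (2 * q * (b + eU + m) + ((β + W) * s + ((β + 2 * m′ * q) * b +
         (2 * q * eσ + (β * s′ + (α * (fd + cb + 2 * db) + (A * a + β * g + β * r + W * p))))))))
    eq = solve-∀

-- Summing the balance over the classes

sum-linear₄ : ∀ {n} a b c d (f g h k : Fin n → ℕ) →
  sum (λ i → a * f i + b * g i + c * h i + d * k i) ≡ a * sum f + b * sum g + c * sum h + d * sum k
sum-linear₄ a b c d f g h k = trans (sum-+₄ _ _ _ _)
  (cong₂ _+_ (cong₂ _+_ (cong₂ _+_ (sum-* a f) (sum-* b g)) (sum-* c h)) (sum-* d k))

sum-linear₅ : ∀ {n} a b c d x (f g h k l : Fin n → ℕ) →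
  sum (λ i → a * f i + b * g i + c * h i + d * k i + x * l i) ≡
  a * sum f + b * sum g + c * sum h + d * sum k + x * sum l
sum-linear₅ a b c d x f g h k l =
  trans (sum-+ (λ i → a * f i + b * g i + c * h i + d * k i) _) (cong₂ _+_ (sum-linear₄ a b c d f g h k) (sum-* x l))

at-most-one : ∀ {n} (p : Fin n → Bool) → (∀ i j → p i ≡ true → p j ≡ true → i ≡ j) → count p ≤ 1
at-most-one p unique with any? (λ i → p i ≟B true)
... | no none = ≤-trans (≤-reflexive (sum-zero λ i → cong [_] (≢true λ h → none (i , h)))) z≤n
... | yes (i , h) = ≤-trans (count-mono λ j h′ → ≡⇒== (unique i j h h′)) (≤-reflexive (sum-δ₁ i))

module CoverBound (m′ q′ β : ℕ) {n k : ℕ} (s t : Fin k → Fin n) {J : Fin k → Bool}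
                  (C : Partition.Classes s t (suc m′) J) (S : Fin n → Bool) where
  open Edges s t
  open Sparsity s t
  open Packing s t
  open Partition s t
  open Classes C
  open Covering s t C S
  open Weights m′ q′ β

  module _ (H₁ : ∀ i → root i ≡ true → 2 * m * (α + q) ≤ α * degree i + W * count (λ v → cls v == i))
           (𝒩 : Fin n → Bool) (isGreedy : Greedy 𝒩) where
    open Cover 𝒩 isGreedy

    balance : A * #classes (not ∘ 𝒩) + β * gained + β * retained + W * #classes σ ≤
      W * count S + 2 * q * over (λ i → not (𝒩 i) ∧ σ i) (back 𝒩) + α * over (not ∘ 𝒩) degree
        + α * over (not ∘ 𝒩) (back 𝒩) + 2 * α * over 𝒩 (back 𝒩)
    balance = ≤-trans (≤-reflexive (sym (sum-linear₄ A β β W _ _ _ _)))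
      (≤-trans (sum-mono λ i → class-balance (root i) (𝒩 i) (σ i)
          (λ h → ≤-trans (≤-reflexive (cong [_] (sym h))) (σ-count i))
          (λ h → ≮⇒≥ (⌊⌋-false (trans (sym (isGreedy i)) h)))
          (back≤degree i)
          (λ h → subst (λ z → 2 * m * (α + q) ≤ α * degree i + W * z) (class-size i) (H₁ i h)))
        (≤-reflexive (trans (sum-linear₅ W (2 * q) α α (2 * α) _ _ _ _ _)
          (cong (λ z → W * z + 2 * q * over (λ i → not (𝒩 i) ∧ σ i) (back 𝒩) + α * over (not ∘ 𝒩) degree
            + α * over (not ∘ 𝒩) (back 𝒩) + 2 * α * over 𝒩 (back 𝒩)) (sym frozen-total)))))

    -- `partition` turns edge counts of `J` into counts of crossing edges against classes, once for
    -- the whole graph and once for the classes meeting `S`.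
    cover-bound : ∀ {M b} → E J all-vertices + M + 1 + m ≤ m * count {n} all-vertices →
      E J (union σ) + b + m ≤ m * count (union σ) → count S ≤ M + b + 1 → b ≤ M →
      suc (β * count S′ + A) ≤ A * #classes 𝒩
    cover-bound {M} {b} h₁ h₂ h₃ h₄ = final-balance
      (whole (E J all-vertices) (E crossing all-vertices) M (count {n} all-vertices) (#classes all-vertices)
        (#classes (not ∘ 𝒩)) (#classes 𝒩) (partition all-vertices) h₁ split-classes)
      (part′ (E J (union σ)) (E crossing (union σ)) b (count (union σ)) (#classes σ) (partition σ) h₂)
      h₃ h₄ frozen-budget S′-size
      (≤-trans crossing-budget (≤-reflexive (cong (2 *_) crossing-total))) balance
      where
      crossing-total : count crossing ≡ E crossing all-vertices
      crossing-total = trans (sum-cong λ e → aux (crossing e)) (sym (E-def crossing all-vertices))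
        where
        aux : ∀ x → [ x ] ≡ [ x ∧ true ]
        aux true  = refl
        aux false = refl
      whole : ∀ j e M v P a N → j + m * P ≡ m * v + e → j + M + 1 + m ≤ m * v → P ≡ a + N → e + M + 1 + m ≤ m * (a + N)
      whole j e M v _ a N h h′ refl = lin 0 (≤-reflexive (sym h) ⊕ h′) (eq m j e M v (a + N))
        where
        eq : ∀ m j e M v P → e + M + 1 + m + (j + m * P + m * v) + 0 ≡ m * P + (m * v + e + (j + M + 1 + m))
        eq = solve-∀
      part′ : ∀ j e b v p → j + m * p ≡ m * v + e → j + b + m ≤ m * v → b + e + m ≤ m * p
      part′ j e b v p h h′ = lin 0 (≤-reflexive (sym h) ⊕ h′) (eq m j e b v p)
        where
        eq : ∀ m j e b v p → b + e + m + (j + m * p + m * v) + 0 ≡ m * p + (m * v + e + (j + b + m))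
        eq = solve-∀

module Deficient {n k : ℕ} (s t : Fin k → Fin n) (m′ : ℕ) (F B : Fin k → Bool) (u : Fin n)
                 (B⊆F : ∀ e → B e ≡ true → F e ≡ true) where
  open Edges s t
  open Sparsity s t
  open Packing s t
  open Partition s t
  open LocalSearch s t (suc m′) F B u B⊆F

  module _ (M : ESet) (feasible : Feasible M) (S : VSet) (u∈S : S u ≡ true)
           (saturated : ∀ v → S v ≡ true → v ≢ u → ∃ λ e → M e ≡ true × Inc v e) where
    open Feasible feasible

    MS bS : ℕ
    MS = count λ e → M e ∧ touches S e
    bS = count λ e → M e ∧ ins S e

    bS≤MS : bS ≤ MS
    bS≤MS = sum-mono λ e → aux (M e) (S (s e)) (S (t e))
      where
      aux : ∀ x a b → [ x ∧ (a ∧ b) ] ≤ [ x ∧ (a ∨ b) ]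
      aux = toWitness {a? = ∀B? λ x → ∀B? λ a → ∀B? λ b → _ ≤? _} tt

    disjoint : ∀ e → M e ≡ true → B e ≡ false
    disjoint e h = ≢true λ b → true≢false (B⊆F e b) (new e h)

    -- Every vertex of `S` except `u` is an end of an edge of `M`, and an edge inside `S` supplies
    -- two such ends; the `+ 1` stands for `u`.
    frozen-degree : count S ≤ MS + bS + 1
    frozen-degree = ≤-trans (sum-mono₁₂ pointwise)
        (≤-trans (≤-reflexive (cong₂ _+_ degrees (sum-δ₁ u))) (+-monoˡ-≤ 1 (≤-reflexive double)))
      where
      incident : Fin n → ℕ
      incident v = sum (λ e → [ s e == v ] * [ M e ]) + sum (λ e → [ t e == v ] * [ M e ])
      pointwise : ∀ v → [ S v ] ≤ [ S v ] * incident v + [ u == v ]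
      pointwise v = cases (S v) refl (u Fin.≟ v)
        where
        cases : ∀ b → S v ≡ b → Dec (u ≡ v) → [ b ] ≤ [ b ] * incident v + [ u == v ]
        cases false _ _ = z≤n
        cases true _ (yes p) = ≤-trans (≤-reflexive (cong [_] (sym (≡⇒== p)))) (m≤n+m _ (1 * incident v))
        cases true h (no u≢v) with saturated v h (u≢v ∘ sym)
        ... | e , e∈M , inj₁ p = ≤-trans (≤-trans (sum-≥1 _ e (≤-reflexive (sym (one (≡⇒== p) e∈M))))
              (≤-trans (m≤m+n _ _) (≤-reflexive (sym (*-identityˡ (incident v)))))) (m≤m+n _ _)
          where
          one : ∀ {a b} → a ≡ true → b ≡ true → [ a ] * [ b ] ≡ 1
          one refl refl = refl
        ... | e , e∈M , inj₂ p = ≤-trans (≤-trans (sum-≥1 _ e (≤-reflexive (sym (one (≡⇒== p) e∈M))))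
              (≤-trans (m≤n+m _ _) (≤-reflexive (sym (*-identityˡ (incident v)))))) (m≤m+n _ _)
          where
          one : ∀ {a b} → a ≡ true → b ≡ true → [ a ] * [ b ] ≡ 1
          one refl refl = refl
      degrees : sum (λ v → [ S v ] * incident v) ≡ sum (λ e → [ S (s e) ] * [ M e ]) + sum (λ e → [ S (t e) ] * [ M e ])
      degrees = trans (sum-cong λ v → *-distribˡ-+ [ S v ] _ _) (trans (sum-+ _ _)
        (cong₂ _+_ (fibre-sum s (λ v → [ S v ]) (λ e → [ M e ])) (fibre-sum t (λ v → [ S v ]) (λ e → [ M e ]))))
      double : sum (λ e → [ S (s e) ] * [ M e ]) + sum (λ e → [ S (t e) ] * [ M e ]) ≡ MS + bS
      double = sum-cong₂₂ λ e → aux (M e) (S (s e)) (S (t e))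
        where
        aux : ∀ x a b → [ a ] * [ x ] + [ b ] * [ x ] ≡ [ x ∧ (a ∨ b) ] + [ x ∧ (a ∧ b) ]
        aux = toWitness {a? = ∀B? λ x → ∀B? λ a → ∀B? λ b → _ ≟ _} tt

    opaque
      unfolding E

      whole-bound : E (restrict S M) all-vertices + MS ≤ E (with-base M) all-vertices
      whole-bound = sum-mono₂₁ λ e → aux (B e) (M e) (touches S e) (disjoint e)
        where
        aux : ∀ b x c → (x ≡ true → b ≡ false) → [ (b ∨ (x ∧ not c)) ∧ true ] + [ x ∧ c ] ≤ [ (b ∨ x) ∧ true ]
        aux = toWitness {a? = ∀B? λ b → ∀B? λ x → ∀B? λ c → (_ ≟B _ →-dec _ ≟B _) →-dec _ ≤? _} tt

      inner-bound : ∀ U → (∀ v → S v ≡ true → U v ≡ true) → E (restrict S M) U + bS ≤ E (with-base M) U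
      inner-bound U S⊆U = sum-mono₂₁ λ e →
        aux (B e) (M e) (S (s e)) (S (t e)) (U (s e)) (U (t e)) (disjoint e) (S⊆U (s e)) (S⊆U (t e))
        where
        aux : ∀ b x p q y z → (x ≡ true → b ≡ false) → (p ≡ true → y ≡ true) → (q ≡ true → z ≡ true) →
          [ (b ∨ (x ∧ not (p ∨ q))) ∧ (y ∧ z) ] + [ x ∧ (p ∧ q) ] ≤ [ (b ∨ x) ∧ (y ∧ z) ]
        aux = toWitness {a? = ∀B? λ b → ∀B? λ x → ∀B? λ p → ∀B? λ q → ∀B? λ y → ∀B? λ z →
          (_ ≟B _ →-dec _ ≟B _) →-dec (_ ≟B _ →-dec _ ≟B _) →-dec (_ ≟B _ →-dec _ ≟B _) →-dec _ ≤? _} tt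

    module _ (q′ β : ℕ) (C : Classes (suc m′) (restrict S M)) where
      open Classes C using (cls; root; #classes; union)
      open Covering s t C S
      open Weights m′ q′ β

      deficient-bound : (∀ i → root i ≡ true → 2 * m * (α + q) ≤ α * degree i + W * count (λ v → cls v == i)) →
        E (with-base M) all-vertices + 1 + m ≤ m * count {n} all-vertices →
        (𝒩 : Fin n → Bool) (isGreedy : Greedy 𝒩) →
        suc (β * count (Cover.S′ 𝒩 isGreedy) + A) ≤ A * #classes 𝒩
      deficient-bound H₁ deficit 𝒩 isGreedy = CoverBound.cover-bound m′ q′ β s t C S H₁ 𝒩 isGreedy
        (≤-trans (+-monoˡ-≤ m (+-monoˡ-≤ 1 whole-bound)) deficit)
        (≤-trans (+-monoˡ-≤ m (inner-bound (union σ) S⊆)) (sparse (union σ) u (S⊆ u u∈S)))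
        frozen-degree bS≤MS
        where
        S⊆ : ∀ v → S v ≡ true → union σ v ≡ true
        S⊆ v h = true-⌊⌋ (v , true-∧ (==-refl (cls v)) h)

-- Labelling and counting connected components

≡-irrelevant-Bool : ∀ {x y : Bool} (p q : x ≡ y) → p ≡ q
≡-irrelevant-Bool = Decidable⇒UIP.≡-irrelevant Data.Bool._≟_

record Enumeration {n} (p : Fin n → Bool) : Set where
  field
    size       : ℕ
    index      : ∀ i → p i ≡ true → Fin size
    surjective : ∀ x → ∃ λ i → Σ (p i ≡ true) λ h → index i h ≡ x
    injective  : ∀ i j h h′ → index i h ≡ index j h′ → i ≡ j

enumerate : ∀ {n} (p : Fin n → Bool) → Enumeration p
enumerate {zero} p = record { size = 0 ; index = λ () ; surjective = λ () ; injective = λ () }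
enumerate {suc n} p = extend (p zero) refl (enumerate (p ∘ suc))
  where
  extend : ∀ b → p zero ≡ b → Enumeration (p ∘ suc) → Enumeration p
  extend true p₀ en = record { size = suc size ; index = index′ ; surjective = surjective′ ; injective = injective′ }
    where
    open Enumeration en
    index′ : ∀ i → p i ≡ true → Fin (suc size)
    index′ zero    _ = zero
    index′ (suc i) h = suc (index i h)
    surjective′ : ∀ x → ∃ λ i → Σ (p i ≡ true) λ h → index′ i h ≡ x
    surjective′ zero = zero , p₀ , refl
    surjective′ (suc x) with surjective x
    ... | i , h , eq = suc i , h , cong suc eq
    injective′ : ∀ i j h h′ → index′ i h ≡ index′ j h′ → i ≡ j
    injective′ zero    zero    h h′ _  = refl
    injective′ (suc i) (suc j) h h′ eq = cong suc (injective i j h h′ (Fin-suc-injective eq))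
  extend false p₀ en = record { size = size ; index = index′ ; surjective = surjective′ ; injective = injective′ }
    where
    open Enumeration en
    index′ : ∀ i → p i ≡ true → Fin size
    index′ zero    h = ⊥-elim (true≢false h p₀)
    index′ (suc i) h = index i h
    surjective′ : ∀ x → ∃ λ i → Σ (p i ≡ true) λ h → index′ i h ≡ x
    surjective′ x with surjective x
    ... | i , h , eq = suc i , h , eq
    injective′ : ∀ i j h h′ → index′ i h ≡ index′ j h′ → i ≡ j
    injective′ zero    _       h h′ _  = ⊥-elim (true≢false h p₀)
    injective′ (suc i) zero    h h′ _  = ⊥-elim (true≢false h′ p₀)
    injective′ (suc i) (suc j) h h′ eq = cong suc (injective i j h h′ eq)

count-≤-injective : ∀ {n j} (p : Fin n → Bool) (g : ∀ i → p i ≡ true → Fin j) →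
  (∀ i i′ h h′ → g i h ≡ g i′ h′ → i ≡ i′) → count p ≤ j
count-≤-injective {n} {j} p g inj = ≤-trans (sum-mono λ i → row i (p i) refl)
  (≤-trans (≤-reflexive (sum-swap _)) (≤-trans (sum-mono λ x → at-most-one (λ i → hit i x (p i) refl) (unique x))
    (≤-reflexive (trans (sum-const j 1) (*-identityʳ j)))))
  where
  hit : ∀ i → Fin j → ∀ b → p i ≡ b → Bool
  hit i x true  h = g i h == x
  hit i x false h = false
  row : ∀ i b (h : p i ≡ b) → [ b ] ≤ sum λ x → [ hit i x b h ]
  row i true  h = ≤-reflexive (sym (sum-δ₁ (g i h)))
  row i false h = z≤n
  elim : ∀ i x b (h : p i ≡ b) → hit i x b h ≡ true → Σ (p i ≡ true) λ h′ → g i h′ ≡ x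
  elim i x true h e = h , ==⇒≡ e
  unique : ∀ x i i′ → hit i x (p i) refl ≡ true → hit i′ x (p i′) refl ≡ true → i ≡ i′
  unique x i i′ e e′ with elim i x (p i) refl e | elim i′ x (p i′) refl e′
  ... | h , q | h′ , q′ = inj i i′ h h′ (trans q (sym q′))

module Connectivity (G : Graph) where
  open Graph G
  open Multigraph G

  avoid-elim : ∀ (S : Subset n) e → e ∈ avoid G S → lookup S (s e) ≡ false × lookup S (t e) ≡ false
  avoid-elim S e h = not-true (∧-left (not (lookup S (s e))) (∈-tabulate⁻ h)) ,
    not-true (∧-right (not (lookup S (s e))) (∈-tabulate⁻ h))

  ∉⇒false : ∀ {S : Subset n} {v} → v ∉ S → lookup S v ≡ false
  ∉⇒false h = ≢true (h ∘ true⇒∈)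

  false⇒∉ : ∀ {S : Subset n} {v} → lookup S v ≡ false → v ∉ S
  false⇒∉ h v∈S = true≢false (∈⇒true v∈S) h

  -- The toughness hypothesis applies only once some labelling is exhibited; here a component is
  -- labelled by the position of its least vertex in an enumeration of all these least vertices.
  numComponents : ∀ S → Σ ℕ (NumComponents G S)
  numComponents S = size , label , surj , λ u v p q → same⇒ u v p q , same⇐ u v p q
    where
    X : Subset k
    X = avoid G S
    module C v = Component (reach-component X v)
    closed : ∀ v e → e ∈ X → C.R v (s e) ≡ C.R v (t e)
    closed v e h = C.closed v e (∈⇒true h)
    reach⇒R : ∀ {u v} → Reach G X u v → C.R u v ≡ true
    reach⇒R {u} p = trans (sym (reach-closed (C.R u) (closed u) p)) (C.root u)
    sameR : ∀ {u v} → Reach G X u v → ∀ w → C.R u w ≡ C.R v w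
    sameR {u} {v} p w = bool-ext
      (λ h → trans (sym (reach-closed (C.R v) (closed v) (C.reached u w h)))
        (trans (reach-closed (C.R v) (closed v) p) (C.root v)))
      (λ h → trans (sym (reach-closed (C.R u) (closed u) (C.reached v w h))) (reach⇒R p))
    rep : Fin n → Fin n
    rep v = first (C.R v) v
    rep-reach : ∀ v → Reach G X v (rep v)
    rep-reach v = C.reached v (rep v) (first-∈ (C.R v) v (C.root v))
    rep-cong : ∀ {u v} → Reach G X u v → rep u ≡ rep v
    rep-cong {u} {v} p = first-unique _ _ (sameR p) u v (C.root u) (C.root v)
    isRep : Fin n → Bool
    isRep i = not (lookup S i) ∧ rep i == i
    open Enumeration (enumerate isRep)
    rep-isRep : ∀ v → v ∉ S → isRep (rep v) ≡ true
    rep-isRep v v∉S = true-∧ (trans (sym (reach-closed (λ w → not (lookup S w)) (λ e h →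
        trans (cong not (proj₁ (avoid-elim S e h))) (cong not (sym (proj₂ (avoid-elim S e h))))) (rep-reach v)))
          (cong not (∉⇒false v∉S)))
      (≡⇒== (sym (rep-cong (rep-reach v))))
    label : (v : Fin n) → v ∉ S → Fin size
    label v v∉S = index (rep v) (rep-isRep v v∉S)
    index-cong : ∀ {i j} (h : isRep i ≡ true) (h′ : isRep j ≡ true) → i ≡ j → index i h ≡ index j h′
    index-cong h h′ refl = cong (index _) (≡-irrelevant-Bool h h′)
    surj : ∀ i → ∃ λ v → Σ (v ∉ S) λ p → label v p ≡ i
    surj x with surjective x
    ... | i , h , eq = i , false⇒∉ (not-true (∧-left (not (lookup S i)) h)) ,
            trans (index-cong _ h (==⇒≡ (∧-right (not (lookup S i)) h))) eq
    same⇒ : ∀ u v p q → label u p ≡ label v q → Reach G X u v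
    same⇒ u v p q eq = C.reached u v (trans (reach-closed (C.R u) (closed u) (rep-reach v))
        (trans (cong (C.R u) (sym (injective _ _ _ _ eq))) (reach⇒R (rep-reach u))))

    same⇐ : ∀ u v p q → Reach G X u v → label u p ≡ label v q
    same⇐ u v p q r = index-cong _ _ (rep-cong r)

  -- `cls` is constant on each component, so the witnesses of different marked classes lie in
  -- different components.
  components≥ : ∀ {S ω} → NumComponents G S ω → (cls : Fin n → Fin n) (p : Fin n → Bool) →
    (∀ e → lookup S (s e) ≡ false → lookup S (t e) ≡ false → cls (s e) ≡ cls (t e)) →
    (∀ i → p i ≡ true → ∃ λ v → cls v ≡ i × lookup S v ≡ false) → count p ≤ ω
  components≥ {S} (f , _ , iff) cls p constant witness = count-≤-injective p g inj
    where
    g : ∀ i → p i ≡ true → Fin _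
    g i h = f (proj₁ (witness i h)) (false⇒∉ (proj₂ (proj₂ (witness i h))))
    along : ∀ {u v} → Reach G (avoid G S) u v → cls u ≡ cls v
    along here = refl
    along (step e e∈ (inj₁ refl) r) = trans (constant e (proj₁ (avoid-elim S e e∈)) (proj₂ (avoid-elim S e e∈))) (along r)
    along (step e e∈ (inj₂ refl) r) = trans (sym (constant e (proj₁ (avoid-elim S e e∈)) (proj₂ (avoid-elim S e e∈)))) (along r)
    inj : ∀ i i′ h h′ → g i h ≡ g i′ h′ → i ≡ i′
    inj i i′ h h′ eq = trans (sym (proj₁ (proj₂ (witness i h))))
      (trans (along (proj₁ (iff _ _ _ _) eq)) (proj₁ (proj₂ (witness i′ h′))))

-- The tree-connected components as classes of a base

module Bases (G : Graph) (m′ : ℕ) (F : Subset (Graph.k G)) where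
  open Graph G
  open Multigraph G
  open Partition s t

  m₀ : ℕ
  m₀ = suc m′

  module _ (B : ESet) (B⊆F : ∀ e → B e ≡ true → lookup F e ≡ true) (CB : Classes m₀ B)
           (maximalB : ∀ e → lookup F e ≡ true → B e ≡ false → ¬ Sparse m₀ (insert B e)) where
    open Classes CB

    -- By maximality of `B`, an edge of `F` outside `B` has both ends in a tight set of `B`, hence
    -- in one class. So `F` and `B` have the same edges between classes.
    F-crossing : ∀ e → lookup F e ≡ true → cls (s e) ≢ cls (t e) → B e ≡ true
    F-crossing e e∈F ≢ with bool-cases (B e)
    ... | inj₁ h = h
    ... | inj₂ h = ⊥-elim (maximalB e e∈F h (insert-sparse sparse λ W tW e∈W →
            ≢ (max tW (ins-s W {e} e∈W) (ins-t W {e} e∈W))))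

    class : Fin n → Subset n
    class i = tabulate λ v → cls v == i

    -- With the classes contracted, each of the `m` trees of `W′` needs at least one edge fewer than
    -- the number of classes met. These edges are distinct and belong to `B`, so the union of the
    -- classes meeting `W′` is tight and lies in a single class.
    class-maximal : ∀ i → root i ≡ true → ∀ W′ → class i ⊆ W′ → TreeConnected G m₀ F W′ → W′ ≡ class i
    class-maximal i rooti W′ ⊆W′ (T , spanning , disjoint) = ⊆-antisym W′⊆ ⊆W′
      where
      i∈W′ : i ∈ W′
      i∈W′ = ⊆W′ (∈-tabulate⁺ rooti)

      U : Fin n → Bool
      U l = ⌊ any? (λ v → lookup W′ v ∧ cls v == l ≟B true) ⌋

      U-intro : ∀ v → v ∈ W′ → U (cls v) ≡ true
      U-intro v h = true-⌊⌋ (v , true-∧ (∈⇒true h) (==-refl (cls v)))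

      X : Fin m₀ → ESet
      X j e = lookup (T j) e ∧ not (cls (s e) == cls (t e))

      T⊆ : ∀ j e → lookup (T j) e ≡ true → lookup F e ≡ true × s e ∈ W′ × t e ∈ W′
      T⊆ j e h with x∈p∩q⁻ F (inside G W′) (proj₁ (spanning j) (true⇒∈ h))
      ... | e∈F , e∈W = ∈⇒true e∈F , true⇒∈ (∧-left (lookup W′ (s e)) (∈-tabulate⁻ e∈W)) ,
              true⇒∈ (∧-right (lookup W′ (s e)) (∈-tabulate⁻ e∈W))

      -- Contracting the classes, the j-th tree still connects all classes meeting W′.
      enough : ∀ j → #classes U ≤ count (X j) + 1
      enough j = ≤-trans (count-mono λ l h → U⊆R l (∧-right (root l) h))
          (≤-trans edges (+-monoˡ-≤ 1 (≤-trans (≤-reflexive (Edges.E-def (cls ∘ s) (cls ∘ t) (X j) R))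
            (sum-mono λ e → aux (X j e) (Edges.ins (cls ∘ s) (cls ∘ t) R e)))))
        where
        aux : ∀ x y → [ x ∧ y ] ≤ [ x ]
        aux = toWitness {a? = ∀B? λ x → ∀B? λ y → _ ≤? _} tt
        open Sparsity.Component (Sparsity.component (cls ∘ s) (cls ∘ t) (X j) i (λ _ → Unit) tt
          (λ _ _ _ → tt) (λ _ _ _ → tt)) renaming (root to root∈R)
        constant : ∀ e → e ∈ T j → R (cls (s e)) ≡ R (cls (t e))
        constant e h with bool-cases (cls (s e) == cls (t e))
        ... | inj₁ p = cong R (==⇒≡ p)
        ... | inj₂ p = closed e (true-∧ (∈⇒true h) (cong not p))
        U⊆R : ∀ l → U l ≡ true → R l ≡ true
        U⊆R l h with ⌊⌋-true {d = any? (λ v → lookup W′ v ∧ cls v == l ≟B true)} h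
        ... | v , p = subst (λ z → R z ≡ true) (==⇒≡ (∧-right (lookup W′ v) p))
          (trans (sym (reach-closed (R ∘ cls) constant
            (proj₁ (proj₂ (spanning j)) i v i∈W′ (true⇒∈ (∧-left (lookup W′ v) p)))))
            (trans (cong R (==⇒≡ rooti)) root∈R))

      opaque
        unfolding E

        used : sum (λ j → count (X j)) ≤ E crossing (union U)
        used = ≤-trans (≤-reflexive (sum-swap _)) (sum-mono λ e → cases e (bool-cases (crossing e ∧ ins (union U) e)))
          where
          X⊆ : ∀ j e → X j e ≡ true → crossing e ∧ ins (union U) e ≡ true
          X⊆ j e h with T⊆ j e (∧-left (lookup (T j) e) h)
          ... | e∈F , s∈ , t∈ = true-∧ (true-∧ (F-crossing e e∈F (==⇒≢ (not-true ≢))) ≢) (true-∧ (U-intro _ s∈) (U-intro _ t∈))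
            where
            ≢ : not (cls (s e) == cls (t e)) ≡ true
            ≢ = ∧-right (lookup (T j) e) h
          cases : ∀ e → crossing e ∧ ins (union U) e ≡ true ⊎ crossing e ∧ ins (union U) e ≡ false →
            count (λ j → X j e) ≤ [ crossing e ∧ ins (union U) e ]
          cases e (inj₁ p) = ≤-trans (at-most-one (λ j → X j e) λ i j h h′ → unique i j h h′) (≤-reflexive (cong [_] (sym p)))
            where
            unique : ∀ i j → X i e ≡ true → X j e ≡ true → i ≡ j
            unique i j h h′ with i Fin.≟ j
            ... | yes q = q
            ... | no ¬q = ⊥-elim (disjoint i j ¬q e (true⇒∈ (∧-left (lookup (T i) e) h)) (true⇒∈ (∧-left (lookup (T j) e) h′)))
          cases e (inj₂ p) = ≤-trans (≤-reflexive (sum-zero λ j → cong [_] (≢true λ h → true≢false (X⊆ j e h) p))) z≤n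

      tightU : Tight m₀ B (union U)
      tightU = combine (≤-trans (≤-reflexive (sym (sum-const m₀ (#classes U)))) (≤-trans (sum-mono enough)
            (≤-reflexive (trans (sum-+ (λ j → count (X j)) (λ _ → 1)) (cong (sum (λ j → count (X j)) +_)
              (trans (sum-const m₀ 1) (*-identityʳ m₀)))))))
          used (partition U)
        where
        combine : ∀ {p x e v b} → m₀ * p ≤ x + m₀ → x ≤ e → b + m₀ * p ≡ m₀ * v + e → m₀ * v ≤ b + m₀
        combine {p} {x} {e} {v} {b} h₁ h₂ h₃ = lin 0 (h₁ ⊕ h₂ ⊕ ≤-reflexive (sym h₃)) (eq m₀ p x e v b)
          where
          eq : ∀ m p x e v b → m * v + (x + m + (e + (b + m * p))) + 0 ≡ b + m + (m * p + (x + (m * v + e)))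
          eq = solve-∀

      W′⊆ : W′ ⊆ class i
      W′⊆ {v} v∈ = ∈-tabulate⁺ (≡⇒== (trans (max tightU (U-intro v v∈) (U-intro i i∈W′)) (==⇒≡ rooti)))

    class-component : ∀ i → root i ≡ true → (TreeComponent G m₀ F (class i) → ⊥) → ⊥
    class-component i rooti k₀ = arboricity B sparse λ col forests → k₀
      ((i , ∈-tabulate⁺ rooti) ,
       treeConnected F forests sparse (subst (λ z → Tight m₀ B (λ v → cls v == z)) (==⇒≡ rooti) (tight i)) rooti
         (λ e h → true⇒∈ (B⊆F e h)) ,
       class-maximal i rooti)

    class-degree : Fin n → ℕ
    class-degree i = sum (λ e → [ cls (s e) == i ] * [ crossing e ]) + sum (λ e → [ cls (t e) == i ] * [ crossing e ])

    boundary≤degree : ∀ i → boundary G F (class i) ≤ class-degree i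
    boundary≤degree i = ≤-trans (≤-reflexive (trans (∣∣≡count (F ∩ˢ tabulate (λ e → lookup (class i) (s e) xor lookup (class i) (t e)))) (sum-cong λ e → cong [_] (lookup-boundary e))))
        (sum-mono₁₂ λ e → aux (lookup F e) (cls (s e) == i) (cls (t e) == i) (crossing e) (crossed e))
      where
      lookup-boundary : ∀ e → lookup (F ∩ˢ tabulate (λ e → lookup (class i) (s e) xor lookup (class i) (t e))) e ≡
        lookup F e ∧ ((cls (s e) == i) xor (cls (t e) == i))
      lookup-boundary e = trans (lookup-zipWith _∧_ e F _) (cong (lookup F e ∧_) (trans (lookup∘tabulate _ e)
        (cong₂ _xor_ (lookup∘tabulate _ (s e)) (lookup∘tabulate _ (t e)))))
      crossed : ∀ e → lookup F e ≡ true → (cls (s e) == i) xor (cls (t e) == i) ≡ true → crossing e ≡ true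
      crossed e e∈F h = true-∧ (F-crossing e e∈F ≢) (cong not (≢⇒== ≢))
        where
        ≢ : cls (s e) ≢ cls (t e)
        ≢ p = xor-true (cls (s e) == i) (cls (t e) == i) h (cong (_== i) p)
      aux : ∀ f a b c → (f ≡ true → a xor b ≡ true → c ≡ true) → [ f ∧ (a xor b) ] ≤ [ a ] * [ c ] + [ b ] * [ c ]
      aux = toWitness {a? = ∀B? λ f → ∀B? λ a → ∀B? λ b → ∀B? λ c →
        (_ ≟B _ →-dec (_ ≟B _ →-dec _ ≟B _)) →-dec _ ≤? _} tt

    -- A class of J is a union of classes of B, and sparsity bounds the number of edges between those.
    module _ {J : ESet} (CJ : Classes m₀ J) (B⊆J : ∀ e → B e ≡ true → J e ≡ true) (α q : ℕ)
             (small : ∀ i → root i ≡ true → 2 * m₀ * (α + q) ≤ α * class-degree i + 2 * m₀ * q * count (λ v → cls v == i)) where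
      private
        module J = Classes CJ

      coarser : ∀ v → J.cls (cls v) ≡ J.cls v
      coarser v = J.max (tight-⊆ (λ e _ → B⊆J e) (tight v)) (≡⇒== (idem v)) (==-refl (cls v))

      degreeJ : Fin n → ℕ
      degreeJ i = sum (λ e → [ J.cls (s e) == i ] * [ J.crossing e ]) + sum (λ e → [ J.cls (t e) == i ] * [ J.crossing e ])

      coarse-bound : ∀ i → J.root i ≡ true →
        2 * m₀ * (α + q) ≤ α * degreeJ i + 2 * m₀ * q * count (λ v → J.cls v == i)
      -- The bounds of the `K` parts add up to `2m(α + q)K`. The `e′` edges between the parts count
      -- twice in the degrees and cost `2α e′`, at most `2αm(K - 1)`; the remaining `2mα + 2mqK`
      -- suffices because `K` is at least 1.
      coarse-bound i rooti = combine weighted inner degrees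
        where
        U : Fin n → Bool
        U l = J.cls l == i

        A : VSet
        A v = J.cls v == i

        union-A : ∀ v → union U v ≡ A v
        union-A v = cong (_== i) (coarser v)

        K D e′ : ℕ
        K  = #classes U
        D  = sum λ l → [ root l ∧ U l ] * class-degree l
        e′ = E crossing (union U)

        weighted : 2 * m₀ * (α + q) * K ≤ α * D + 2 * m₀ * q * count A
        weighted = ≤-trans (≤-reflexive (sym (sum-* (2 * m₀ * (α + q)) _)))
          (≤-trans (sum-mono λ l → pointwise l (root l) refl)
            (≤-reflexive (trans (sum-+ _ _) (cong₂ _+_ (sum-* α _) (trans (sum-* (2 * m₀ * q) _) (cong (2 * m₀ * q *_) sizes))))))
          where
          sizes : sum (λ l → [ root l ∧ U l ] * count (λ v → cls v == l)) ≡ count A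
          sizes = trans (sum-cong λ l → cong ([ root l ∧ U l ] *_) (sum-cong λ v → sym (*-identityʳ _)))
            (trans (class-sum (λ v → v) U (λ _ → 1)) (sum-cong λ v → trans (*-identityʳ _) (cong [_] (union-A v))))
          pointwise : ∀ l b → root l ≡ b → 2 * m₀ * (α + q) * [ b ∧ U l ] ≤
            α * ([ b ∧ U l ] * class-degree l) + 2 * m₀ * q * ([ b ∧ U l ] * count (λ v → cls v == l))
          pointwise l false h = ≤-trans (≤-reflexive (*-zeroʳ (2 * m₀ * (α + q)))) z≤n
          pointwise l true  h with U l
          ... | false = ≤-trans (≤-reflexive (*-zeroʳ (2 * m₀ * (α + q)))) z≤n
          ... | true  = ≤-trans (≤-reflexive (*-identityʳ _)) (≤-trans (small l h)
                (≤-reflexive (cong₂ (λ x y → α * x + 2 * m₀ * q * y) (sym (*-identityˡ _)) (sym (*-identityˡ _)))))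

        inner : e′ + m₀ ≤ m₀ * K
        inner = lin 0 (sparse (union U) i (trans (union-A i) rooti) ⊕ ≤-reflexive (sym (partition U)))
            (eq m₀ e′ K (E B (union U)) (count (union U)))
          where
          eq : ∀ m e K b v → e + m + (m * v + (b + m * K)) + 0 ≡ m * K + (b + m + (m * v + e))
          eq = solve-∀

        degrees : D ≤ degreeJ i + 2 * e′
        degrees = ≤-trans (≤-reflexive (trans (sum-cong λ l → *-distribˡ-+ [ root l ∧ U l ] _ _)
              (trans (sum-+ _ _) (trans (cong₂ _+_ (class-sum s U (λ e → [ crossing e ])) (class-sum t U (λ e → [ crossing e ])))
                (sym (sum-+ _ _))))))
            (≤-trans (sum-mono pointwise) (≤-reflexive (trans (sum-+₃ _ _ _)
              (cong (degreeJ i +_) (trans (sum-* 2 _) (cong (2 *_) (sym (E-def crossing (union U)))))))))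
          where
          aux : ∀ a b c j → (c ≡ true → a xor b ≡ true → j ≡ true) →
            [ a ] * [ c ] + [ b ] * [ c ] ≤ [ a ] * [ j ] + [ b ] * [ j ] + 2 * [ c ∧ (a ∧ b) ]
          aux = toWitness {a? = ∀B? λ a → ∀B? λ b → ∀B? λ c → ∀B? λ j →
            (_ ≟B _ →-dec (_ ≟B _ →-dec _ ≟B _)) →-dec _ ≤? _} tt
          pointwise : ∀ e → [ union U (s e) ] * [ crossing e ] + [ union U (t e) ] * [ crossing e ] ≤
            [ J.cls (s e) == i ] * [ J.crossing e ] + [ J.cls (t e) == i ] * [ J.crossing e ] + 2 * [ crossing e ∧ ins (union U) e ]
          pointwise e rewrite union-A (s e) | union-A (t e) = aux (A (s e)) (A (t e)) (crossing e) (J.crossing e)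
            λ h x → true-∧ (B⊆J e (∧-left (B e) h)) (cong not (≢⇒== λ p → xor-true (A (s e)) (A (t e)) x (cong (_== i) p)))

        combine : ∀ {a dJ} → 2 * m₀ * (α + q) * K ≤ α * D + 2 * m₀ * q * a → e′ + m₀ ≤ m₀ * K → D ≤ dJ + 2 * e′ →
          2 * m₀ * (α + q) ≤ α * dJ + 2 * m₀ * q * a
        combine {a} {dJ} h₁ h₂ h₃ = lin 0
          (h₁ ⊕ mul-mono (2 * α) h₂ ⊕ mul-mono (2 * q) (≤-trans (m≤n+m m₀ e′) h₂) ⊕ mul-mono α h₃) (eq m₀ α q K D e′ a dJ)
          where
          eq : ∀ m α q K D e a d → 2 * m * (α + q) + (α * D + 2 * m * q * a + (2 * α * (m * K) + (2 * q * (m * K) + α * (d + 2 * e)))) + 0 ≡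
            α * d + 2 * m * q * a + (2 * m * (α + q) * K + (2 * α * (e + m) + (2 * q * m + α * D)))
          eq = solve-∀

-- Clearing denominators

module Rationals where
  toℚ-mkℚ : ∀ a → toℚ a ≡ mkℚ (ℤ.+ a) 0 (Coprime.sym (1-coprimeTo a))
  toℚ-mkℚ a = ℚ.↥p/↧p≡p (mkℚ (ℤ.+ a) 0 (Coprime.sym (1-coprimeTo a)))

  toℚ-reflects-≤ : ∀ {a b} → toℚ a ≤ℚ toℚ b → a ≤ b
  toℚ-reflects-≤ {a} {b} h rewrite toℚ-mkℚ a | toℚ-mkℚ b = ℤ.drop‿+≤+
    (ℤ.≤-trans (ℤ.≤-reflexive (sym (ℤ.*-identityʳ (ℤ.+ a)))) (ℤ.≤-trans (ℚ.drop-*≤* h) (ℤ.≤-reflexive (ℤ.*-identityʳ (ℤ.+ b)))))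

  toℚ-+ : ∀ a b → toℚ (a + b) ≡ toℚ a +ℚ toℚ b
  toℚ-+ a b rewrite toℚ-mkℚ a | toℚ-mkℚ b =
    ℚ./-cong (trans (ℤ.pos-+ a b) (cong₂ ℤ._+_ (sym (ℤ.*-identityʳ (ℤ.+ a))) (sym (ℤ.*-identityʳ (ℤ.+ b))))) refl

  toℚ-* : ∀ a b → toℚ (a * b) ≡ toℚ a *ℚ toℚ b
  toℚ-* a b rewrite toℚ-mkℚ a | toℚ-mkℚ b = ℚ./-cong (ℤ.pos-* a b) refl

  clear-denominator : ∀ N q′ .(cop : Coprime.Coprime N (suc q′)) → toℚ (suc q′) *ℚ mkℚ (ℤ.+ N) q′ cop ≡ toℚ N
  clear-denominator N q′ cop rewrite toℚ-mkℚ (suc q′) =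
    ℚ.fromℚᵘ-cong {mkℚᵘ (ℤ.+ (suc q′) ℤ.* ℤ.+ N) (q′ + 0)} {mkℚᵘ (ℤ.+ N) 0}
      (*≡* (trans (ℤ.*-identityʳ (ℤ.+ (suc q′) ℤ.* ℤ.+ N)) (trans (ℤ.*-comm (ℤ.+ (suc q′)) (ℤ.+ N))
        (cong (λ z → ℤ.+ N ℤ.* ℤ.+ (suc z)) (sym (+-identityʳ q′))))))

  toℚ-nonNegative : ∀ a → ℚ.NonNegative (toℚ a)
  toℚ-nonNegative a = subst ℚ.NonNegative (sym (toℚ-mkℚ a)) _

  open +-*-Solver renaming (solve to ℚ-solve)

  -- `Q` is the denominator of `c` and `X` is `Q(c - 1)`. After multiplication by `Q`, the fraction
  -- `c` occurs only in the product `Q c`, which the equation replaces.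
  scale₁ : ∀ A c o D w Q X → Q *ℚ c ≡ X +ℚ o *ℚ Q → .{{ℚ.NonNegative Q}} →
    (A *ℚ c) -ℚ ((c -ℚ o) *ℚ D) ≤ℚ A *ℚ w → A *ℚ (X +ℚ o *ℚ Q) ≤ℚ (X *ℚ D) +ℚ (A *ℚ Q) *ℚ w
  scale₁ A c o D w Q X h ineq = subst₂ _≤ℚ_
    (trans (left A c o D Q X) (trans (cong (λ z → (A *ℚ z) -ℚ ((z -ℚ o *ℚ Q) *ℚ D) +ℚ X *ℚ D) h) (cancel A o D Q X)))
    (right A w Q X D)
    (ℚ.+-monoˡ-≤ (X *ℚ D) (ℚ.*-monoʳ-≤-nonNeg Q ineq))
    where
    left : ∀ A c o D Q X → ((A *ℚ c) -ℚ ((c -ℚ o) *ℚ D)) *ℚ Q +ℚ X *ℚ D ≡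
      (A *ℚ (Q *ℚ c)) -ℚ ((Q *ℚ c -ℚ o *ℚ Q) *ℚ D) +ℚ X *ℚ D
    left = ℚ-solve 6 (λ A c o D Q X → ((A :* c) :- ((c :- o) :* D)) :* Q :+ X :* D :=
      (A :* (Q :* c)) :- ((Q :* c :- o :* Q) :* D) :+ X :* D) refl
    cancel : ∀ A o D Q X → (A *ℚ (X +ℚ o *ℚ Q)) -ℚ ((X +ℚ o *ℚ Q -ℚ o *ℚ Q) *ℚ D) +ℚ X *ℚ D ≡ A *ℚ (X +ℚ o *ℚ Q)
    cancel = ℚ-solve 5 (λ A o D Q X → (A :* (X :+ o :* Q)) :- ((X :+ o :* Q :- o :* Q) :* D) :+ X :* D := A :* (X :+ o :* Q)) refl
    right : ∀ A w Q X D → (A *ℚ w) *ℚ Q +ℚ X *ℚ D ≡ (X *ℚ D) +ℚ (A *ℚ Q) *ℚ w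
    right = ℚ-solve 5 (λ A w Q X D → (A :* w) :* Q :+ X :* D := (X :* D) :+ (A :* Q) :* w) refl

  scale₂ : ∀ A c o w s Q X Y → Q *ℚ c ≡ X +ℚ o *ℚ Q → Q *ℚ c ≡ Y +ℚ A *ℚ Q → .{{ℚ.NonNegative Q}} →
    (A *ℚ (c -ℚ o)) *ℚ w ≤ℚ ((c -ℚ A) *ℚ s) +ℚ (A *ℚ (c -ℚ o)) → (A *ℚ X) *ℚ w ≤ℚ Y *ℚ s +ℚ A *ℚ X
  scale₂ A c o w s Q X Y hX hY ineq = subst₂ _≤ℚ_
    (trans (left A c o w Q) (trans (cong (λ z → (A *ℚ (z -ℚ o *ℚ Q)) *ℚ w) hX) (cancel₁ A o w Q X)))
    (trans (right A c o s Q) (trans (cong₂ (λ y z → (y -ℚ A *ℚ Q) *ℚ s +ℚ A *ℚ (z -ℚ o *ℚ Q)) hY hX) (cancel₂ A o s Q X Y)))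
    (ℚ.*-monoʳ-≤-nonNeg Q ineq)
    where
    left : ∀ A c o w Q → ((A *ℚ (c -ℚ o)) *ℚ w) *ℚ Q ≡ (A *ℚ (Q *ℚ c -ℚ o *ℚ Q)) *ℚ w
    left = ℚ-solve 5 (λ A c o w Q → ((A :* (c :- o)) :* w) :* Q := (A :* (Q :* c :- o :* Q)) :* w) refl
    cancel₁ : ∀ A o w Q X → (A *ℚ (X +ℚ o *ℚ Q -ℚ o *ℚ Q)) *ℚ w ≡ (A *ℚ X) *ℚ w
    cancel₁ = ℚ-solve 5 (λ A o w Q X → (A :* (X :+ o :* Q :- o :* Q)) :* w := (A :* X) :* w) refl
    right : ∀ A c o s Q → (((c -ℚ A) *ℚ s) +ℚ (A *ℚ (c -ℚ o))) *ℚ Q ≡ (Q *ℚ c -ℚ A *ℚ Q) *ℚ s +ℚ A *ℚ (Q *ℚ c -ℚ o *ℚ Q)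
    right = ℚ-solve 5 (λ A c o s Q → (((c :- A) :* s) :+ (A :* (c :- o))) :* Q :=
      (Q :* c :- A :* Q) :* s :+ A :* (Q :* c :- o :* Q)) refl
    cancel₂ : ∀ A o s Q X Y → (Y +ℚ A *ℚ Q -ℚ A *ℚ Q) *ℚ s +ℚ A *ℚ (X +ℚ o *ℚ Q -ℚ o *ℚ Q) ≡ Y *ℚ s +ℚ A *ℚ X
    cancel₂ = ℚ-solve 6 (λ A o s Q X Y → (Y :+ A :* Q :- A :* Q) :* s :+ A :* (X :+ o :* Q :- o :* Q) := Y :* s :+ A :* X) refl

  record Scaled (m′ : ℕ) (c : ℚ) : Set where
    field
      q′ β : ℕ
    open Weights m′ q′ β
    field
      component-bound : ∀ d w → (toℚ (2 * suc m′) *ℚ c) -ℚ ((c -ℚ toℚ 1) *ℚ toℚ d) ≤ℚ toℚ (2 * suc m′) *ℚ toℚ w →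
        2 * m * (α + q) ≤ α * d + W * w
      toughness-bound : ∀ s ω → (toℚ (2 * suc m′) *ℚ (c -ℚ toℚ 1)) *ℚ toℚ ω ≤ℚ
        ((c -ℚ toℚ (2 * suc m′)) *ℚ toℚ s) +ℚ (toℚ (2 * suc m′) *ℚ (c -ℚ toℚ 1)) → A * ω ≤ β * s + A

  scaled : ∀ m′ c → toℚ (2 * suc m′ + 1) ≤ℚ c → Scaled m′ c
  scaled m′ (mkℚ (ℤ.+ N) q′ cop) h = record
    { q′ = q′ ; β = β
    ; component-bound = λ d w ineq → toℚ-reflects-≤ {2 * m * (α + q)} {α * d + W * w} (subst₂ _≤ℚ_
        (sym (trans (toℚ-* (2 * m) (α + q)) (cong (toℚ (2 * m) *ℚ_) (trans (cong (λ z → toℚ (α + z)) (sym (*-identityˡ q)))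
          (trans (toℚ-+ α (1 * q)) (cong (toℚ α +ℚ_) (toℚ-* 1 q)))))))
        (sym (trans (toℚ-+ (α * d) (W * w)) (cong₂ _+ℚ_ (toℚ-* α d) (trans (toℚ-* W w) (cong (_*ℚ toℚ w) (toℚ-* (2 * m) q))))))
        (scale₁ (toℚ (2 * m)) (mkℚ (ℤ.+ N) q′ cop) (toℚ 1) (toℚ d) (toℚ w) (toℚ q) (toℚ α) hX {{toℚ-nonNegative q}} ineq))
    ; toughness-bound = λ s ω ineq → toℚ-reflects-≤ {A * ω} {β * s + A} (subst₂ _≤ℚ_
        (sym (trans (toℚ-* A ω) (cong (_*ℚ toℚ ω) (toℚ-* (2 * m) α))))
        (sym (trans (toℚ-+ (β * s) A) (cong₂ _+ℚ_ (toℚ-* β s) (toℚ-* (2 * m) α))))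
        (scale₂ (toℚ (2 * m)) (mkℚ (ℤ.+ N) q′ cop) (toℚ 1) (toℚ ω) (toℚ s) (toℚ q) (toℚ α) (toℚ β) hX hY {{toℚ-nonNegative q}} ineq)) }
    where
    β : ℕ
    -- With `c = N / q`, this is `q(c - 2m)`; the truncated subtraction is exact because `c` is at
    -- least `2m + 1`.
    β = N ∸ 2 * suc m′ * suc q′
    open Weights m′ q′ β
    enough : (2 * m + 1) * q ≤ N
    enough = ℤ.drop‿+≤+ (ℤ.≤-trans (ℤ.≤-reflexive (ℤ.pos-* (2 * m + 1) q))
      (ℤ.≤-trans (ℚ.drop-*≤* (subst (_≤ℚ mkℚ (ℤ.+ N) q′ cop) (toℚ-mkℚ (2 * m + 1)) h)) (ℤ.≤-reflexive (ℤ.*-identityʳ (ℤ.+ N)))))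
    N≡ : N ≡ β + 2 * m * q
    N≡ = sym (m∸n+n≡m (≤-trans (*-monoˡ-≤ q (m≤m+n (2 * m) 1)) enough))
    N≡′ : N ≡ α + 1 * q
    N≡′ = trans N≡ (eq m′ q′ β)
      where
      eq : ∀ m′ q′ β → β + 2 * suc m′ * suc q′ ≡ β + suc q′ + 2 * m′ * suc q′ + 1 * suc q′
      eq = solve-∀
    hX : toℚ q *ℚ mkℚ (ℤ.+ N) q′ cop ≡ toℚ α +ℚ toℚ 1 *ℚ toℚ q
    hX = trans (clear-denominator N q′ cop) (trans (cong toℚ N≡′) (trans (toℚ-+ α (1 * q)) (cong (toℚ α +ℚ_) (toℚ-* 1 q))))
    hY : toℚ q *ℚ mkℚ (ℤ.+ N) q′ cop ≡ toℚ β +ℚ toℚ (2 * m) *ℚ toℚ q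
    hY = trans (clear-denominator N q′ cop) (trans (cong toℚ N≡) (trans (toℚ-+ β (2 * m * q)) (cong (toℚ β +ℚ_) (toℚ-* (2 * m) q))))
  scaled m′ (mkℚ -[1+ N ] q′ cop) h = ⊥-elim (contra (ℤ.≤-trans (ℤ.≤-reflexive (ℤ.pos-* (2 * suc m′ + 1) (suc q′)))
      (ℚ.drop-*≤* (subst (_≤ℚ mkℚ -[1+ N ] q′ cop) (toℚ-mkℚ (2 * suc m′ + 1)) h))))
    where
    contra : ∀ {a} → ℤ.+ a ℤ.≤ -[1+ N ] ℤ.* ℤ.+ 1 → ⊥
    contra ()

-- Decidable search and conclusion

anyVec? : ∀ {a m k} {P : Vec (Fin m) k → Set a} → (∀ v → Dec (P v)) → Dec (∃ P)
anyVec? {k = zero} P? with P? []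
... | yes p = yes ([] , p)
... | no ¬p = no λ { ([] , p) → ¬p p }
anyVec? {k = suc k} P? with any? (λ c → anyVec? (λ v → P? (c ∷ v)))
... | yes (c , v , p) = yes (c ∷ v , p)
... | no ¬p = no λ { (c ∷ v , p) → ¬p (c , v , p) }

module Solving (G : Graph) where
  open Graph G
  open Multigraph G
  open Partition s t

  sparse? : ∀ m X → Dec (Sparse m X)
  sparse? m X = decide (anySubset? λ p →
      any? (λ v → lookup p v ≟B true) ×-dec (suc (m * count (lookup p)) ≤? E X (lookup p) + m))
    where
    decide : Dec (∃ λ p → (∃ λ v → lookup p v ≡ true) × suc (m * count (lookup p)) ≤ E X (lookup p) + m) → Dec (Sparse m X)
    decide (yes (p , (v , v∈p) , violated)) = no λ sp → <⇒≱ violated (sp (lookup p) v v∈p)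
    decide (no none) = yes λ W v v∈W → ≮⇒≥ λ violated → none (tabulate W , (v , trans (lookup∘tabulate W v) v∈W) ,
      ≤-trans (≤-trans (≤-reflexive (cong (λ z → suc (m * z)) (count-ext (lookup∘tabulate W)))) violated)
        (+-monoˡ-≤ m (E-⊆ X λ w h → trans (lookup∘tabulate W w) h)))

  forests-sparse : ∀ {m A col} → Forests {m} A col → Sparse m A
  forests-sparse {m} {A} {col} forests W v v∈W = ≤-trans (≤-reflexive (sym total))
      (≤-trans (sum-mono λ i → ≤-trans (forests i W v v∈W) (≤-reflexive (*-identityˡ _))) (≤-reflexive (sum-const m (count W))))
    where
    total : sum (λ i → E (part A col i) W + 1) ≡ E A W + m
    total = trans (sum-+ _ _) (cong₂ _+_ (part-sum A col W) (trans (sum-const m 1) (*-identityʳ m)))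

  empty-sparse : ∀ {m} → Sparse m (λ _ → false)
  empty-sparse {m} W v v∈W = ≤-trans (≤-reflexive (cong (_+ m) (E-zero (λ _ → false) W λ _ → refl)))
    (≤-trans (≤-reflexive (sym (*-identityʳ m))) (mul-mono m (sum-≥1 _ v (≤-reflexive (cong [_] (sym v∈W))))))

  at : Fin n → ESet
  at v e = v == s e ∨ v == t e

  deg-count : ∀ X v → deg G X v ≡ count λ e → lookup X e ∧ at v e
  deg-count X v = trans (∣∣≡count (X ∩ˢ tabulate at′)) (sum-cong λ e → cong [_]
      (trans (lookup-zipWith _∧_ e X (tabulate at′)) (cong (lookup X e ∧_) (trans (lookup∘tabulate at′ e)
        (cong₂ _∨_ (sym (==-def v (s e))) (sym (==-def v (t e))))))))
    where
    at′ : ESet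
    at′ e = ⌊ v Fin.≟ proj₁ (ends e) ⌋ ∨ ⌊ v Fin.≟ proj₂ (ends e) ⌋

  lookup-∪ : ∀ (X : Subset k) (M : ESet) e → lookup (X ∪ˢ tabulate M) e ≡ lookup X e ∨ M e
  lookup-∪ X M e = trans (lookup-zipWith _∨_ e X (tabulate M)) (cong (lookup X e ∨_) (lookup∘tabulate M e))

  deg-∪ : ∀ X M v → deg G (X ∪ˢ tabulate M) v ≤ deg G X v + count (λ e → M e ∧ at v e)
  deg-∪ X M v = ≤-trans (≤-reflexive (deg-count (X ∪ˢ tabulate M) v)) (≤-trans
      (sum-mono₁₂ λ e → ≤-trans (≤-reflexive (cong (λ b → [ b ∧ at v e ]) (lookup-∪ X M e))) (aux (lookup X e) (M e) (at v e)))
      (≤-reflexive (cong (_+ count (λ e → M e ∧ at v e)) (sym (deg-count X v)))))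
    where
    aux : ∀ x y a → [ (x ∨ y) ∧ a ] ≤ [ x ∧ a ] + [ y ∧ a ]
    aux = toWitness {a? = ∀B? λ x → ∀B? λ y → ∀B? λ a → _ ≤? _} tt

  deg-∪≥ : ∀ X M v → deg G X v ≤ deg G (X ∪ˢ tabulate M) v
  deg-∪≥ X M v = ≤-trans (≤-reflexive (deg-count X v)) (≤-trans
      (sum-mono λ e → ≤-trans (aux (lookup X e) (M e) (at v e)) (≤-reflexive (cong (λ b → [ b ∧ at v e ]) (sym (lookup-∪ X M e)))))
      (≤-reflexive (sym (deg-count (X ∪ˢ tabulate M) v))))
    where
    aux : ∀ x y a → [ x ∧ a ] ≤ [ (x ∨ y) ∧ a ]
    aux = toWitness {a? = ∀B? λ x → ∀B? λ y → ∀B? λ a → _ ≤? _} tt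

  module Search (m′ : ℕ) (F : Subset k) (u : Fin n) where
    open Bases G m′ F using (m₀)

    -- Tree-connectedness is replaced by finite data with a decidable test: `A` is tight on the
    -- whole vertex set and coloured by `m` forests, which are then spanning trees. An exhaustive
    -- search can thus remove the double negations of the argument.
    Solution : Subset k → Subset k → Vec (Fin m₀) k → Set
    Solution A H col = F ⊆ H × (∀ e → lookup A e ≡ true → lookup H e ≡ true) ×
      (∀ v → deg G H v ≤ deg G F v + 1) × deg G H u ≡ deg G F u ×
      Tight m₀ (lookup A) all-vertices × (∀ i → Sparse 1 (part (lookup A) (lookup col) i))

    solution? : ∀ A H col → Dec (Solution A H col)
    solution? A H col = F ⊆? H ×-dec all? (λ e → lookup A e ≟B true →-dec lookup H e ≟B true) ×-dec
      all? (λ v → deg G H v ≤? deg G F v + 1) ×-dec deg G H u ≟ deg G F u ×-dec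
      (_ ≤? _) ×-dec all? (λ i → sparse? 1 _)

    solve-by-contradiction : ((∀ A H col → ¬ Solution A H col) → ⊥) →
      Σ (Subset k) λ H → F ⊆ H × TreeConnected G m₀ H ⊤ × (∀ v → deg G H v ≤ deg G F v + 1) × deg G H u ≡ deg G F u
    solve-by-contradiction absurd = extract (anySubset? λ A → anySubset? λ H → anyVec? λ col → solution? A H col)
      where
      extract : Dec (∃ λ A → ∃ λ H → ∃ λ col → Solution A H col) → Σ (Subset k) λ H →
        F ⊆ H × TreeConnected G m₀ H ⊤ × (∀ v → deg G H v ≤ deg G F v + 1) × deg G H u ≡ deg G F u
      extract (no none) = ⊥-elim (absurd λ A H col sol → none (A , H , col , sol))
      extract (yes (A , H , col , F⊆H , A⊆H , deg≤ , deg≡ , tight , forests)) = H , F⊆H ,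
        subst (TreeConnected G m₀ H) (⊆-antisym (λ _ → ∈⊤) (λ _ → ∈-tabulate⁺ refl))
          (treeConnected {W = all-vertices} {v = u} H forests (forests-sparse forests) tight refl λ e h → true⇒∈ (A⊆H e h)) ,
        deg≤ , deg≡

  module Main (m′ q′ β : ℕ) (F : Subset k) (u : Fin n) where
    open Weights m′ q′ β
    open Search m′ F u
    open Bases G m′ F using (class; class-component; class-degree; boundary≤degree; coarse-bound)

    module _ (small : ∀ C → TreeComponent G m F C → 2 * m * (α + q) ≤ α * boundary G F C + W * ∣ C ∣)
             (tough : ∀ (S : Subset n) ω → NumComponents G S ω → A * ω ≤ β * ∣ S ∣ + A) where

      module WithBase (B : ESet) (B⊆F : ∀ e → B e ≡ true → lookup F e ≡ true) (sparseB : Sparse m B)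
                      (maximalB : ∀ e → lookup F e ≡ true → B e ≡ false → ¬ Sparse m (insert B e)) where
        open LocalSearch s t m (lookup F) B u B⊆F

        at-inc : ∀ {v e} → at v e ≡ true → Inc v e
        at-inc {v} {e} h with ∨-elim (v == s e) h
        ... | inj₁ p = inj₁ (sym (==⇒≡ p))
        ... | inj₂ p = inj₂ (sym (==⇒≡ p))

        solution : ∀ M → Feasible M → Tight m (with-base M) all-vertices → (∀ A H col → ¬ Solution A H col) → ⊥
        solution M feasible tight none = arboricity (with-base M) sparse λ col forests →
            none (tabulate (with-base M)) H (tabulate col)
              (p⊆p∪q _ , A⊆H , (λ v → ≤-trans (deg-∪ F M v) (+-monoʳ-≤ (deg G F v) (degree≤1 v))) ,
               ≤-antisym (≤-trans (deg-∪ F M u) (≤-reflexive (trans (cong (deg G F u +_) degree-u) (+-identityʳ _)))) (deg-∪≥ F M u) ,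
               tight-⊆ (λ e _ h → trans (lookup∘tabulate _ e) h) tight ,
               λ i → sparse-⊆ (λ e h → trans (sym (cong₂ (λ a c → a ∧ i == c) (lookup∘tabulate _ e) (lookup∘tabulate col e))) h) (forests i))
          where
          open Feasible feasible
          H : Subset k
          H = F ∪ˢ tabulate M
          A⊆H : ∀ e → lookup (tabulate (with-base M)) e ≡ true → lookup H e ≡ true
          A⊆H e h with ∨-elim (B e) (trans (sym (lookup∘tabulate (with-base M) e)) h)
          ... | inj₁ b = trans (lookup-∪ F M e) (∨-left (M e) (B⊆F e b))
          ... | inj₂ p = trans (lookup-∪ F M e) (∨-right (lookup F e) p)
          degree≤1 : ∀ v → count (λ e → M e ∧ at v e) ≤ 1
          degree≤1 v = at-most-one _ λ e e′ h h′ → matching (∧-left (M e) h) (∧-left (M e′) h′)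
            (at-inc (∧-right (M e) h)) (at-inc (∧-right (M e′) h′))
          degree-u : count (λ e → M e ∧ at u e) ≡ 0
          degree-u = sum-zero λ e → cong [_] (≢true λ h → avoids e (∧-left (M e) h) (at-inc (∧-right (M e) h)))

        module Deficit (M : ESet) (feasible : Feasible M) (maximum : ∀ N → Feasible N → count N ≤ count M)
                       (deficit : ¬ Tight m (with-base M) all-vertices) where

          -- An unsaturated vertex is free at once: `M` itself serves as the matching and the
          -- singleton as the tight set.
          saturated-frozen : ∀ {S} → Frozen M feasible maximum S → ∀ v → S v ≡ true → ¬ Unsaturated M v
          saturated-frozen empty v ()
          saturated-frozen (add {S} {z} frozen ¬free) v v∈ unsat with ∨-elim (S v) v∈
          ... | inj₁ p = saturated-frozen frozen v p unsat
          ... | inj₂ p with ==⇒≡ p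
          ...   | refl = ¬free record { N = M ; feasibleN = feasible ; size = refl ; Z = z ==_
                            ; tightZ = singleton-tight z ; v∈Z = ==-refl z ; agree = λ _ _ → refl ; unsaturated = unsat }

          module AtFrozen (S : VSet) (frozen : Frozen M feasible maximum S)
                          (free : ∀ v → S v ≡ false → ¬ ¬ Free M feasible maximum S v)
                          (CJ : Classes m (restrict S M)) (CB : Classes m B) where
            open Classes CJ using (cls; root; max; #classes)
            open Covering s t CJ S

            u∈S : S u ≡ true
            u∈S with bool-cases (S u)
            ... | inj₁ h = h
            ... | inj₂ h = ⊥-elim (free u h λ f → proj₁ (Free.unsaturated f) refl)

            saturated : ∀ v → S v ≡ true → v ≢ u → ∃ λ e → M e ≡ true × Inc v e
            saturated v v∈S v≢u with any? (λ e → M e ∧ at v e ≟B true)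
            ... | yes (e , h) = e , ∧-left (M e) h , at-inc (∧-right (M e) h)
            ... | no none = ⊥-elim (saturated-frozen frozen v v∈S (v≢u , λ e e∈M i → none (e , true-∧ e∈M (inc-at i))))
              where
              inc-at : ∀ {e} → Inc v e → at v e ≡ true
              inc-at {e} (inj₁ refl) = ∨-left (s e == t e) (==-refl (s e))
              inc-at {e} (inj₂ refl) = ∨-right (t e == s e) (==-refl (t e))

            crossing-closed : ∀ e → touchesS e ≡ false → cls (s e) ≢ cls (t e) → restrict S M e ≡ true
            crossing-closed e untouched ≢ with bool-cases (restrict S M e)
            ... | inj₁ h = h
            ... | inj₂ h = ⊥-elim (closure M feasible maximum frozen free maximalB sparseB e untouched h
                    λ W tW e∈W → ≢ (max tW (ins-s W {e} e∈W) (ins-t W {e} e∈W)))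

            base-bound : ∀ i → Classes.root CB i ≡ true →
              2 * m * (α + q) ≤ α * class-degree B B⊆F CB maximalB i + W * count (λ v → Classes.cls CB v == i)
            base-bound i rooti = ≮⇒≥ λ violated → class-component B B⊆F CB maximalB i rooti λ component →
              <⇒≱ violated (enlarge (class-degree B B⊆F CB maximalB i) (count λ v → Classes.cls CB v == i)
                (small (class B B⊆F CB maximalB i) component)
                (boundary≤degree B B⊆F CB maximalB i) (count-tabulate λ v → Classes.cls CB v == i))

            class-bound : ∀ i → root i ≡ true → 2 * m * (α + q) ≤ α * degree i + W * count (λ v → cls v == i)
            class-bound = coarse-bound B B⊆F CB maximalB CJ (λ e h → ∨-left _ h) α q base-bound

            module Conclude (𝒩 : Fin n → Bool) (isGreedy : Greedy 𝒩) where
              open Cover 𝒩 isGreedy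

              deficit′ : E (with-base M) all-vertices + 1 + m ≤ m * count {n} all-vertices
              deficit′ = ≤-trans (≤-reflexive (trans (+-assoc (E (with-base M) all-vertices) 1 m) (+-suc _ m))) (≰⇒> deficit)

              lower : suc (β * count S′ + A) ≤ A * #classes 𝒩
              lower = Deficient.deficient-bound s t m′ (lookup F) B u B⊆F M feasible S u∈S saturated q′ β CJ class-bound
                deficit′ 𝒩 isGreedy

              constant : ∀ e → lookup (tabulate S′) (s e) ≡ false → lookup (tabulate S′) (t e) ≡ false → cls (s e) ≡ cls (t e)
              constant e h h′ = S′-separates crossing-closed e (trans (sym (lookup∘tabulate S′ (s e))) h)
                (trans (sym (lookup∘tabulate S′ (t e))) h′)

              witness : ∀ i → root i ∧ 𝒩 i ≡ true → ∃ λ v → cls v ≡ i × lookup (tabulate S′) v ≡ false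
              witness i h = transport (survivor i (∧-right (root i) h))
                where
                transport : (∃ λ v → cls v ≡ i × S′ v ≡ false) → ∃ λ v → cls v ≡ i × lookup (tabulate S′) v ≡ false
                transport (v , p , v∉) = v , p , trans (lookup∘tabulate S′ v) v∉

              no-components : ¬ Σ ℕ (NumComponents G (tabulate S′))
              no-components (ω , components) = too-tough (#classes 𝒩) ω (count S′) ∣ tabulate S′ ∣ lower
                (Connectivity.components≥ G components cls (λ i → root i ∧ 𝒩 i) constant witness)
                (count-tabulate S′) (tough (tabulate S′) ω components)

          absurd : ⊥
          absurd = argmin {A = Σ VSet (Frozen M feasible maximum)} (λ S → n ∸ count (proj₁ S)) ((λ _ → false) , empty)
            λ { (S , frozen) least →
              classes (sparse-⊆ (restrict⊆ {S} {M}) (Feasible.sparse feasible)) λ CJ → classes sparseB λ CB →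
                conclude S frozen (λ v v∉S ¬free →
                  <⇒≱ (∸-monoʳ-< {n} (≤-reflexive (sym (count-insert S v v∉S))) (count≤ _)) (least (_ , add frozen ¬free))) CJ CB
                  (Covering.greedy s t CJ S) }
            where
            conclude : ∀ S (frozen : Frozen M feasible maximum S) (free : ∀ v → S v ≡ false → ¬ ¬ Free M feasible maximum S v)
              (CJ : Classes m (restrict S M)) (CB : Classes m B) → Σ (Fin n → Bool) (Covering.Greedy s t CJ S) → ⊥
            conclude S frozen free CJ CB (𝒩 , isGreedy) =

              AtFrozen.Conclude.no-components S frozen free CJ CB 𝒩 isGreedy
                (Connectivity.numComponents G (tabulate (Covering.Cover.S′ s t CJ S 𝒩 isGreedy)))

        absurd : (∀ A H col → ¬ Solution A H col) → ⊥
        absurd none = argmin {A = Σ ESet Feasible} (λ M → k ∸ count (proj₁ M))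
            ((λ _ → false) , record { new = λ _ () ; sparse = sparse-⊆ (λ e → base e) sparseB
                                    ; matching = λ () ; avoids = λ _ () })
            λ { (M , feasible) least → by-cases (Tight m (with-base M) all-vertices)
                  (λ tight → solution M feasible tight none)
                  (λ deficit → Deficit.absurd M feasible
                    (λ N feasibleN → ≮⇒≥ λ larger → <⇒≱ (∸-monoʳ-< larger (count≤ N)) (least (N , feasibleN))) deficit) }
          where
          base : ∀ e → B e ∨ false ≡ true → B e ≡ true
          base e h with ∨-elim (B e) h
          ... | inj₁ p = p

      result : Σ (Subset k) λ H →
        F ⊆ H × TreeConnected G m H ⊤ × (∀ v → deg G H v ≤ deg G F v + 1) × deg G H u ≡ deg G F u
      result = solve-by-contradiction λ none →
        argmin {A = Σ ESet λ B → (∀ e → B e ≡ true → lookup F e ≡ true) × Sparse m B} (λ B → k ∸ count (proj₁ B))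
          ((λ _ → false) , (λ _ ()) , empty-sparse)
          λ { (B , B⊆F , sparseB) least → WithBase.absurd B B⊆F sparseB (λ e e∈F e∉B sp →
                <⇒≱ (∸-monoʳ-< {k} (≤-reflexive (sym (count-insert B e e∉B))) (count≤ _))
                  (least (insert B e , inserted B B⊆F e e∈F , sp))) none }
        where
        inserted : ∀ B → (∀ e → B e ≡ true → lookup F e ≡ true) → ∀ e → lookup F e ≡ true →
          ∀ e′ → insert B e e′ ≡ true → lookup F e′ ≡ true
        inserted B B⊆F e e∈F e′ h with ∨-elim (B e′) h
        ... | inj₁ p = B⊆F e′ p
        ... | inj₂ p = subst (λ z → lookup F z ≡ true) (==⇒≡ p) e∈F

theorem7p9 : (m : ℕ) → 1 ≤ m → (c : ℚ) → toℚ (2 * m + 1) ≤ℚ c →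
    (G : Graph) → (F : Subset (Graph.k G)) →
    (∀ C → TreeComponent G m F C →
    (toℚ (2 * m) *ℚ c) -ℚ ((c -ℚ toℚ 1) *ℚ toℚ (boundary G F C)) ≤ℚ toℚ (2 * m) *ℚ toℚ ∣ C ∣) →
    (∀ (S : Subset (Graph.n G)) (ω : ℕ) → NumComponents G S ω →
    (toℚ (2 * m) *ℚ (c -ℚ toℚ 1)) *ℚ toℚ ω
    ≤ℚ ((c -ℚ toℚ (2 * m)) *ℚ toℚ ∣ S ∣) +ℚ (toℚ (2 * m) *ℚ (c -ℚ toℚ 1))) →
    (u : Fin (Graph.n G)) →
    Σ (Subset (Graph.k G)) λ H →
    (F ⊆ H) × TreeConnected G m H ⊤ ×
    (∀ v → deg G H v ≤ deg G F v + 1) × (deg G H u ≡ deg G F u)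
theorem7p9 (suc m′) _ c 2m+1≤c G F small tough u =
  Solving.Main.result G m′ q′ β F u
    (λ C component → component-bound (boundary G F C) ∣ C ∣ (small C component))
    (λ S ω components → toughness-bound ∣ S ∣ ω (tough S ω components))
  where
  open Rationals.Scaled (Rationals.scaled m′ c 2m+1≤c)
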